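{- Let $G=(V,E)$ be a directed graph with $n$ vertices, $m$ edges and strictly positive edge weights. The Min-2-DSP problem on $G$ is solvable in $O(m^2n^3)$ time. Moreover, the explicit paths can be reported in $O(m^2n^4)$ time.
   Context: The Min-2-DSP problem: given $G$ and terminal pairs $(s_1,t_1)$, $(s_2,t_2)$ (with $t_i$ reachable from $s_i$), find the minimum, over all pairs $(P_1,P_2)$ where $P_i$ is a shortest (minimum total weight) path from $s_i$ to $t_i$, of the number $|V(P_1)\cap V(P_2)|$ of vertices common to $P_1$ and $P_2$; reporting means outputting a pair $(P_1,P_2)$ attaining this minimum. Running times refer to (possibly randomized, Monte Carlo) algorithms in the word-RAM model with $O(\log n)$-bit words. -}

module Defs where

open import Data.Fin using (Fin; toℕ)
open import Data.Fin.Subset using (Subset; ⁅_⁆; ⋃; _∩_; ∣_∣)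
open import Data.List using (List; []; _∷_; _++_; map; length; concatMap; allFin)
open import Data.List.Relation.Unary.All using (All)
open import Data.List.Relation.Unary.Unique.Propositional using (Unique)
open import Data.Nat
  using (ℕ; zero; suc; _+_; _*_; _∸_; _^_; _/_; _%_; _⊔_; _≤_; _<_; _≡ᵇ_; _<ᵇ_; ∣_-_∣)
open import Data.Nat.Logarithm using (⌊log₂_⌋)
open import Data.Nat.Properties using (m^n≢0; _≟_)
open import Data.Bool using (if_then_else_)
open import Data.Product using (Σ-syntax; ∃-syntax; _×_; _,_)
open import Data.Vec using (Vec; toList)
open import Data.Unit using (⊤)
open import Relation.Binary.Construct.Closure.ReflexiveTransitive using (Star; ε; _◅_)
open import Relation.Binary.PropositionalEquality using (_≡_; _≢_)
open import Relation.Nullary.Decidable using (does)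

record Digraph (n m : ℕ) : Set where
  field
    src tgt  : Fin m → Fin n
    weight   : Fin m → ℕ
    distinct : ∀ {e f} → src e ≡ src f → tgt e ≡ tgt f → e ≡ f
    positive : ∀ e → 0 < weight e

module _ {n m : ℕ} (G : Digraph n m) where
  open Digraph G

  Arc : Fin n → Fin n → Set
  Arc u v = Σ[ e ∈ Fin m ] (src e ≡ u × tgt e ≡ v)

  Walk : Fin n → Fin n → Set
  Walk = Star Arc

  vertices : ∀ {s t} → Walk s t → List (Fin n)
  vertices {s} ε       = s ∷ []
  vertices {s} (_ ◅ p) = s ∷ vertices p

  totalWeight : ∀ {s t} → Walk s t → ℕ
  totalWeight ε             = 0
  totalWeight ((e , _) ◅ p) = weight e + totalWeight p

  IsPath : ∀ {s t} → Walk s t → Set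
  IsPath p = Unique (vertices p)

  record ShortestPath (s t : Fin n) : Set where
    field
      walk     : Walk s t
      isPath   : IsPath walk
      shortest : ∀ (q : Walk s t) → IsPath q → totalWeight walk ≤ totalWeight q

record Instance (n m : ℕ) : Set where
  field
    graph       : Digraph n m
    s₁ t₁ s₂ t₂ : Fin n
    reachable₁  : Walk graph s₁ t₁
    reachable₂  : Walk graph s₂ t₂

module _ {n m : ℕ} (I : Instance n m) where
  open Instance I
  open ShortestPath

  ShortestPair : Set
  ShortestPair = ShortestPath graph s₁ t₁ × ShortestPath graph s₂ t₂

  vertices₁ vertices₂ : ShortestPair → List (Fin n)
  vertices₁ (P₁ , _) = vertices graph (walk P₁)
  vertices₂ (_ , P₂) = vertices graph (walk P₂)

  vertexSet : List (Fin n) → Subset n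
  vertexSet vs = ⋃ (map ⁅_⁆ vs)

  common : ShortestPair → ℕ
  common P = ∣ vertexSet (vertices₁ P) ∩ vertexSet (vertices₂ P) ∣

  Optimal : ShortestPair → Set
  Optimal P = ∀ Q → common P ≤ common Q

-- Registers are named by natural numbers (a program mentions only finitely
-- many).  Control flow is structured rather than by jumps; since a program
-- counter can be kept in a register, this changes running times by at most a
-- factor depending only on the program.

Reg : Set
Reg = ℕ

data Op : Set where
  add sub mul quo rem and or xor shl shr eq lt : Op

data Instr : Set where
  const  : Reg → ℕ → Instr              -- r := k
  move   : Reg → Reg → Instr            -- r := x
  arith  : Op → Reg → Reg → Reg → Instr -- r := x op y
  load   : Reg → Reg → Instr            -- r := mem[x]
  store  : Reg → Reg → Instr            -- mem[x] := y
  random : Reg → Instr                  -- r := uniformly random word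

infixr 5 _⨾_

data Program : Set where
  skip  : Program
  instr : Instr → Program
  _⨾_   : Program → Program → Program
  ifnz  : Reg → Program → Program → Program
  while : Reg → Program → Program

-- `tape` holds the random words still to be drawn.
record State : Set where
  constructor ⟨_,_,_⟩
  field
    reg  : Reg → ℕ
    mem  : ℕ → ℕ
    tape : List ℕ

open State public

infixl 6 _[_↦_]

_[_↦_] : (ℕ → ℕ) → ℕ → ℕ → (ℕ → ℕ)
(f [ a ↦ v ]) b = if does (b ≟ a) then v else f b

trunc : ℕ → ℕ → ℕ
trunc w x = _%_ x (2 ^ w) {{m^n≢0 2 w}}

bitwise : (ℕ → ℕ → ℕ) → ℕ → ℕ → ℕ → ℕ
bitwise f zero    x y = 0
bitwise f (suc w) x y = f (x % 2) (y % 2) + 2 * bitwise f w (x / 2) (y / 2)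

evalOp : ℕ → Op → ℕ → ℕ → ℕ
evalOp w add x y       = trunc w (x + y)
evalOp w sub x y       = trunc w (x + (2 ^ w ∸ y))
evalOp w mul x y       = trunc w (x * y)
evalOp w quo x zero    = 0
evalOp w quo x (suc y) = trunc w (x / suc y)
evalOp w rem x zero    = 0
evalOp w rem x (suc y) = trunc w (x % suc y)
evalOp w and x y       = bitwise _*_ w x y
evalOp w or  x y       = bitwise _⊔_ w x y
evalOp w xor x y       = bitwise ∣_-_∣ w x y
evalOp w shl x y       = trunc w (x * 2 ^ y)
evalOp w shr x y       = trunc w (_/_ x (2 ^ y) {{m^n≢0 2 y}})
evalOp w eq  x y       = trunc w (if x ≡ᵇ y then 1 else 0)
evalOp w lt  x y       = trunc w (if x <ᵇ y then 1 else 0)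

module Semantics (w : ℕ) where

  data Exec : Instr → State → State → Set where
    const  : ∀ {r k f M ω} →
             Exec (const r k) ⟨ f , M , ω ⟩ ⟨ f [ r ↦ trunc w k ] , M , ω ⟩
    move   : ∀ {r x f M ω} →
             Exec (move r x) ⟨ f , M , ω ⟩ ⟨ f [ r ↦ f x ] , M , ω ⟩
    arith  : ∀ {o r x y f M ω} →
             Exec (arith o r x y) ⟨ f , M , ω ⟩
                  ⟨ f [ r ↦ evalOp w o (f x) (f y) ] , M , ω ⟩
    load   : ∀ {r x f M ω} →
             Exec (load r x) ⟨ f , M , ω ⟩ ⟨ f [ r ↦ M (f x) ] , M , ω ⟩
    store  : ∀ {x y f M ω} →
             Exec (store x y) ⟨ f , M , ω ⟩ ⟨ f , M [ f x ↦ f y ] , ω ⟩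
    random : ∀ {r f M v ω} →
             Exec (random r) ⟨ f , M , v ∷ ω ⟩ ⟨ f [ r ↦ v ] , M , ω ⟩

  -- Run p σ t τ: started in σ, p halts in state τ after t time steps.
  data Run : Program → State → ℕ → State → Set where
    skip      : ∀ {σ} → Run skip σ 1 σ
    instr     : ∀ {i σ τ} → Exec i σ τ → Run (instr i) σ 1 τ
    seq       : ∀ {p q σ τ υ a b} →
                Run p σ a τ → Run q τ b υ → Run (p ⨾ q) σ (a + b) υ
    if-nz     : ∀ {r p q σ τ a} → reg σ r ≢ 0 →
                Run p σ a τ → Run (ifnz r p q) σ (1 + a) τ
    if-z      : ∀ {r p q σ τ a} → reg σ r ≡ 0 →
                Run q σ a τ → Run (ifnz r p q) σ (1 + a) τ
    while-nz  : ∀ {r p σ τ υ a b} → reg σ r ≢ 0 →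
                Run p σ a τ → Run (while r p) τ b υ →
                Run (while r p) σ (1 + a + b) υ
    while-z   : ∀ {r p σ} → reg σ r ≡ 0 → Run (while r p) σ 1 σ

-- The entry of xs at a position, or 0 beyond its end.
at : List ℕ → ℕ → ℕ
at []       _       = 0
at (x ∷ _)  zero    = x
at (_ ∷ xs) (suc a) = at xs a

-- The input occupies memory from address 0 on; so does the output: the optimal
-- value, or each path as its number of vertices followed by the vertices.
inputList : ∀ {n m} → Instance n m → List ℕ
inputList {n} {m} I =
  n ∷ m ∷ toℕ s₁ ∷ toℕ t₁ ∷ toℕ s₂ ∷ toℕ t₂ ∷
  concatMap (λ e → toℕ (src e) ∷ toℕ (tgt e) ∷ weight e ∷ []) (allFin m)
  where
  open Instance I
  open Digraph graph

initial : ∀ {n m} → ℕ → Instance n m → List ℕ → State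
initial w I ω = ⟨ (λ _ → 0) , (λ a → trunc w (at (inputList I) a)) , ω ⟩

Answer : Set₁
Answer = ∀ {n m} → Instance n m → (ℕ → ℕ) → Set

MinValue : Answer
MinValue I M = ∃[ P ] (Optimal I P × M 0 ≡ common I P)

pairList : ∀ {n m} (I : Instance n m) → ShortestPair I → List ℕ
pairList I P = block (vertices₁ I P) ++ block (vertices₂ I P)
  where
  block : List (Fin _) → List ℕ
  block vs = length vs ∷ map toℕ vs

MinPair : Answer
MinPair I M =
  ∃[ P ] (Optimal I P × (∀ a → a < length (pairList I P) → M a ≡ at (pairList I P) a))

Tape : ℕ → ℕ → Set
Tape w T = Vec (Fin (2 ^ w)) T

-- A uniformly random tape has the property E with probability at least 2/3:
-- at least two thirds of all (2 ^ w) ^ T tapes have it.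
Likely : ∀ {w T} → (Tape w T → Set) → Set
Likely {w} {T} E =
  ∃[ ωs ] (Unique ωs × All E ωs × 2 * (2 ^ w) ^ T ≤ 3 * length ωs)

-- c times the number of binary digits of n (for n ≥ 1).
bits : ℕ → ℕ → ℕ
bits c n = c * (1 + ⌊log₂ n ⌋)

-- Weights have c-log-n bits for an arbitrary constant c; the algorithm may use
-- words of k-log-n bits for a constant k of its choice.  The summand 1 matters
-- only where f vanishes (no edges), when no program halts in time 0.  A run of
-- at most T steps draws at most T random words, so tapes of length T suffice.
SolvableInTime : Answer → (ℕ → ℕ → ℕ) → Set
SolvableInTime Correct f =
  ∀ (c : ℕ) → ∃[ k ] Σ[ p ∈ Program ] ∃[ C ]
  ∀ {n m : ℕ} (I : Instance n m) →
  (∀ e → Digraph.weight (Instance.graph I) e < 2 ^ bits c n) →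
  let w = bits k n
      T = C * (1 + f n m)
      HaltsIn : Tape w T → ((ℕ → ℕ) → Set) → Set
      HaltsIn ω Post =
        ∃[ t ] ∃[ τ ] (Semantics.Run w p (initial w I (map toℕ (toList ω))) t τ
                       × t ≤ T × Post (mem τ))
  in (∀ ω → HaltsIn ω (λ _ → ⊤)) × Likely {w} {T} (λ ω → HaltsIn ω (Correct I))

-- Let gᵢ v be a large constant minus the distance from v to tᵢ.  The shortest
-- paths from sᵢ to tᵢ are the paths of tight arcs, along which gᵢ grows by exactly
-- the weight.  Hence the level g₁ − g₂ never falls along the first path and never
-- rises along the second one, and a tight arc of either path that stays on its
-- level is tight for both.  So the first path is followed forwards and the second
-- one backwards from level to level; inside a level both run towards larger g₁.
-- A state of the dynamic program consists of the current vertex u of the first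
-- path, the ends v and y of what remains of the second path on its current level,
-- and the last vertex z before it entered that level.  A move advances whichever
-- path is behind, and costs 1 if the first path leaves u while v = u.
-- There are O(m n³) moves and a pair of paths is assembled by at most 2 m + 3 of
-- them, so 2 m + 4 rounds of relaxing all moves take time O(m² n³).  To report the
-- paths, every state also carries the successors of their vertices, which makes a
-- relaxation cost O(n).  Instances without arcs are answered directly.

module Submission where

open import Defs
open import Data.Bool using (Bool; true; false; if_then_else_; T)
open import Data.Fin using (Fin; toℕ; fromℕ<; combine)
import Data.Fin.Properties as Fin
open import Data.Fin.Subset using (Subset; ⁅_⁆; ⋃; _∩_; _∪_; ∣_∣; inside; outside)
  renaming (_∈_ to _∈ₛ_; _∉_ to _∉ₛ_)
import Data.Fin.Subset.Properties as Sub
open import Data.List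
  using (List; []; _∷_; _++_; map; length; lookup; concatMap; allFin; tabulate; cartesianProductWith)
open import Data.List.Membership.Propositional using (_∈_; _∉_)
open import Data.List.Membership.Propositional.Properties
  using (∈-lookup; ∈-++⁺ˡ; ∈-++⁺ʳ; ∈-++⁻; ∈-map⁺; ∈-map⁻)
open import Data.List.Properties using (length-++; length-map; length-tabulate; ++-assoc; ++-identityʳ)
open import Data.List.Relation.Unary.All as All using (All; []; _∷_)
open import Data.List.Relation.Unary.AllPairs using ([]; _∷_)
open import Data.List.Relation.Unary.Any using (here; there)
open import Data.List.Relation.Unary.Unique.Propositional using (Unique)
import Data.List.Relation.Unary.Unique.Propositional.Properties as Unique
open import Data.Nat
open import Data.Nat.DivMod using (m<n⇒m%n≡m; [m+n]%n≡m%n)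
open import Data.Nat.Logarithm using (⌊log₂_⌋; ⌊log₂⌋-mono-≤; ⌊log₂[2^n]⌋≡n)
open import Data.Nat.Properties
open import Data.Nat.Solver using (module +-*-Solver)
open import Data.List.Membership.DecPropositional _≟_ using (_∈?_)
open import Data.Product using (Σ-syntax; ∃-syntax; _×_; _,_; proj₁; proj₂)
open import Data.Sum using (_⊎_; inj₁; inj₂)
open import Data.Unit using (⊤; tt)
open import Data.Vec using ([]; _∷_; here; there; toList)
import Data.Vec.Properties as Vec
open import Relation.Binary.Construct.Closure.ReflexiveTransitive using (ε; _◅_)
open import Relation.Binary.Definitions using (tri<; tri≈; tri>)
open import Relation.Binary.PropositionalEquality
open import Relation.Nullary using (¬_; Dec; yes; no; contradiction)
open import Relation.Nullary.Decidable using (does; dec-true; dec-false)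

-- Being behind is measured by `K`, which orders vertices by level and, within a level, by g₁. `K`
-- grows along the first path; what remains of the second path runs through its level with growing
-- `K` and continues on higher levels. So when the path that is behind moves, the vertex it leaves
-- lies below all that remains of the other path, except possibly that path's current vertex. This
-- is why comparing u with v suffices to count common vertices. The table is updated in place.
-- Soundness therefore does not mention rounds: at any time a set entry is realised by actual paths,
-- and since the successors are copied together with the value, a later change of the source does no
-- harm. Completeness counts rounds, but asks for upper bounds only, which improvements within a
-- round cannot spoil. The value 0 is left to unset entries and to unreachable vertices: both paths
-- are extended through a common vertex `top`, which makes every cost positive, and distances are
-- subtracted from a constant above every path weight. The program is written in a language of
-- nested loops, so that its running time is a product of loop limits times a constant of the
-- program.

infixl 6 _⊕_ _⊖_
infixl 7 _⊗_
infix  5 _≺_ _≐_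

-- A structured command language, its meaning and its compilation

data Exp : Set where
  var                     : ℕ → Exp
  lit                     : ℕ → Exp
  _⊕_ _⊗_ _⊖_ _≺_ _≐_     : Exp → Exp → Exp
  inp                     : Exp → Exp
  arr                     : ℕ → Exp → Exp

infixr 4 _⨟_

-- `iter e c` runs c for each counter value below e and `bind e c` binds the
-- value of e; at nesting level Γ the new variable is number Γ (an iteration
-- also keeps its limit, as variable Γ + 1).
data Cmd : Set where
  nop         : Cmd
  _⨟_         : Cmd → Cmd → Cmd
  put         : ℕ → Exp → Exp → Cmd
  out         : Exp → Exp → Cmd
  cond        : Exp → Cmd → Cmd → Cmd
  iter bind   : Exp → Cmd → Cmd

-- Array 0 is the memory below the address `off`, where input and output live;
-- entry i of array j, for 0 < j < 16, is at address off + (16 * i + j).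
Mem : Set
Mem = ℕ → ℕ → ℕ

upd : Mem → ℕ → ℕ → ℕ → Mem
upd A j i v j′ = if j′ ≡ᵇ j then A j [ i ↦ v ] else A j′

bool : Bool → ℕ
bool b = if b then 1 else 0

eval : Exp → (ℕ → ℕ) → Mem → ℕ
eval (var x)   ρ A = ρ x
eval (lit k)   ρ A = k
eval (a ⊕ b)   ρ A = eval a ρ A + eval b ρ A
eval (a ⊗ b)   ρ A = eval a ρ A * eval b ρ A
eval (a ⊖ b)   ρ A = eval a ρ A ∸ eval b ρ A
eval (a ≺ b)   ρ A = bool (eval a ρ A <ᵇ eval b ρ A)
eval (a ≐ b)   ρ A = bool (eval a ρ A ≡ᵇ eval b ρ A)
eval (inp e)   ρ A = A 0 (eval e ρ A)
eval (arr j e) ρ A = A j (eval e ρ A)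

-- β B d = B ^ (2 ^ d) bounds an expression of depth d over variables and cells
-- below B.  It is opaque because β B depthLimit must never be unfolded.
opaque
  β : ℕ → ℕ → ℕ
  β B zero    = B
  β B (suc d) = β B d * β B d

  β-zero : ∀ B → β B zero ≡ B
  β-zero B = refl

  β-suc : ∀ B d → β B (suc d) ≡ β B d * β B d
  β-suc B d = refl

depthLimit : ℕ
depthLimit = 16

-- A product or a sum at most squares the bound. A literal k gets depth k because k < β B k, and
-- what is read from memory or results from a comparison is below B again, hence the depth 0.
depth : Exp → ℕ
depth (var x)   = 0
depth (lit k)   = k
depth (a ⊕ b)   = suc (depth a ⊔ depth b)
depth (a ⊗ b)   = suc (depth a ⊔ depth b)
depth (a ⊖ b)   = depth a ⊔ depth b
depth (a ≺ b)   = 0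
depth (a ≐ b)   = 0
depth (inp e)   = 0
depth (arr j e) = 0

-- For a concrete expression this computes to a product of unit types, which `_` fills in. An array
-- access asks for three spare levels because its address takes three more operations: scaling by
-- 16, adding j and adding `off`.
okE : ℕ → Exp → Set
okE Γ (var x)   = T (x <ᵇ Γ)
okE Γ (lit k)   = T (k <ᵇ suc depthLimit)
okE Γ (a ⊕ b)   = okE Γ a × okE Γ b × T (depth a ⊔ depth b <ᵇ depthLimit)
okE Γ (a ⊗ b)   = okE Γ a × okE Γ b × T (depth a ⊔ depth b <ᵇ depthLimit)
okE Γ (a ⊖ b)   = okE Γ a × okE Γ b × T (depth a ⊔ depth b <ᵇ suc depthLimit)
okE Γ (a ≺ b)   = okE Γ a × okE Γ b
okE Γ (a ≐ b)   = okE Γ a × okE Γ b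
okE Γ (inp e)   = okE Γ e
okE Γ (arr j e) = okE Γ e × T (3 + depth e <ᵇ suc depthLimit) × T (0 <ᵇ j) × T (j <ᵇ 16)

-- Register 0 holds `off`. Interleaving the arrays with stride 16 gives each of them unbounded room
-- without knowledge of their lengths.
toAddress : ℕ → ℕ → Program
toAddress t j =
  instr (const (suc t) 16) ⨾ instr (arith mul t t (suc t)) ⨾
  instr (const (suc t) j) ⨾ instr (arith add t t (suc t)) ⨾
  instr (arith add t t 0)

-- The registers form a stack: the value ends in register t, the registers from t on are scratch,
-- and those below t keep the variables and pending operands.
compE : ℕ → Exp → Program
compE t (var x)   = instr (move t x)
compE t (lit k)   = instr (const t k)
compE t (a ⊕ b)   = compE t a ⨾ compE (suc t) b ⨾ instr (arith add t t (suc t))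
compE t (a ⊗ b)   = compE t a ⨾ compE (suc t) b ⨾ instr (arith mul t t (suc t))
-- The product with the outcome of the comparison truncates the subtraction.
compE t (a ⊖ b)   = compE t a ⨾ compE (suc t) b ⨾ instr (arith lt (2 + t) (suc t) t) ⨾
                    instr (arith sub t t (suc t)) ⨾ instr (arith mul t t (2 + t))
compE t (a ≺ b)   = compE t a ⨾ compE (suc t) b ⨾ instr (arith lt t t (suc t))
compE t (a ≐ b)   = compE t a ⨾ compE (suc t) b ⨾ instr (arith eq t t (suc t))
compE t (inp e)   = compE t e ⨾ instr (load t t)
compE t (arr j e) = compE t e ⨾ toAddress t j ⨾ instr (load t t)

timeE : Exp → ℕ
timeE (var x)   = 1
timeE (lit k)   = 1
timeE (a ⊕ b)   = timeE a + (timeE b + 1)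
timeE (a ⊗ b)   = timeE a + (timeE b + 1)
timeE (a ⊖ b)   = timeE a + (timeE b + 3)
timeE (a ≺ b)   = timeE a + (timeE b + 1)
timeE (a ≐ b)   = timeE a + (timeE b + 1)
timeE (inp e)   = timeE e + 1
timeE (arr j e) = timeE e + 6

comp : ℕ → Cmd → Program
comp Γ nop          = skip
comp Γ (c ⨟ d)      = comp Γ c ⨾ comp Γ d
comp Γ (put j a b)  = compE Γ a ⨾ toAddress Γ j ⨾ compE (suc Γ) b ⨾ instr (store Γ (suc Γ))
comp Γ (out a b)    = compE Γ a ⨾ compE (suc Γ) b ⨾ instr (store Γ (suc Γ))
comp Γ (cond e c d) = compE Γ e ⨾ ifnz Γ (comp Γ c) (comp Γ d)
comp Γ (bind e c)   = compE Γ e ⨾ comp (suc Γ) c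
comp Γ (iter e c)   =
  compE (suc Γ) e ⨾ instr (const Γ 0) ⨾ instr (arith lt (2 + Γ) Γ (suc Γ)) ⨾
  -- The body uses register 2 + Γ as scratch, so the loop test is recomputed at the end of every
  -- pass.
  while (2 + Γ)
    (comp (2 + Γ) c ⨾ instr (const (2 + Γ) 1) ⨾ instr (arith add Γ Γ (2 + Γ)) ⨾
     instr (arith lt (2 + Γ) Γ (suc Γ)))

-- A command whose loops run through at most X innermost iterations takes at
-- most κ c * X steps.
κ : Cmd → ℕ
κ nop          = 1
κ (c ⨟ d)      = κ c + κ d
κ (put j a b)  = timeE a + (5 + (timeE b + 1))
κ (out a b)    = timeE a + (timeE b + 1)
κ (cond e c d) = timeE e + (1 + (κ c + κ d))
κ (bind e c)   = timeE e + κ c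
κ (iter e c)   = timeE e + (3 + (κ c + 4))

-- Function updates and uniqueness of addresses

upd-same : ∀ (f : ℕ → ℕ) a v → (f [ a ↦ v ]) a ≡ v
upd-same f a v rewrite dec-true (a ≟ a) refl = refl

upd-other : ∀ (f : ℕ → ℕ) {a b} v → b ≢ a → (f [ a ↦ v ]) b ≡ f b
upd-other f {a} {b} v b≢a rewrite dec-false (b ≟ a) b≢a = refl

upd-below : ∀ (f : ℕ → ℕ) {a b} v → b < a → (f [ a ↦ v ]) b ≡ f b
upd-below f v b<a = upd-other f v (<⇒≢ b<a)

Upd-same : ∀ A j i v → upd A j i v j i ≡ v
Upd-same A j i v with j ≡ᵇ j | ≡⇒≡ᵇ j j refl
... | true | _ = upd-same (A j) i v

Upd-other : ∀ A {j i j′ i′} v → ¬ (j′ ≡ j × i′ ≡ i) → upd A j i v j′ i′ ≡ A j′ i′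
Upd-other A {j} {i} {j′} {i′} v ne with j′ ≡ᵇ j | ≡ᵇ⇒≡ j′ j
... | false | _ = refl
... | true  | f = trans (upd-other (A j) v (λ e → ne (f _ , e))) (cong (λ x → A x i′) (sym (f _)))

bool≤1 : ∀ b → bool b ≤ 1
bool≤1 true  = s≤s z≤n
bool≤1 false = z≤n

-- Uniqueness of quotient and remainder. It separates the interleaved arrays, the numbers of the
-- states and the successor blocks.
scaled-injective : ∀ {c i j i′ j′} → j < c → j′ < c → c * i + j ≡ c * i′ + j′ → j ≡ j′ × i ≡ i′
scaled-injective {c} {i} {j} {i′} {j′} j<c j′<c ij≡ with <-cmp i i′
... | tri< i<i′ _ _ = contradiction ij≡ (<⇒≢ (begin-strict
        c * i + j    <⟨ +-monoʳ-< (c * i) j<c ⟩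
        c * i + c    ≡⟨ +-comm (c * i) c ⟩
        c + c * i    ≡⟨ sym (*-suc c i) ⟩
        c * suc i    ≤⟨ *-monoʳ-≤ c i<i′ ⟩
        c * i′       ≤⟨ m≤m+n (c * i′) j′ ⟩
        c * i′ + j′  ∎))
  where open ≤-Reasoning
... | tri≈ _ refl _ = +-cancelˡ-≡ (c * i) j j′ ij≡ , refl
... | tri> _ _ i>i′ = contradiction (sym ij≡) (<⇒≢ (begin-strict
        c * i′ + j′  <⟨ +-monoʳ-< (c * i′) j′<c ⟩
        c * i′ + c   ≡⟨ +-comm (c * i′) c ⟩
        c + c * i′   ≡⟨ sym (*-suc c i′) ⟩
        c * suc i′   ≤⟨ *-monoʳ-≤ c i>i′ ⟩
        c * i        ≤⟨ m≤m+n (c * i) j ⟩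
        c * i + j    ∎))
  where open ≤-Reasoning

-- Correctness and cost of the compiled code

-- Words have w bits; input and output occupy the addresses below off, and all
-- variables and memory cells stay below B.
record Layout : Set where
  field
    w B off : ℕ
    16≤B    : 16 ≤ B
    off<B   : off < B
    β≤2^w   : β B depthLimit ≤ 2 ^ w

module Machine (𝓛 : Layout) where

  open Layout 𝓛
  open Semantics w

  16≤β : ∀ d → 16 ≤ β B d
  16≤β zero    rewrite β-zero B = 16≤B
  16≤β (suc d) rewrite β-suc B d =
    ≤-trans (16≤β d) (m≤m*n _ _ ⦃ >-nonZero (≤-trans (s≤s z≤n) (16≤β d)) ⦄)

  B≤β : ∀ d → B ≤ β B d

  β-step : ∀ d → β B d ≤ β B (suc d)
  β-step d rewrite β-suc B d = m≤m*n _ _ ⦃ >-nonZero (≤-trans (s≤s z≤n) (16≤β d)) ⦄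

  B≤β zero    = ≤-reflexive (sym (β-zero B))
  B≤β (suc d) = ≤-trans (B≤β d) (β-step d)

  β-mono′ : ∀ a k → β B a ≤ β B (k + a)
  β-mono′ a zero    = ≤-refl
  β-mono′ a (suc k) = ≤-trans (β-mono′ a k) (β-step (k + a))

  β-mono : ∀ {a b} → a ≤ b → β B a ≤ β B b
  β-mono {a} a≤b = subst (λ x → β B a ≤ β B x) (m∸n+n≡m a≤b) (β-mono′ a _)

  β-mul : ∀ {a b x y} → x < β B a → y < β B b → x * y < β B (suc (a ⊔ b))
  β-mul {a} {b} x< y< rewrite β-suc B (a ⊔ b) =
    *-mono-< (<-≤-trans x< (β-mono (m≤m⊔n a b))) (<-≤-trans y< (β-mono (m≤n⊔m a b)))

  β-add : ∀ {a b x y} → x < β B a → y < β B b → x + y < β B (suc (a ⊔ b))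
  β-add {a} {b} {x} {y} x< y< rewrite β-suc B (a ⊔ b) = begin-strict
    x + y          <⟨ +-mono-< (<-≤-trans x< (β-mono (m≤m⊔n a b))) (<-≤-trans y< (β-mono (m≤n⊔m a b))) ⟩
    c + c          ≡⟨ cong (c +_) (sym (+-identityʳ c)) ⟩
    2 * c          ≤⟨ *-monoˡ-≤ c (≤-trans (s≤s (s≤s z≤n)) (16≤β (a ⊔ b))) ⟩
    c * c          ∎
    where open ≤-Reasoning
          c = β B (a ⊔ b)

  lit<β : ∀ k → k < β B k
  lit<β zero    = ≤-trans (s≤s z≤n) (16≤β 0)
  lit<β (suc k) rewrite β-suc B k = ≤-<-trans (lit<β k)
    (m<m*n _ _ ⦃ >-nonZero (≤-trans (s≤s z≤n) (16≤β k)) ⦄ (≤-trans (s≤s (s≤s z≤n)) (16≤β k)))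

  β<2^w : ∀ {x d} → d < suc depthLimit → x < β B d → x < 2 ^ w
  β<2^w (s≤s d≤) x< = <-≤-trans x< (≤-trans (β-mono d≤) β≤2^w)

  trunc-id : ∀ {x} → x < 2 ^ w → trunc w x ≡ x
  trunc-id x< = m<n⇒m%n≡m ⦃ m^n≢0 2 w ⦄ x<

  B≤2^w : B ≤ 2 ^ w
  B≤2^w = ≤-trans (B≤β depthLimit) β≤2^w

  bool<B : ∀ b → bool b < B
  bool<B b = ≤-<-trans (bool≤1 b) (≤-trans (s≤s (s≤s z≤n)) 16≤B)

  trunc-bool : ∀ b → trunc w (bool b) ≡ bool b
  trunc-bool b = trunc-id (<-≤-trans (bool<B b) B≤2^w)

  -- Machine subtraction wraps around. For y < x the truncation removes the surplus 2 ^ w; for x ≤ y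
  -- the factor 0 discards the wrapped result.
  monus : ∀ {x y} → x < 2 ^ w → y < 2 ^ w →
          evalOp w mul (evalOp w sub x y) (evalOp w lt y x) ≡ x ∸ y
  monus {x} {y} x< y< rewrite trunc-bool (y <ᵇ x) with y <ᵇ x | <ᵇ⇒< y x | <⇒<ᵇ {y} {x}
  ... | true | f | _ = begin
      trunc w (trunc w (x + (2 ^ w ∸ y)) * 1)  ≡⟨ cong (trunc w) (*-identityʳ _) ⟩
      trunc w (trunc w (x + (2 ^ w ∸ y)))      ≡⟨ cong (λ z → trunc w (trunc w z)) shift ⟩
      trunc w (trunc w (x ∸ y + 2 ^ w))        ≡⟨ cong (trunc w) (wrap (x ∸ y)) ⟩
      trunc w (trunc w (x ∸ y))                ≡⟨ cong (trunc w) (trunc-id small) ⟩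
      trunc w (x ∸ y)                          ≡⟨ trunc-id small ⟩
      x ∸ y ∎
    where
    open ≡-Reasoning
    small : x ∸ y < 2 ^ w
    small = ≤-<-trans (m∸n≤m x y) x<
    wrap : ∀ z → trunc w (z + 2 ^ w) ≡ trunc w z
    wrap z = [m+n]%n≡m%n z (2 ^ w) ⦃ m^n≢0 2 w ⦄
    shift : x + (2 ^ w ∸ y) ≡ x ∸ y + 2 ^ w
    shift = trans (sym (+-∸-assoc x (<⇒≤ y<)))
              (+-∸-comm (2 ^ w) (<⇒≤ (f _)))
  ... | false | _ | g =
      trans (cong (trunc w) (*-zeroʳ (trunc w (x + (2 ^ w ∸ y)))))
        (trans (trunc-id (m^n>0 2 w)) (sym (m≤n⇒m∸n≡0 (≮⇒≥ g))))

  record MemRel (M : ℕ → ℕ) (A : Mem) : Set where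
    field
      low     : ∀ a → a < off → M a ≡ A 0 a
      high    : ∀ j i → 0 < j → j < 16 → M (off + (16 * i + j)) ≡ A j i
      bounded : ∀ j i → A j i < B

  record EnvRel (Γ : ℕ) (ρ f : ℕ → ℕ) : Set where
    field
      positive : 0 < Γ
      offset   : ρ 0 ≡ off
      agree    : ∀ r → r < Γ → f r ≡ ρ r
      small    : ∀ r → r < Γ → ρ r < B

  open MemRel
  open EnvRel

  -- Only `inp` carries an obligation: array 0 mirrors the machine memory just below `off`, whereas
  -- every index of another array has an address of its own.
  Safe : Exp → (ℕ → ℕ) → Mem → Set
  Safe (var x)   ρ A = ⊤
  Safe (lit k)   ρ A = ⊤
  Safe (a ⊕ b)   ρ A = Safe a ρ A × Safe b ρ A
  Safe (a ⊗ b)   ρ A = Safe a ρ A × Safe b ρ A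
  Safe (a ⊖ b)   ρ A = Safe a ρ A × Safe b ρ A
  Safe (a ≺ b)   ρ A = Safe a ρ A × Safe b ρ A
  Safe (a ≐ b)   ρ A = Safe a ρ A × Safe b ρ A
  Safe (inp e)   ρ A = Safe e ρ A × eval e ρ A < off
  Safe (arr j e) ρ A = Safe e ρ A

  <ᵇ-< : ∀ {m n} → T (m <ᵇ n) → m < n
  <ᵇ-< {m} {n} = <ᵇ⇒< m n

  depth-ok : ∀ {Γ} e → okE Γ e → depth e < suc depthLimit
  depth-ok (var x)   _           = s≤s z≤n
  depth-ok (lit k)   p           = <ᵇ-< p
  depth-ok (a ⊕ b)   (_ , _ , p) = s≤s (<ᵇ-< {depth a ⊔ depth b} {depthLimit} p)
  depth-ok (a ⊗ b)   (_ , _ , p) = s≤s (<ᵇ-< {depth a ⊔ depth b} {depthLimit} p)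
  depth-ok (a ⊖ b)   (_ , _ , p) = <ᵇ-< {depth a ⊔ depth b} {suc depthLimit} p
  depth-ok (a ≺ b)   _           = s≤s z≤n
  depth-ok (a ≐ b)   _           = s≤s z≤n
  depth-ok (inp e)   _           = s≤s z≤n
  depth-ok (arr j e) _           = s≤s z≤n

  eval<β : ∀ {Γ ρ f M A} e → EnvRel Γ ρ f → MemRel M A → okE Γ e → eval e ρ A < β B (depth e)
  eval<β (var x) E R p = <-≤-trans (small E x (<ᵇ-< p)) (B≤β 0)
  eval<β (lit k) E R p = lit<β k
  eval<β (a ⊕ b) E R (p , q , _) = β-add {depth a} {depth b} (eval<β a E R p) (eval<β b E R q)
  eval<β (a ⊗ b) E R (p , q , _) = β-mul {depth a} {depth b} (eval<β a E R p) (eval<β b E R q)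
  eval<β {ρ = ρ} {A = A} (a ⊖ b) E R (p , q , _) =
    ≤-<-trans (m∸n≤m (eval a ρ A) (eval b ρ A))
      (<-≤-trans (eval<β a E R p) (β-mono (m≤m⊔n (depth a) (depth b))))
  eval<β (a ≺ b) E R p = <-≤-trans (bool<B _) (B≤β 0)
  eval<β (a ≐ b) E R p = <-≤-trans (bool<B _) (B≤β 0)
  eval<β (inp e) E R p = <-≤-trans (bounded R _ _) (B≤β 0)
  eval<β (arr j e) E R p = <-≤-trans (bounded R _ _) (B≤β 0)

  Computes : Program → ℕ → (ℕ → ℕ) → (ℕ → ℕ) → List ℕ → ℕ → ℕ → Set
  Computes p t f M ω d v =
    ∃[ f′ ] (Run p ⟨ f , M , ω ⟩ d ⟨ f′ , M , ω ⟩ × f′ t ≡ v × (∀ r → r < t → f′ r ≡ f r))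

  arith-step : ∀ {f M ω} o t x y v → evalOp w o (f x) (f y) ≡ v →
               Computes (instr (arith o t x y)) t f M ω 1 v
  arith-step {f} o t x y v e =
    f [ t ↦ evalOp w o (f x) (f y) ] , instr arith , trans (upd-same f t _) e , λ r r<t → upd-below f _ r<t

  binary : ∀ {p q t f M ω d d′ u v o z} → Computes p t f M ω d u →
           (∀ f′ → (∀ r → r < t → f′ r ≡ f r) → Computes q (suc t) f′ M ω d′ v) →
           evalOp w o u v ≡ z →
           Computes (p ⨾ q ⨾ instr (arith o t t (suc t))) t f M ω (d + (d′ + 1)) z
  binary {t = t} {o = o} (f₁ , r₁ , e₁ , k₁) q e with q f₁ k₁
  ... | f₂ , r₂ , e₂ , k₂ with arith-step {f₂} o t t (suc t) _ (trans (cong₂ (evalOp w o) (trans (k₂ t ≤-refl) e₁) e₂) e)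
  ... | f₃ , r₃ , e₃ , k₃ = f₃ , seq r₁ (seq r₂ r₃) , e₃ ,
        λ r r<t → trans (k₃ r r<t) (trans (k₂ r (m<n⇒m<1+n r<t)) (k₁ r r<t))

  weaken : ∀ {Γ ρ f f′ t} → EnvRel Γ ρ f → Γ ≤ t → (∀ r → r < t → f′ r ≡ f r) → EnvRel Γ ρ f′
  weaken E Γ≤t k = record
    { positive = positive E ; offset = offset E ; small = small E
    ; agree = λ r r<Γ → trans (k r (<-≤-trans r<Γ Γ≤t)) (agree E r r<Γ) }

  16<2^w : 16 < 2 ^ w
  16<2^w = <-≤-trans (lit<β 16) (≤-trans (β-mono (m≤m+n 16 0)) β≤2^w)

  toAddress-correct : ∀ {f M ω t i d j} → f 0 ≡ off → 0 < t → f t ≡ i → i < β B d →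
                      3 + d < suc depthLimit → j < 16 →
                      Computes (toAddress t j) t f M ω 5 (off + (16 * i + j))
  toAddress-correct {f} {M} {ω} {t} {i} {d} {j} f0 0<t ft i< d< j<16 =
    f₅ , seq (instr const) (seq (instr arith) (seq (instr const) (seq (instr arith) (instr arith)))) ,
    v₅ , keep
    where
    f₁ f₂ f₃ f₄ f₅ : ℕ → ℕ
    f₁ = f  [ suc t ↦ trunc w 16 ]
    f₂ = f₁ [ t ↦ evalOp w mul (f₁ t) (f₁ (suc t)) ]
    f₃ = f₂ [ suc t ↦ trunc w j ]
    f₄ = f₃ [ t ↦ evalOp w add (f₃ t) (f₃ (suc t)) ]
    f₅ = f₄ [ t ↦ evalOp w add (f₄ t) (f₄ 0) ]
    keep : ∀ r → r < t → f₅ r ≡ f r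
    keep r r<t =
      trans (upd-below f₄ _ r<t) (trans (upd-below f₃ _ r<t) (trans (upd-below f₂ _ (m<n⇒m<1+n r<t))
        (trans (upd-below f₁ _ r<t) (upd-below f _ (m<n⇒m<1+n r<t)))))
    b₂ : 16 * i < β B (1 + d)
    b₂ = subst₂ _<_ (*-comm i 16) (sym (β-suc B d))
           (<-≤-trans (*-monoˡ-< 16 i<) (*-monoʳ-≤ (β B d) (16≤β d)))
    b₄ : 16 * i + j < β B (2 + d)
    b₄ = subst (λ e → 16 * i + j < β B (suc e)) (⊔-idem (1 + d))
           (β-add {1 + d} {1 + d} b₂ (<-≤-trans j<16 (16≤β (1 + d))))
    b₅ : 16 * i + j + off < β B (3 + d)
    b₅ = subst (λ e → 16 * i + j + off < β B (suc e)) (⊔-idem (2 + d))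
           (β-add {2 + d} {2 + d} b₄ (<-≤-trans off<B (B≤β (2 + d))))
    v₂ : f₂ t ≡ 16 * i
    v₂ = trans (upd-same f₁ t _)
      (trans (cong₂ (evalOp w mul) (trans (upd-below f {suc t} {t} _ ≤-refl) ft)
                                   (trans (upd-same f (suc t) _) (trunc-id 16<2^w)))
        (trans (cong (trunc w) (*-comm i 16)) (trunc-id (β<2^w (≤-trans (n≤1+n _) (≤-trans (n≤1+n _) d<)) b₂))))
    v₄ : f₄ t ≡ 16 * i + j
    v₄ = trans (upd-same f₃ t _)
      (trans (cong₂ (evalOp w add) (trans (upd-below f₂ {suc t} {t} _ ≤-refl) v₂)
                                   (trans (upd-same f₂ (suc t) _) (trunc-id (<-trans j<16 16<2^w))))
        (trunc-id (β<2^w (≤-trans (n≤1+n _) d<) b₄)))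
    z₄ : f₄ 0 ≡ off
    z₄ = trans (upd-below f₃ _ 0<t) (trans (upd-below f₂ (trunc w j) (m<n⇒m<1+n 0<t))
           (trans (upd-below f₁ _ 0<t) (trans (upd-below f (trunc w 16) (m<n⇒m<1+n 0<t)) f0)))
    v₅ : f₅ t ≡ off + (16 * i + j)
    v₅ = trans (upd-same f₄ t _) (trans (cong₂ (evalOp w add) v₄ z₄)
           (trans (trunc-id (β<2^w d< b₅)) (+-comm _ off)))

  compE-correct : ∀ {Γ ρ f M A ω} e {t} → okE Γ e → Safe e ρ A → EnvRel Γ ρ f → MemRel M A → Γ ≤ t →
                  Computes (compE t e) t f M ω (timeE e) (eval e ρ A)
  compE-correct {f = f} (var x) {t} ok s E R Γ≤t =
    _ , instr move , trans (upd-same f t _) (agree E x (<ᵇ-< ok)) , λ r → upd-below f _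
  compE-correct {f = f} (lit k) {t} ok s E R Γ≤t =
    _ , instr const , trans (upd-same f t _) (trunc-id (β<2^w (<ᵇ-< ok) (lit<β k))) , λ r → upd-below f _
  compE-correct (a ⊕ b) ok@(p , q , _) (s , s′) E R Γ≤t =
    binary (compE-correct a p s E R Γ≤t)
      (λ f′ k → compE-correct b q s′ (weaken E Γ≤t k) R (m≤n⇒m≤1+n Γ≤t))
      (trunc-id (β<2^w (depth-ok (a ⊕ b) ok) (eval<β (a ⊕ b) E R ok)))
  compE-correct (a ⊗ b) ok@(p , q , _) (s , s′) E R Γ≤t =
    binary (compE-correct a p s E R Γ≤t)
      (λ f′ k → compE-correct b q s′ (weaken E Γ≤t k) R (m≤n⇒m≤1+n Γ≤t))
      (trunc-id (β<2^w (depth-ok (a ⊗ b) ok) (eval<β (a ⊗ b) E R ok)))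
  compE-correct {ρ = ρ} {A = A} (a ⊖ b) {t} (p , q , _) (s , s′) E R Γ≤t
    with compE-correct a p s E R Γ≤t
  ... | f₁ , r₁ , e₁ , k₁ with compE-correct b q s′ (weaken E Γ≤t k₁) R (m≤n⇒m≤1+n Γ≤t)
  ... | f₂ , r₂ , e₂ , k₂ =
      f₅ , seq r₁ (seq r₂ (seq (instr arith) (seq (instr arith) (instr arith)))) , v₅ , keep
    where
    x = eval a ρ A
    y = eval b ρ A
    f₃ f₄ f₅ : ℕ → ℕ
    f₃ = f₂ [ 2 + t ↦ evalOp w lt (f₂ (suc t)) (f₂ t) ]
    f₄ = f₃ [ t ↦ evalOp w sub (f₃ t) (f₃ (suc t)) ]
    f₅ = f₄ [ t ↦ evalOp w mul (f₄ t) (f₄ (2 + t)) ]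
    f₂t : f₂ t ≡ x
    f₂t = trans (k₂ t ≤-refl) e₁
    v₄ : f₄ t ≡ evalOp w sub x y
    v₄ = trans (upd-same f₃ t _) (cong₂ (evalOp w sub)
           (trans (upd-below f₂ _ (s≤s (n≤1+n t))) f₂t) (trans (upd-below f₂ _ ≤-refl) e₂))
    c₄ : f₄ (2 + t) ≡ evalOp w lt y x
    c₄ = trans (upd-other f₃ _ (λ e → <-irrefl (sym e) (s≤s (n≤1+n t))))
           (trans (upd-same f₂ (2 + t) _) (cong₂ (evalOp w lt) e₂ f₂t))
    v₅ : f₅ t ≡ x ∸ y
    v₅ = trans (upd-same f₄ t _) (trans (cong₂ (evalOp w mul) v₄ c₄)
           (monus (β<2^w (depth-ok a p) (eval<β a E R p)) (β<2^w (depth-ok b q) (eval<β b E R q))))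
    keep : ∀ r → r < t → f₅ r ≡ _
    keep r r<t = trans (upd-below f₄ _ r<t) (trans (upd-below f₃ _ r<t)
      (trans (upd-below f₂ _ (m<n⇒m<1+n (m<n⇒m<1+n r<t))) (trans (k₂ r (m<n⇒m<1+n r<t)) (k₁ r r<t))))
  compE-correct {ρ = ρ} {A = A} (a ≺ b) (p , q) (s , s′) E R Γ≤t =
    binary (compE-correct a p s E R Γ≤t)
      (λ f′ k → compE-correct b q s′ (weaken E Γ≤t k) R (m≤n⇒m≤1+n Γ≤t))
      (trunc-bool (eval a ρ A <ᵇ eval b ρ A))
  compE-correct {ρ = ρ} {A = A} (a ≐ b) (p , q) (s , s′) E R Γ≤t =
    binary (compE-correct a p s E R Γ≤t)
      (λ f′ k → compE-correct b q s′ (weaken E Γ≤t k) R (m≤n⇒m≤1+n Γ≤t))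
      (trunc-bool (eval a ρ A ≡ᵇ eval b ρ A))
  compE-correct {M = M} (inp e) {t} ok (s , i<off) E R Γ≤t with compE-correct e ok s E R Γ≤t
  ... | f₁ , r₁ , e₁ , k₁ =
      _ , seq r₁ (instr load) ,
      trans (upd-same f₁ t _) (trans (cong M e₁) (low R _ i<off)) ,
      λ r r<t → trans (upd-below f₁ _ r<t) (k₁ r r<t)
  compE-correct {ρ = ρ} {M = M} {A = A} (arr j e) {t} (ok , d< , 0<j , j<16) s E R Γ≤t
    with compE-correct e ok s E R Γ≤t
  ... | f₁ , r₁ , e₁ , k₁
    with toAddress-correct {M = M} (trans (k₁ 0 (<-≤-trans (positive E) Γ≤t)) (trans (agree E 0 (positive E)) (offset E)))
           (<-≤-trans (positive E) Γ≤t) e₁ (eval<β e E R ok) (<ᵇ-< {3 + depth e} d<) (<ᵇ-< j<16)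
  ... | f₂ , r₂ , e₂ , k₂ =
      f₂ [ t ↦ M (f₂ t) ] , seq r₁ (seq r₂ (instr load)) ,
      trans (upd-same f₂ t _) (trans (cong M e₂) (high R j _ (<ᵇ-< 0<j) (<ᵇ-< j<16))) ,
      λ r r<t → trans (upd-below f₂ _ r<t) (trans (k₂ r r<t) (k₁ r r<t))

  -- Variables are bound once and never assigned, so the same `ρ` describes the registers before and
  -- after, and a postcondition speaks of the memory alone. As X is a parameter, the limits of
  -- nested loops multiply into it while `κ c` stays a constant of the program.
  record wp (Γ : ℕ) (ρ : ℕ → ℕ) (c : Cmd) (X : ℕ) (Q : Mem → Set) (A : Mem) : Set where
    field
      run : ∀ f M ω → EnvRel Γ ρ f → MemRel M A →
        ∃[ d ] ∃[ f′ ] ∃[ M′ ] ∃[ A′ ] (Run (comp Γ c) ⟨ f , M , ω ⟩ d ⟨ f′ , M′ , ω ⟩ ×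
          d ≤ κ c * X × EnvRel Γ ρ f′ × MemRel M′ A′ × Q A′)

  open wp

  below : ∀ {Γ ρ f f′} → EnvRel Γ ρ f → (∀ r → r < Γ → f′ r ≡ f r) → EnvRel Γ ρ f′
  below E k = weaken E ≤-refl k

  wp-mono : ∀ {Γ ρ} c {X X′ Q Q′ A} → X ≤ X′ → (∀ A → Q A → Q′ A) → wp Γ ρ c X Q A → wp Γ ρ c X′ Q′ A
  run (wp-mono c X≤ Q⇒ h) f M ω E R with run h f M ω E R
  ... | d , f′ , M′ , A′ , r , d≤ , E′ , R′ , q =
      d , f′ , M′ , A′ , r , ≤-trans d≤ (*-monoʳ-≤ (κ c) X≤) , E′ , R′ , Q⇒ A′ q

  -- The bound on the cells is part of the memory relation; taking it from the run keeps it out of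
  -- all invariants.
  wp-bounded : ∀ {Γ ρ} c {X Q A} → ((∀ j i → A j i < B) → wp Γ ρ c X Q A) → wp Γ ρ c X Q A
  run (wp-bounded c h) f M ω E R = run (h (bounded R)) f M ω E R

  m≤m*X : ∀ m {X} → 1 ≤ X → m ≤ m * X
  m≤m*X m {X} 1≤X = m≤m*n m X ⦃ >-nonZero 1≤X ⦄

  wp-nop : ∀ {Γ ρ X Q A} → 1 ≤ X → Q A → wp Γ ρ nop X Q A
  run (wp-nop 1≤X q) f M ω E R = _ , _ , _ , _ , skip , m≤m*X 1 1≤X , E , R , q

  wp-seq : ∀ {Γ ρ} c c′ {X Q A} → wp Γ ρ c X (λ A′ → wp Γ ρ c′ X Q A′) A → wp Γ ρ (c ⨟ c′) X Q A
  run (wp-seq c c′ {X} h) f M ω E R with run h f M ω E R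
  ... | d , f₁ , M₁ , A₁ , r , d≤ , E₁ , R₁ , h′ with run h′ f₁ M₁ ω E₁ R₁
  ... | d′ , f₂ , M₂ , A₂ , r′ , d′≤ , E₂ , R₂ , q =
      _ , f₂ , M₂ , A₂ , seq r r′ ,
      ≤-trans (+-mono-≤ d≤ d′≤) (≤-reflexive (sym (*-distribʳ-+ X (κ c) (κ c′)))) , E₂ , R₂ , q

  store-array : ∀ {M A j i v} → 0 < j → j < 16 → v < B → MemRel M A →
                MemRel (M [ off + (16 * i + j) ↦ v ]) (upd A j i v)
  store-array {M} {A} {j} {i} {v} 0<j j<16 v<B R = record { low = lo ; high = hi ; bounded = bd }
    where
    lo : ∀ a → a < off → (M [ off + (16 * i + j) ↦ v ]) a ≡ upd A j i v 0 a
    lo a a<off = trans (upd-below M v (<-≤-trans a<off (m≤m+n off _)))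
      (trans (low R a a<off) (sym (Upd-other A v λ { (e , _) → <-irrefl e 0<j })))
    hi : ∀ j′ i′ → 0 < j′ → j′ < 16 → (M [ off + (16 * i + j) ↦ v ]) (off + (16 * i′ + j′)) ≡ upd A j i v j′ i′
    hi j′ i′ 0<j′ j′<16 with j′ ≟ j | i′ ≟ i
    ... | yes refl | yes refl = trans (upd-same M _ v) (sym (Upd-same A j i v))
    ... | yes refl | no  i≢ = trans (upd-other M v λ e → i≢ (proj₂ (scaled-injective {16} {i′} {j′} {i} {j} j′<16 j<16 (+-cancelˡ-≡ off _ _ e))))
                                (trans (high R j′ i′ 0<j′ j′<16) (sym (Upd-other A v λ { (_ , e) → i≢ e })))
    ... | no  j≢ | _ = trans (upd-other M v λ e → j≢ (proj₁ (scaled-injective {16} {i′} {j′} {i} {j} j′<16 j<16 (+-cancelˡ-≡ off _ _ e))))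
                         (trans (high R j′ i′ 0<j′ j′<16) (sym (Upd-other A v λ { (e , _) → j≢ e })))
    bd : ∀ j′ i′ → upd A j i v j′ i′ < B
    bd j′ i′ with j′ ≟ j | i′ ≟ i
    ... | yes refl | yes refl = subst (_< B) (sym (Upd-same A j i v)) v<B
    ... | yes refl | no  i≢ = subst (_< B) (sym (Upd-other A v λ { (_ , e) → i≢ e })) (bounded R j′ i′)
    ... | no  j≢ | _ = subst (_< B) (sym (Upd-other A v λ { (e , _) → j≢ e })) (bounded R j′ i′)

  store-low : ∀ {M A i v} → i < off → v < B → MemRel M A → MemRel (M [ i ↦ v ]) (upd A 0 i v)
  store-low {M} {A} {i} {v} i<off v<B R = record { low = lo ; high = hi ; bounded = bd }
    where
    lo : ∀ a → a < off → (M [ i ↦ v ]) a ≡ upd A 0 i v 0 a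
    lo a a<off with a ≟ i
    ... | yes refl = trans (upd-same M i v) (sym (Upd-same A 0 i v))
    ... | no  a≢i  = trans (upd-other M v a≢i) (trans (low R a a<off) (sym (Upd-other A {0} {i} {0} {a} v λ { (_ , e) → a≢i e })))
    hi : ∀ j′ i′ → 0 < j′ → j′ < 16 → (M [ i ↦ v ]) (off + (16 * i′ + j′)) ≡ upd A 0 i v j′ i′
    hi j′ i′ 0<j′ j′<16 = trans (upd-other M v λ e → <-irrefl (sym e) (<-≤-trans i<off (m≤m+n off _)))
      (trans (high R j′ i′ 0<j′ j′<16) (sym (Upd-other A {0} {i} {j′} {i′} v λ { (e , _) → <-irrefl (sym e) 0<j′ })))
    bd : ∀ j′ i′ → upd A 0 i v j′ i′ < B
    bd j′ i′ with j′ ≟ 0 | i′ ≟ i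
    ... | yes refl | yes refl = subst (_< B) (sym (Upd-same A 0 i v)) v<B
    ... | yes refl | no  i≢ = subst (_< B) (sym (Upd-other A {0} {i} {0} {i′} v λ { (_ , e) → i≢ e })) (bounded R j′ i′)
    ... | no  j≢ | _ = subst (_< B) (sym (Upd-other A v λ { (e , _) → j≢ e })) (bounded R j′ i′)

  wp-put : ∀ {Γ ρ j a b X Q A} → {ok : okE Γ (arr j a)} → {okE Γ b} → 1 ≤ X → Safe a ρ A → Safe b ρ A →
           eval b ρ A < B → Q (upd A j (eval a ρ A) (eval b ρ A)) → wp Γ ρ (put j a b) X Q A
  run (wp-put {Γ} {ρ} {j} {a} {b} {X} {Q} {A} {ok , d< , 0<j , j<16} {ok′} 1≤X s s′ v<B q) f M ω E R
    with compE-correct {ω = ω} a ok s E R ≤-refl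
  ... | f₁ , r₁ , e₁ , k₁
    with toAddress-correct {M = M} {ω} (trans (k₁ 0 (positive E)) (trans (agree E 0 (positive E)) (offset E)))
           (positive E) e₁ (eval<β a E R ok) (<ᵇ-< {3 + depth a} d<) (<ᵇ-< j<16)
  ... | f₂ , r₂ , e₂ , k₂
    with compE-correct {ω = ω} b ok′ s′ (below E (λ r r< → trans (k₂ r r<) (k₁ r r<))) R (n≤1+n Γ)
  ... | f₃ , r₃ , e₃ , k₃ =
      _ , f₃ , M [ f₃ Γ ↦ f₃ (suc Γ) ] , _ , seq r₁ (seq r₂ (seq r₃ (instr store))) ,
      m≤m*X _ 1≤X ,
      below E (λ r r< → trans (k₃ r (m<n⇒m<1+n r<)) (trans (k₂ r r<) (k₁ r r<))) ,
      subst₂ (λ x y → MemRel (M [ x ↦ y ]) (upd A j (eval a ρ A) (eval b ρ A)))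
        (sym (trans (k₃ Γ ≤-refl) e₂)) (sym e₃) (store-array (<ᵇ-< 0<j) (<ᵇ-< j<16) v<B R) ,
      q

  wp-out : ∀ {Γ ρ a b X Q A} → {okE Γ a} → {okE Γ b} → 1 ≤ X → Safe a ρ A → Safe b ρ A →
           eval a ρ A < off → eval b ρ A < B →
           Q (upd A 0 (eval a ρ A) (eval b ρ A)) → wp Γ ρ (out a b) X Q A
  run (wp-out {Γ} {ρ} {a} {b} {X} {Q} {A} {ok} {ok′} 1≤X s s′ i<off v<B q) f M ω E R
    with compE-correct {ω = ω} a ok s E R ≤-refl
  ... | f₁ , r₁ , e₁ , k₁
    with compE-correct {ω = ω} b ok′ s′ (below E k₁) R (n≤1+n Γ)
  ... | f₃ , r₃ , e₃ , k₃ =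
      _ , f₃ , M [ f₃ Γ ↦ f₃ (suc Γ) ] , _ , seq r₁ (seq r₃ (instr store)) ,
      m≤m*X _ 1≤X ,
      below E (λ r r< → trans (k₃ r (m<n⇒m<1+n r<)) (k₁ r r<)) ,
      subst₂ (λ x y → MemRel (M [ x ↦ y ]) (upd A 0 (eval a ρ A) (eval b ρ A)))
        (sym (trans (k₃ Γ ≤-refl) e₁)) (sym e₃) (store-low i<off v<B R) ,
      q

  cond-time : ∀ {e c c′ k d X} → 1 ≤ X → k ≤ κ c + κ c′ → d ≤ k * X →
              timeE e + (1 + d) ≤ κ (cond e c c′) * X
  cond-time {e} {c} {c′} {k} {d} {X} 1≤X k≤ d≤ = begin
    timeE e + (1 + d)                      ≤⟨ +-mono-≤ (m≤m*X (timeE e) 1≤X) (+-mono-≤ 1≤X (≤-trans d≤ (*-monoˡ-≤ X k≤))) ⟩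
    timeE e * X + (1 + (κ c + κ c′)) * X   ≡⟨ sym (*-distribʳ-+ X (timeE e) (1 + (κ c + κ c′))) ⟩
    κ (cond e c c′) * X                    ∎
    where open ≤-Reasoning

  wp-cond : ∀ {Γ ρ e c c′ X Q A} → {ok : okE Γ e} → 1 ≤ X → Safe e ρ A →
            (eval e ρ A ≢ 0 → wp Γ ρ c X Q A) → (eval e ρ A ≡ 0 → wp Γ ρ c′ X Q A) →
            wp Γ ρ (cond e c c′) X Q A
  run (wp-cond {ρ = ρ} {e} {c} {c′} {A = A} {ok} 1≤X s h h′) f M ω E R
    with compE-correct {ω = ω} e ok s E R ≤-refl
  ... | f₁ , r₁ , e₁ , k₁ with eval e ρ A ≟ 0
  ... | no ≢0 with run (h ≢0) f₁ M ω (below E k₁) R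
  ... | d , f₂ , M₂ , A₂ , r₂ , d≤ , rest =
      _ , f₂ , M₂ , A₂ , seq r₁ (if-nz (λ z → ≢0 (trans (sym e₁) z)) r₂) ,
      cond-time {e} {c} {c′} 1≤X (m≤m+n (κ c) (κ c′)) d≤ , rest
  run (wp-cond {e = e} {c} {c′} 1≤X s h h′) f M ω E R
      | f₁ , r₁ , e₁ , k₁ | yes ≡0 with run (h′ ≡0) f₁ M ω (below E k₁) R
  ... | d , f₂ , M₂ , A₂ , r₂ , d≤ , rest =
      _ , f₂ , M₂ , A₂ , seq r₁ (if-z (trans e₁ ≡0) r₂) ,
      cond-time {e} {c} {c′} 1≤X (m≤n+m (κ c′) (κ c)) d≤ , rest

  extend : ∀ {Γ ρ f f′ v} → EnvRel Γ ρ f → (∀ r → r < Γ → f′ r ≡ f r) → f′ Γ ≡ v → v < B →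
           EnvRel (suc Γ) (ρ [ Γ ↦ v ]) f′
  extend {Γ} {ρ} {f} {f′} {v} E k e v<B = record
    { positive = s≤s z≤n
    ; offset   = trans (upd-below ρ v (positive E)) (offset E)
    ; agree    = ag
    ; small    = sm
    }
    where
    ag : ∀ r → r < suc Γ → f′ r ≡ (ρ [ Γ ↦ v ]) r
    ag r r< with r ≟ Γ
    ... | yes refl = trans e (sym (upd-same ρ Γ v))
    ... | no  r≢   = trans (k r (≤∧≢⇒< (≤-pred r<) r≢))
                      (trans (agree E r (≤∧≢⇒< (≤-pred r<) r≢)) (sym (upd-other ρ v r≢)))
    sm : ∀ r → r < suc Γ → (ρ [ Γ ↦ v ]) r < B
    sm r r< with r ≟ Γ
    ... | yes refl = subst (_< B) (sym (upd-same ρ Γ v)) v<B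
    ... | no  r≢   = subst (_< B) (sym (upd-other ρ v r≢)) (small E r (≤∧≢⇒< (≤-pred r<) r≢))

  restrict : ∀ {Γ ρ f f′ v} → EnvRel Γ ρ f → EnvRel (suc Γ) (ρ [ Γ ↦ v ]) f′ → EnvRel Γ ρ f′
  restrict {ρ = ρ} {v = v} E E′ = record
    { positive = positive E ; offset = offset E ; small = small E
    ; agree = λ r r<Γ → trans (agree E′ r (m<n⇒m<1+n r<Γ)) (upd-below ρ v r<Γ) }

  wp-bind : ∀ {Γ ρ e c X Q A} → {ok : okE Γ e} → ∀ v → 1 ≤ X → Safe e ρ A → eval e ρ A ≡ v → v < B →
            wp (suc Γ) (ρ [ Γ ↦ v ]) c X Q A → wp Γ ρ (bind e c) X Q A
  run (wp-bind {Γ} {ρ} {e} {c} {X} {A = A} {ok} v 1≤X s refl v<B h) f M ω E R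
    with compE-correct {ω = ω} e ok s E R ≤-refl
  ... | f₁ , r₁ , e₁ , k₁ with run h f₁ M ω (extend E k₁ e₁ v<B) R
  ... | d , f₂ , M₂ , A₂ , r₂ , d≤ , E₂ , R₂ , q =
      _ , f₂ , M₂ , A₂ , seq r₁ r₂ ,
      ≤-trans (+-mono-≤ (m≤m*X (timeE e) 1≤X) d≤) (≤-reflexive (sym (*-distribʳ-+ X (timeE e) (κ c)))) ,
      restrict E E₂ , R₂ , q

  module Loop {Γ : ℕ} {ρ : ℕ → ℕ} {c : Cmd} {X : ℕ} {Inv : ℕ → Mem → Set} (limit : ℕ) (limit<B : limit < B) (1≤X : 1 ≤ X)
    (body : ∀ i → i < limit → ∀ A → Inv i A →
            wp (2 + Γ) (ρ [ Γ ↦ i ] [ suc Γ ↦ limit ]) c X (Inv (suc i)) A) where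

    loopBody : Program
    loopBody = comp (2 + Γ) c ⨾ instr (const (2 + Γ) 1) ⨾ instr (arith add Γ Γ (2 + Γ)) ⨾
               instr (arith lt (2 + Γ) Γ (suc Γ))

    -- Induction on the number r of passes left. A pass costs its body and four more steps: the
    -- test, two instructions to increment the counter, and the comparison. The extra 1 is the final
    -- failing test.
    loop : ∀ r i → r + i ≡ limit → ∀ f M ω A → EnvRel Γ ρ f → MemRel M A →
           f Γ ≡ i → f (suc Γ) ≡ limit → f (2 + Γ) ≡ bool (i <ᵇ limit) → Inv i A →
           ∃[ d ] ∃[ f′ ] ∃[ M′ ] ∃[ A′ ] (Run (while (2 + Γ) loopBody) ⟨ f , M , ω ⟩ d ⟨ f′ , M′ , ω ⟩ ×
             d ≤ 1 + r * (κ c * X + 4) × EnvRel Γ ρ f′ × MemRel M′ A′ × Inv limit A′)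
    loop zero i refl f M ω A E R fi fl ft inv =
      1 , f , M , A , while-z (trans ft (cong bool (<ᵇ-irrefl i))) , s≤s z≤n , E , R , inv
      where
      <ᵇ-irrefl : ∀ i → (i <ᵇ i) ≡ false
      <ᵇ-irrefl zero    = refl
      <ᵇ-irrefl (suc i) = <ᵇ-irrefl i
    loop (suc r) i refl f M ω A E R fi fl ft inv
      with run (body i (s≤s (m≤n+m i r)) A inv) f M ω
             (extend (extend E (λ _ _ → refl) fi (<-trans (s≤s (m≤n+m i r)) limit<B)) (λ _ _ → refl) fl limit<B) R
    ... | d , f₁ , M₁ , A₁ , r₁ , d≤ , E₁ , R₁ , inv₁
      with loop r (suc i) (+-suc r i) f₄ M₁ ω A₁ E₄ R₁ v₄ l₄ t₄ inv₁
      where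
      f₂ f₃ f₄ : ℕ → ℕ
      f₂ = f₁ [ 2 + Γ ↦ trunc w 1 ]
      f₃ = f₂ [ Γ ↦ evalOp w add (f₂ Γ) (f₂ (2 + Γ)) ]
      f₄ = f₃ [ 2 + Γ ↦ evalOp w lt (f₃ Γ) (f₃ (suc Γ)) ]
      1<2^w : 1 < 2 ^ w
      1<2^w = <-≤-trans (bool<B true) B≤2^w
      Γ<2+Γ : Γ < 2 + Γ
      Γ<2+Γ = s≤s (n≤1+n Γ)
      v₂ : f₂ Γ ≡ i
      v₂ = trans (upd-below f₁ (trunc w 1) Γ<2+Γ)
        (trans (agree E₁ Γ Γ<2+Γ) (trans (upd-below (ρ [ Γ ↦ i ]) (suc r + i) ≤-refl) (upd-same ρ Γ i)))
      v₃ : f₃ Γ ≡ suc i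
      v₃ = trans (upd-same f₂ Γ _)
        (trans (cong₂ (evalOp w add) v₂ (trans (upd-same f₁ (2 + Γ) _) (trunc-id 1<2^w)))
          (trans (cong (trunc w) (+-comm i 1)) (trunc-id (≤-<-trans (s≤s (m≤n+m i r)) (<-≤-trans limit<B B≤2^w)))))
      v₄ : f₄ Γ ≡ suc i
      v₄ = trans (upd-below f₃ (evalOp w lt (f₃ Γ) (f₃ (suc Γ))) Γ<2+Γ) v₃
      l₃ : f₃ (suc Γ) ≡ suc r + i
      l₃ = trans (upd-other f₂ _ (λ e → <-irrefl (sym e) ≤-refl))
        (trans (upd-below f₁ (trunc w 1) ≤-refl)
          (trans (agree E₁ (suc Γ) ≤-refl) (upd-same (ρ [ Γ ↦ i ]) (suc Γ) _)))
      l₄ : f₄ (suc Γ) ≡ suc r + i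
      l₄ = trans (upd-below f₃ {2 + Γ} {suc Γ} (evalOp w lt (f₃ Γ) (f₃ (suc Γ))) ≤-refl) l₃
      t₄ : f₄ (2 + Γ) ≡ bool (suc i <ᵇ suc r + i)
      t₄ = trans (upd-same f₃ (2 + Γ) _) (trans (cong₂ (evalOp w lt) v₃ l₃) (trunc-bool (suc i <ᵇ suc r + i)))
      E₄ : EnvRel Γ ρ f₄
      E₄ = below (restrict E (restrict (extend E (λ _ _ → refl) fi (<-trans (s≤s (m≤n+m i r)) limit<B)) E₁))
             (λ q q< → trans (upd-below f₃ _ (m<n⇒m<1+n (m<n⇒m<1+n q<)))
               (trans (upd-below f₂ _ q<) (upd-below f₁ (trunc w 1) (m<n⇒m<1+n (m<n⇒m<1+n q<)))))
    ... | d′ , f₅ , M₅ , A₅ , r₅ , d′≤ , E₅ , R₅ , inv₅ =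
        _ , f₅ , M₅ , A₅ ,
        while-nz (λ z → 1≢0 (trans (sym (trans ft (cong bool (<ᵇ-true i r)))) z))
          (seq r₁ (seq (instr const) (seq (instr arith) (instr arith)))) r₅ ,
        (begin
          1 + (d + 3) + d′                                       ≤⟨ +-mono-≤ (s≤s (+-monoˡ-≤ 3 d≤)) d′≤ ⟩
          1 + (κ c * X + 3) + (1 + r * (κ c * X + 4))            ≡⟨ +-suc (1 + (κ c * X + 3)) _ ⟩
          1 + (1 + (κ c * X + 3) + r * (κ c * X + 4))            ≡⟨ cong (λ z → 1 + (z + r * (κ c * X + 4))) (sym (+-suc (κ c * X) 3)) ⟩
          1 + suc r * (κ c * X + 4)                              ∎) ,
        E₅ , R₅ , inv₅
      where
      open ≤-Reasoning
      1≢0 : 1 ≢ 0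
      1≢0 ()
      <ᵇ-true : ∀ i r → (i <ᵇ suc r + i) ≡ true
      <ᵇ-true i r with i <ᵇ suc r + i | <⇒<ᵇ {i} {suc r + i} (s≤s (m≤n+m i r))
      ... | true | _ = refl

  -- The factor a of the budget is kept apart from the number of passes because a loop without
  -- passes also takes time. This occurs: the copying loop of a relaxation has limit 0 when only the
  -- value is computed.
  wp-iter : ∀ {Γ ρ e c X Q A} → {ok : okE Γ e} → (Inv : ℕ → Mem → Set) (limit a : ℕ) → limit ≤ a → 1 ≤ a → 1 ≤ X →
            Safe e ρ A → eval e ρ A ≡ limit → limit < B → Inv 0 A →
            (∀ i → i < limit → ∀ A → Inv i A → wp (2 + Γ) (ρ [ Γ ↦ i ] [ suc Γ ↦ limit ]) c X (Inv (suc i)) A) →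
            (∀ A → Inv limit A → Q A) → wp Γ ρ (iter e c) (a * X) Q A
  run (wp-iter {Γ} {ρ} {e} {c} {X} {Q} {A} {ok} Inv limit a limit≤a 1≤a 1≤X s e≡ limit<B inv body post) f M ω E R
    with compE-correct {ω = ω} e {suc Γ} ok s E R (n≤1+n Γ)
  ... | f₁ , r₁ , e₁ , k₁
    with Loop.loop {X = X} {Inv = Inv} limit limit<B 1≤X body limit 0 (+-identityʳ limit) f₃ M ω A E₃ R v₃ l₃ t₃ inv
    where
    f₂ f₃ : ℕ → ℕ
    f₂ = f₁ [ Γ ↦ trunc w 0 ]
    f₃ = f₂ [ 2 + Γ ↦ evalOp w lt (f₂ Γ) (f₂ (suc Γ)) ]
    v₂ : f₂ Γ ≡ 0
    v₂ = trans (upd-same f₁ Γ _) (trunc-id (≤-<-trans z≤n (<-≤-trans limit<B B≤2^w)))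
    v₃ : f₃ Γ ≡ 0
    v₃ = trans (upd-below f₂ _ (s≤s (n≤1+n Γ))) v₂
    l₂ : f₂ (suc Γ) ≡ limit
    l₂ = trans (upd-other f₁ (trunc w 0) (λ e → <-irrefl (sym e) ≤-refl)) (trans e₁ e≡)
    l₃ : f₃ (suc Γ) ≡ limit
    l₃ = trans (upd-below f₂ _ ≤-refl) l₂
    t₃ : f₃ (2 + Γ) ≡ bool (0 <ᵇ limit)
    t₃ = trans (upd-same f₂ (2 + Γ) _) (trans (cong₂ (evalOp w lt) v₂ l₂) (trunc-bool (0 <ᵇ limit)))
    E₃ : EnvRel Γ ρ f₃
    E₃ = below E (λ r r< → trans (upd-below f₂ _ (m<n⇒m<1+n (m<n⇒m<1+n r<)))
           (trans (upd-below f₁ (trunc w 0) r<) (k₁ r (m<n⇒m<1+n r<))))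
  ... | d , f₄ , M₄ , A₄ , r₄ , d≤ , E₄ , R₄ , inv₄ =
      _ , f₄ , M₄ , A₄ , seq r₁ (seq (instr const) (seq (instr arith) r₄)) ,
      (begin
        timeE e + (1 + (1 + d))                                  ≤⟨ +-mono-≤ (m≤m*X (timeE e) 1≤aX) (s≤s (s≤s (≤-trans d≤ (s≤s (*-monoˡ-≤ (κ c * X + 4) limit≤a))))) ⟩
        timeE e * (a * X) + (3 + a * (κ c * X + 4))              ≤⟨ +-monoʳ-≤ (timeE e * (a * X)) (+-mono-≤ (m≤m*X 3 1≤aX) step) ⟩
        timeE e * (a * X) + (3 * (a * X) + (κ c + 4) * (a * X))  ≡⟨ cong (timeE e * (a * X) +_) (sym (*-distribʳ-+ (a * X) 3 (κ c + 4))) ⟩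
        timeE e * (a * X) + (3 + (κ c + 4)) * (a * X)            ≡⟨ sym (*-distribʳ-+ (a * X) (timeE e) (3 + (κ c + 4))) ⟩
        κ (iter e c) * (a * X)                                   ∎) ,
      E₄ , R₄ , post A₄ inv₄
    where
    open ≤-Reasoning
    1≤aX : 1 ≤ a * X
    1≤aX = *-mono-≤ 1≤a 1≤X
    step : a * (κ c * X + 4) ≤ (κ c + 4) * (a * X)
    step = begin
      a * (κ c * X + 4)        ≤⟨ *-monoʳ-≤ a (+-monoʳ-≤ (κ c * X) (m≤m*X 4 1≤X)) ⟩
      a * (κ c * X + 4 * X)    ≡⟨ cong (a *_) (sym (*-distribʳ-+ X (κ c) 4)) ⟩
      a * ((κ c + 4) * X)      ≡⟨ sym (*-assoc a (κ c + 4) X) ⟩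
      a * (κ c + 4) * X        ≡⟨ cong (_* X) (*-comm a (κ c + 4)) ⟩
      (κ c + 4) * a * X        ≡⟨ *-assoc (κ c + 4) a X ⟩
      (κ c + 4) * (a * X)      ∎

-- Potentials and tight arcs

lookup-injective : ∀ {A : Set} {xs : List A} → Unique xs → ∀ i j → lookup xs i ≡ lookup xs j → i ≡ j
lookup-injective (_ ∷ _)   Fin.zero Fin.zero e = refl
lookup-injective (px ∷ _)  Fin.zero (Fin.suc j) e = contradiction e (All.lookup px (∈-lookup j))
lookup-injective (px ∷ _)  (Fin.suc i) Fin.zero e = contradiction (sym e) (All.lookup px (∈-lookup i))
lookup-injective (_ ∷ u)   (Fin.suc i) (Fin.suc j) e = cong Fin.suc (lookup-injective u i j e)

unique-length : ∀ {m} {es : List (Fin m)} → Unique es → length es ≤ m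
unique-length {es = es} u = Fin.injective⇒≤ {f = lookup es} (λ {i} {j} → lookup-injective u i j)

module Graph {n m : ℕ} (G : Digraph n m) where
  open Digraph G

  Wk : Fin n → Fin n → Set
  Wk = Walk G

  wt : ∀ {s t} → Wk s t → ℕ
  wt = totalWeight G

  vs : ∀ {s t} → Wk s t → List (Fin n)
  vs = vertices G

  arcs : ∀ {s t} → Wk s t → List (Fin m)
  arcs ε             = []
  arcs ((e , _) ◅ p) = e ∷ arcs p

  size : ∀ {s t} → Wk s t → ℕ
  size p = length (arcs p)

  length-vs : ∀ {s t} (p : Wk s t) → length (vs p) ≡ suc (size p)
  length-vs ε       = refl
  length-vs (_ ◅ p) = cong suc (length-vs p)

  sources : ∀ {s t} (p : Wk s t) → All (λ e → src e ∈ vs p) (arcs p)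
  sources ε = []
  sources ((e , refl , refl) ◅ p) = here refl ∷ All.map there (sources p)

  arcs-unique : ∀ {s t} (p : Wk s t) → Unique (vs p) → Unique (arcs p)
  arcs-unique ε u = []
  arcs-unique ((e , refl , refl) ◅ p) (s∉ ∷ u) =
    All.map (λ { src∈ refl → All.lookup s∉ src∈ refl }) (sources p) ∷ arcs-unique p u

  -- The arcs of a path have distinct sources, hence are distinct. A bound by m instead of n
  -- matters: isolated vertices can make n larger than m, and the claimed time affords O(m) rounds
  -- but not O(n).
  size≤m : ∀ {s t} (p : Wk s t) → Unique (vs p) → size p ≤ m
  size≤m p u = unique-length (arcs-unique p u)

  suffix : ∀ {s t v} (p : Wk s t) → Unique (vs p) → v ∈ vs p →
           Σ[ q ∈ Wk v t ] (Unique (vs q) × wt q ≤ wt p)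
  suffix ε u (here refl) = ε , u , ≤-refl
  suffix (a ◅ p) u (here refl) = a ◅ p , u , ≤-refl
  suffix ((e , refl , refl) ◅ p) (_ ∷ u) (there v∈) with suffix p u v∈
  ... | q , uq , le = q , uq , m≤n⇒m≤o+n (weight e) le

  open import Data.List.Membership.DecPropositional (Fin._≟_ {n}) using () renaming (_∈?_ to _∈ᵥ?_)

  -- Loop erasure: weights are not negative, so cutting out cycles costs nothing. Rounds of
  -- relaxation account only for walks with a bounded number of arcs, which paths respect.
  erase : ∀ {s t} (p : Wk s t) → Σ[ q ∈ Wk s t ] (Unique (vs q) × wt q ≤ wt p)
  erase ε = ε , [] ∷ [] , z≤n
  erase {s} ((e , refl , refl) ◅ p) with erase p
  ... | q , uq , le with s ∈ᵥ? vs q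
  ... | no  s∉ = (e , refl , refl) ◅ q ,
                 All.tabulate (λ v∈ s≡v → s∉ (subst (_∈ vs q) (sym s≡v) v∈)) ∷ uq , +-monoʳ-≤ (weight e) le
  ... | yes s∈ with suffix q uq s∈
  ... | q′ , uq′ , le′ = q′ , uq′ , m≤n⇒m≤o+n (weight e) (≤-trans le′ le)

  wt≤ : ∀ {W} → (∀ e → weight e ≤ W) → ∀ {s t} (p : Wk s t) → wt p ≤ size p * W
  wt≤ w≤ ε             = z≤n
  wt≤ w≤ ((e , _) ◅ p) = +-mono-≤ (w≤ e) (wt≤ w≤ p)

  attained≤ : ∀ {top t} {g : Fin n → ℕ} → (∀ v → 0 < g v → Σ[ p ∈ Wk v t ] (g v + wt p ≡ top)) → ∀ v → g v ≤ top
  attained≤ {top} {g = g} a v with g v in eqn | a v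
  ... | zero  | _ = z≤n
  ... | suc x | f with f (s≤s z≤n)
  ... | p , e = subst (suc x ≤_) e (m≤m+n (suc x) (wt p))

  -- g v stands for top − dist(v , t), or 0 if t cannot be reached from v.
  record Potential (top : ℕ) (t : Fin n) (g : Fin n → ℕ) : Set where
    field
      target   : g t ≡ top
      feasible : ∀ e → g (tgt e) ≤ g (src e) + weight e
      attained : ∀ v → 0 < g v → Σ[ p ∈ Wk v t ] (g v + wt p ≡ top)

    feasible* : ∀ {u v} (p : Wk u v) → g v ≤ g u + wt p
    feasible* {u} ε = ≤-reflexive (sym (+-identityʳ (g u)))
    feasible* ((e , refl , refl) ◅ p) = ≤-trans (feasible* p)
      (≤-trans (+-monoˡ-≤ (wt p) (feasible e)) (≤-reflexive (+-assoc (g (src e)) (weight e) (wt p))))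

    Tight : Fin m → Set
    Tight e = g (tgt e) ≡ g (src e) + weight e

    AllTight : ∀ {u v} → Wk u v → Set
    AllTight p = All Tight (arcs p)

    g≤top : ∀ v → g v ≤ top
    g≤top = attained≤ attained

    tight-weight : ∀ {u v} (p : Wk u v) → AllTight p → g v ≡ g u + wt p
    tight-weight {u} ε [] = sym (+-identityʳ (g u))
    tight-weight ((e , refl , refl) ◅ p) (τ ∷ τs) =
      trans (tight-weight p τs) (trans (cong (_+ wt p) τ) (+-assoc (g (src e)) (weight e) (wt p)))

    -- Feasibility telescopes along the walk to the opposite inequality; equality of the sums forces
    -- equality in every summand.
    weight-tight : ∀ {u v} (p : Wk u v) → g u + wt p ≤ g v → AllTight p
    weight-tight ε le = []
    weight-tight ((e , refl , refl) ◅ p) le =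
      ≤-antisym (feasible e) (+-cancelʳ-≤ (wt p) _ _ (≤-trans (≤-reflexive (+-assoc _ (weight e) (wt p))) (≤-trans le (feasible* p))))
      ∷ weight-tight p (≤-trans (+-monoˡ-≤ (wt p) (feasible e)) (≤-trans (≤-reflexive (+-assoc _ (weight e) (wt p))) le))

    tight-grows : ∀ {u v} (p : Wk u v) → AllTight p → All (λ x → g u ≤ g x) (vs p)
    tight-grows ε [] = ≤-refl ∷ []
    tight-grows ((e , refl , refl) ◅ p) (τ ∷ τs) =
      ≤-refl ∷ All.map (≤-trans (≤-trans (m≤m+n _ (weight e)) (≤-reflexive (sym τ)))) (tight-grows p τs)

    -- Weights are strictly positive, so g strictly increases along tight arcs and no vertex can
    -- recur.
    tight-unique : ∀ {u v} (p : Wk u v) → AllTight p → Unique (vs p)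
    tight-unique ε _ = [] ∷ []
    tight-unique ((e , refl , refl) ◅ p) (τ ∷ τs) =
      All.map (λ { le refl → <-irrefl refl (<-≤-trans (m<m+n (g (src e)) (positive e))
                     (≤-trans (≤-reflexive (sym τ)) le)) }) (tight-grows p τs)
      ∷ tight-unique p τs

    tight⇒shortest : ∀ {s} (p : Wk s t) → AllTight p → ShortestPath G s t
    tight⇒shortest {s} p τs = record
      { walk = p ; isPath = tight-unique p τs
      ; shortest = λ q _ → +-cancelˡ-≤ (g s) _ _ (≤-trans (≤-reflexive (sym (tight-weight p τs))) (feasible* q)) }

    attained-tight : ∀ v → 0 < g v → Σ[ p ∈ Wk v t ] AllTight p
    attained-tight v 0<g with attained v 0<g
    ... | p , e = p , weight-tight p (≤-reflexive (trans e (sym target)))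

    -- Some tight walk exists, and its weight is the difference of the potentials. A shortest path
    -- weighs no more than that, which leaves no slack on any arc.
    shortest⇒tight : ∀ {s} → 0 < g s → (P : ShortestPath G s t) → AllTight (ShortestPath.walk P)
    shortest⇒tight {s} 0<g P with attained-tight s 0<g
    ... | p , τs = weight-tight (ShortestPath.walk P)
          (≤-trans (+-monoʳ-≤ (g s) (ShortestPath.shortest P p (tight-unique p τs)))
            (≤-reflexive (sym (tight-weight p τs))))

  module BellmanFord (top W : ℕ) (w≤W : ∀ e → weight e ≤ W) (m*W<top : m * W < top) (t : Fin n) where

    Attained : (Fin n → ℕ) → Set
    Attained g = ∀ v → 0 < g v → Σ[ p ∈ Wk v t ] (g v + wt p ≡ top)

    Covers : ℕ → (Fin n → ℕ) → Set
    Covers r g = ∀ v (p : Wk v t) → size p ≤ r → top ≤ g v + wt p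

    attained-step : ∀ {g g′} e → Attained g → g (tgt e) ∸ weight e ≡ g′ → 0 < g′ →
                    Σ[ p ∈ Wk (src e) t ] (g′ + wt p ≡ top)
    attained-step {g} e A refl 0<g′ with A (tgt e) (<-≤-trans 0<g′ (m∸n≤m (g (tgt e)) (weight e)))
    ... | p , eqn = (e , refl , refl) ◅ p ,
        trans (sym (+-assoc (g (tgt e) ∸ weight e) (weight e) (wt p)))
          (trans (cong (_+ wt p) (m∸n+n≡m {g (tgt e)} {weight e} (<⇒≤ (m∸n≢0⇒n<m (λ z → <-irrefl (sym z) 0<g′))))) eqn)

    covers-step : ∀ {r g g′} → Covers r g → (∀ v → g v ≤ g′ v) →
                  (∀ e → g (tgt e) ≤ g′ (src e) + weight e) → Covers (suc r) g′
    covers-step C g≤ relaxed v ε _ = ≤-trans (C v ε z≤n) (+-monoˡ-≤ 0 (g≤ v))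
    covers-step C g≤ relaxed v ((e , refl , refl) ◅ p) (s≤s le) =
      ≤-trans (C (tgt e) p le) (≤-trans (+-monoˡ-≤ (wt p) (relaxed e)) (≤-reflexive (+-assoc _ (weight e) (wt p))))

    covers-zero : ∀ {g} → g t ≡ top → Covers 0 g
    covers-zero {g} gt .t ε _ = ≤-reflexive (trans (sym gt) (sym (+-identityʳ (g t))))

    -- The walk attaining the value behind an arc can be made a path of at most m arcs; with the arc
    -- in front it has m + 1, hence m + 1 rounds.
    potential : ∀ {g} → g t ≡ top → Attained g → Covers (suc m) g → Potential top t g
    potential {g} gt A C = record { target = gt ; attained = A ; feasible = feas }
      where
      feas : ∀ e → g (tgt e) ≤ g (src e) + weight e
      feas e with 0 <? g (tgt e)
      ... | no  g≡0 = ≤-trans (≮⇒≥ g≡0) z≤n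
      ... | yes 0<g with A (tgt e) 0<g
      ... | p , eqn with erase p
      ... | q , uq , le = +-cancelʳ-≤ (wt q) _ _ (begin
              g (tgt e) + wt q              ≤⟨ +-monoʳ-≤ (g (tgt e)) le ⟩
              g (tgt e) + wt p              ≡⟨ eqn ⟩
              top                           ≤⟨ C (src e) ((e , refl , refl) ◅ q) (s≤s (size≤m q uq)) ⟩
              g (src e) + (weight e + wt q) ≡⟨ sym (+-assoc _ (weight e) (wt q)) ⟩
              g (src e) + weight e + wt q   ∎)
        where open ≤-Reasoning

    -- This makes 0 unambiguous: a vertex that reaches t does so by a path of at most m arcs, and
    -- such a path weighs less than `top`.
    reachable : ∀ {g s} → Covers (suc m) g → Wk s t → 0 < g s
    reachable {g} {s} C p with erase p
    ... | q , uq , _ = +-cancelʳ-< (wt q) 0 (g s) (<-≤-trans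
          (≤-<-trans (≤-trans (wt≤ w≤W q) (*-monoˡ-≤ W (size≤m q uq))) m*W<top)
          (C s q (m≤n⇒m≤1+n (size≤m q uq))))

-- Pairs of paths in a levelled network

count : List ℕ → List ℕ → ℕ
count []       ys = 0
count (x ∷ xs) ys = bool (does (x ∈? ys)) + count xs ys

count-mono : ∀ xs {ys zs} → (∀ {x} → x ∈ xs → x ∈ ys → x ∈ zs) → count xs ys ≤ count xs zs
count-mono []       f = z≤n
count-mono (x ∷ xs) {ys} {zs} f = +-mono-≤ head (count-mono xs (λ x∈ → f (there x∈)))
  where
  head : bool (does (x ∈? ys)) ≤ bool (does (x ∈? zs))
  head with x ∈? ys | x ∈? zs
  ... | no _     | _      = z≤n
  ... | yes _    | yes _  = ≤-refl
  ... | yes x∈ys | no x∉  = contradiction (f (here refl) x∈ys) x∉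

data Path (R : ℕ → ℕ → Set) : ℕ → ℕ → List ℕ → Set where
  nil  : ∀ {u} → Path R u u (u ∷ [])
  cons : ∀ {u v w xs} → R u v → Path R v w xs → Path R u w (u ∷ xs)

module _ {R : ℕ → ℕ → Set} where

  path-length : ∀ {u v xs} → Path R u v xs → 1 ≤ length xs
  path-length nil        = s≤s z≤n
  path-length (cons _ _) = s≤s z≤n

  head∈ : ∀ {u v xs} → Path R u v xs → u ∈ xs
  head∈ nil        = here refl
  head∈ (cons _ _) = here refl

  path-append : ∀ {a b c d xs ys} → Path R a b xs → R b c → Path R c d ys → Path R a d (xs ++ ys)
  path-append nil        r q = cons r q
  path-append (cons s p) r q = cons s (path-append p r q)

  path-all : ∀ {P : ℕ → Set} {u v xs} → (∀ {a b} → R a b → P a × P b) → P u → Path R u v xs → All P xs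
  path-all f pu nil        = pu ∷ []
  path-all f pu (cons r p) = pu ∷ path-all f (proj₂ (f r)) p

path-map : ∀ {R R′ : ℕ → ℕ → Set} {u v xs} → (∀ {a b} → R a b → R′ a b) → Path R u v xs → Path R′ u v xs
path-map f nil        = nil
path-map f (cons r p) = cons (f r) (path-map f p)

-- A list read off by following the successor function f. Nothing is required of f at the last
-- entry, so a list can be prolonged by redirecting f there.
data Chain (f : ℕ → ℕ) : List ℕ → Set where
  one  : ∀ {x} → Chain f (x ∷ [])
  _∷_  : ∀ {x y xs} → f x ≡ y → Chain f (y ∷ xs) → Chain f (x ∷ y ∷ xs)

chain-cong : ∀ {f g xs} → All (λ x → f x ≡ g x) xs → Chain f xs → Chain g xs
chain-cong e one = one
chain-cong (e ∷ es) (c ∷ cs) = trans (sym e) c ∷ chain-cong es cs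

chain-upd : ∀ {f xs a b} → a ∉ xs → Chain f xs → Chain (f [ a ↦ b ]) xs
chain-upd {f} {xs} {a} {b} a∉ = chain-cong (All.tabulate (λ x∈ → sym (upd-other f b (λ e → a∉ (subst (_∈ xs) e x∈)))))

chain-cons : ∀ {R f u v w xs} → f u ≡ v → Path R v w xs → Chain f xs → Chain f (u ∷ xs)
chain-cons e nil c        = e ∷ c
chain-cons e (cons _ _) c = e ∷ c

chain-append : ∀ {R R′ f a b c d xs ys} → Path R a b xs → Path R′ c d ys → f b ≡ c →
               Chain f xs → Chain f ys → Chain f (xs ++ ys)
chain-append nil q e c c′ = chain-cons e q c′
chain-append (cons _ nil) q e (x ∷ c) c′ = x ∷ chain-cons e q c′
chain-append (cons _ p@(cons _ _)) q e (x ∷ c) c′ = x ∷ chain-append p q e c c′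

-- Vertices are the numbers below N and arcs those below M; o₁ and o₂ mark the arcs
-- that the first and the second path may use.  F is the level, and K refines it
-- by the position within a level.
record Network : Set where
  field
    N M top root      : ℕ
    F K from to o₁ o₂   : ℕ → ℕ
    from<N               : ∀ {e} → e < M → from e < N
    to<N               : ∀ {e} → e < M → to e < N
    K-refines-F       : ∀ {u v} → u < N → v < N → F u < F v → K u < K v
    K-increases       : ∀ {e} → e < M → o₁ e ≢ 0 → K (from e) < K (to e)
    F-decreases       : ∀ {e} → e < M → o₂ e ≢ 0 → F (to e) ≤ F (from e)
    K-increases-level : ∀ {e} → e < M → o₂ e ≢ 0 → F (to e) ≡ F (from e) → K (from e) < K (to e)
    top<N             : top < N
    root<N            : root < N
    top-level         : ∀ {v} → v < N → F top ≤ F v → v ≡ top ⊎ v ≡ root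
    F-top<F-root      : F top < F root
    top-leaves-level  : ∀ {e} → e < M → o₂ e ≢ 0 → from e ≡ top → F (to e) ≢ F (from e)
    root-to-top       : ∀ {e} → e < M → o₂ e ≢ 0 → from e ≡ root → to e ≡ top

module NetworkTheory (𝒩 : Network) where
  open Network 𝒩

  R₁ R₂ R₂ₛ : ℕ → ℕ → Set
  R₁ u v  = ∃[ e ] (e < M × o₁ e ≢ 0 × from e ≡ u × to e ≡ v)
  R₂ u v  = ∃[ e ] (e < M × o₂ e ≢ 0 × from e ≡ u × to e ≡ v)
  R₂ₛ u v = R₂ u v × F v ≡ F u

  <N₁ : ∀ {a b} → R₁ a b → a < N × b < N
  <N₁ (e , e<M , _ , refl , refl) = from<N e<M , to<N e<M

  <N₂ : ∀ {a b} → R₂ a b → a < N × b < N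
  <N₂ (e , e<M , _ , refl , refl) = from<N e<M , to<N e<M

  path₁-grows : ∀ {u v xs} → Path R₁ u v xs → All (λ x → K u ≤ K x) xs × K u ≤ K v
  path₁-grows nil = ≤-refl ∷ [] , ≤-refl
  path₁-grows (cons (e , e<M , o , refl , refl) p) with path₁-grows p
  ... | a , l = ≤-refl ∷ All.map (≤-trans (<⇒≤ (K-increases e<M o))) a , ≤-trans (<⇒≤ (K-increases e<M o)) l

  level-path : ∀ {u v xs} → Path R₂ₛ u v xs → All (λ x → F x ≡ F u × K u ≤ K x) xs × F v ≡ F u
  level-path nil = (refl , ≤-refl) ∷ [] , refl
  level-path (cons ((e , e<M , o , refl , refl) , F≡) p) with level-path p
  ... | a , l = (refl , ≤-refl) ∷
                All.map (λ { (x , y) → trans x F≡ , ≤-trans (<⇒≤ (K-increases-level e<M o F≡)) y }) a ,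
                trans l F≡

  level-tail : ∀ {u v w xs} → R₂ₛ u v → Path R₂ₛ v w xs → All (λ x → K u < K x) xs
  level-tail ((e , e<M , o , refl , refl) , F≡) p =
    All.map (λ { (_ , y) → <-≤-trans (K-increases-level e<M o F≡) y }) (proj₁ (level-path p))

  path₂-falls : ∀ {u v xs} → Path R₂ u v xs → All (λ x → F v ≤ F x) xs × F v ≤ F u
  path₂-falls nil = ≤-refl ∷ [] , ≤-refl
  path₂-falls (cons (e , e<M , o , refl , refl) p) with path₂-falls p
  ... | a , l = ≤-trans l (F-decreases e<M o) ∷ a , ≤-trans l (F-decreases e<M o)

  -- The second path strictly advances in this lexicographic order, level falling first and then `K`
  -- rising, so it never returns to a vertex.
  _◁_ : ℕ → ℕ → Set
  a ◁ b = F b < F a ⊎ (F b ≡ F a × K a < K b)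

  ◁-trans : ∀ {a b c} → a ◁ b → b ◁ c → a ◁ c
  ◁-trans (inj₁ x)       (inj₁ y)        = inj₁ (<-trans y x)
  ◁-trans (inj₁ x)       (inj₂ (e , _))  = inj₁ (≤-<-trans (≤-reflexive e) x)
  ◁-trans (inj₂ (e , _)) (inj₁ y)        = inj₁ (<-≤-trans y (≤-reflexive e))
  ◁-trans (inj₂ (e , x)) (inj₂ (e′ , y)) = inj₂ (trans e′ e , <-trans x y)

  ◁-irrefl : ∀ {a} → ¬ (a ◁ a)
  ◁-irrefl (inj₁ x)       = <-irrefl refl x
  ◁-irrefl (inj₂ (_ , x)) = <-irrefl refl x

  R₂⇒◁ : ∀ {a b} → R₂ a b → a ◁ b
  R₂⇒◁ (e , e<M , o , refl , refl) with m≤n⇒m<n∨m≡n (F-decreases e<M o)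
  ... | inj₁ l = inj₁ l
  ... | inj₂ l = inj₂ (l , K-increases-level e<M o l)

  path₂-◁ : ∀ {a b c xs} → R₂ a b → Path R₂ b c xs → a ◁ c
  path₂-◁ r nil        = R₂⇒◁ r
  path₂-◁ r (cons s p) = ◁-trans (R₂⇒◁ r) (path₂-◁ s p)

  -- By `_◁_` the last vertex does not occur earlier on the path, so redirecting its successor
  -- disturbs no other link.
  chain-upd-last : ∀ {a b f c xs} → Path R₂ a b xs → Chain f xs → Chain (f [ b ↦ c ]) xs
  chain-upd-last nil one = one
  chain-upd-last {f = f} {c} (cons r p@nil) (x ∷ cs) =
    trans (upd-other f c (λ { refl → ◁-irrefl (path₂-◁ r p) })) x ∷ chain-upd-last p cs
  chain-upd-last {f = f} {c} (cons r p@(cons _ _)) (x ∷ cs) =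
    trans (upd-other f c (λ { refl → ◁-irrefl (path₂-◁ r p) })) x ∷ chain-upd-last p cs

  -- A state (u , v , y , z): the remaining part of the first path leads from u
  -- to top; that of the second path leads from v to y on one level and, before
  -- this level, from root to z.
  record Realised (b val : ℕ) (f₁ f₂ : ℕ → ℕ) (u v y z : ℕ) : Set where
    field
      {xs ws zs} : List ℕ
      path₁      : Path R₁ u top xs
      level      : Path R₂ₛ v y ws
      path₂      : Path R₂ root z zs
      above      : F y < F z
      counted    : count xs (ws ++ zs) ≤ val
      small      : val + K u ≤ 1 + K top
      chained    : b ≡ 1 → Chain f₁ xs × Chain f₂ ws × Chain f₂ zs

  open Realised

  realised-cong : ∀ {b val f₁ f₂ g₁ g₂ u v y z} → u < N → v < N →
                  (b ≡ 1 → ∀ i → i < N → f₁ i ≡ g₁ i × f₂ i ≡ g₂ i) →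
                  Realised b val f₁ f₂ u v y z → Realised b val g₁ g₂ u v y z
  realised-cong u<N v<N f≡g r = record
    { path₁ = path₁ r ; level = level r ; path₂ = path₂ r ; above = above r ; counted = counted r ; small = small r
    ; chained = λ b≡1 → let (c₁ , c₂ , c₃) = chained r b≡1 in
        chain-cong (All.map (λ {i} i<N → proj₁ (f≡g b≡1 i i<N)) (path-all <N₁ u<N (path₁ r))) c₁ ,
        chain-cong (All.map (λ {i} i<N → proj₂ (f≡g b≡1 i i<N)) (path-all (λ x → <N₂ (proj₁ x)) v<N (level r))) c₂ ,
        chain-cong (All.map (λ {i} i<N → proj₂ (f≡g b≡1 i i<N)) (path-all <N₂ root<N (path₂ r))) c₃ }

  realised-terminal : ∀ {b f₁ f₂} → Realised b 1 f₁ f₂ top top top root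
  realised-terminal = record
    { path₁ = nil ; level = nil ; path₂ = nil ; above = F-top<F-root
    ; counted = ≤-trans (+-monoˡ-≤ 0 (bool≤1 (does (top ∈? (top ∷ root ∷ []))))) ≤-refl ; small = ≤-refl
    ; chained = λ _ → one , one , one }

  -- The rest of the level has larger `K` than v, and the part of the second path before it lies on
  -- higher levels. Hence a first path that is not ahead of v can meet the second one at u only if u
  -- is v itself.
  K-above : ∀ {u x v y ws zs z} → v < N → Path R₂ₛ v y ws → Path R₂ root z zs → F y < F z →
            K u ≤ K v → x ∈ ws ++ zs → x ≡ v ⊎ K u < K x
  K-above {ws = ws} v<N p q F< u≤v x∈ with ∈-++⁻ ws x∈
  K-above v<N nil q F< u≤v x∈ | inj₁ (here e) = inj₁ e
  K-above v<N (cons _ _) q F< u≤v x∈ | inj₁ (here e) = inj₁ e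
  K-above v<N (cons r p) q F< u≤v x∈ | inj₁ (there x∈′) =
    inj₂ (≤-<-trans u≤v (All.lookup (level-tail r p) x∈′))
  K-above v<N p q F< u≤v x∈ | inj₂ x∈′ = inj₂ (≤-<-trans u≤v (K-refines-F v<N
    (All.lookup (path-all <N₂ root<N q) x∈′)
    (<-≤-trans (≤-<-trans (≤-reflexive (sym (proj₂ (level-path p)))) F<) (All.lookup (proj₁ (path₂-falls q)) x∈′))))

  -- Each of the following three moves takes one arc off one of the two paths,
  -- namely off the one that is behind with respect to K.
  move-first : ∀ {b val f₁ f₂ e v y z} → e < M → o₁ e ≢ 0 → v < N → K (from e) ≤ K v →
               Realised b val f₁ f₂ (to e) v y z →
               Realised b (bool (from e ≡ᵇ v) + val) (f₁ [ from e ↦ to e ]) f₂ (from e) v y z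
  move-first {b} {val} {f₁} {f₂} {e} {v} e<M o v<N u≤v r = record
    { path₁ = cons (e , e<M , o , refl , refl) (path₁ r)
    ; level = level r ; path₂ = path₂ r ; above = above r
    ; counted = +-mono-≤ meet (counted r)
    -- The charge of at most 1 is paid for by the growth of `K` along the arc. This keeps values
    -- within a word, however many relaxations take place.
    ; small = ≤-trans (+-monoˡ-≤ _ (+-monoˡ-≤ val (bool≤1 (from e ≡ᵇ v))))
        (≤-trans (≤-reflexive (sym (+-suc val (K (from e)))))
          (≤-trans (+-monoʳ-≤ val (K-increases e<M o)) (small r)))
    ; chained = λ b≡1 → let (c₁ , c₂ , c₃) = chained r b≡1 in
        chain-cons (upd-same f₁ (from e) (to e)) (path₁ r) (chain-upd fresh c₁) , c₂ , c₃ }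
    where
    fresh : from e ∉ xs r
    fresh x∈ = <-irrefl refl (<-≤-trans (K-increases e<M o) (All.lookup (proj₁ (path₁-grows (path₁ r))) x∈))
    meet : bool (does (from e ∈? (ws r ++ zs r))) ≤ bool (from e ≡ᵇ v)
    meet with from e ∈? (ws r ++ zs r)
    ... | no  _  = z≤n
    ... | yes x∈ with K-above v<N (level r) (path₂ r) (above r) u≤v x∈
    ... | inj₂ l = contradiction l (<-irrefl refl)
    ... | inj₁ e≡ with from e ≡ᵇ v | ≡⇒≡ᵇ (from e) v e≡
    ... | true | _ = s≤s z≤n

  move-level : ∀ {b val f₁ f₂ e u y z} → e < M → o₂ e ≢ 0 → F (to e) ≡ F (from e) → K (from e) < K u →
               Realised b val f₁ f₂ u (to e) y z →
               Realised b val f₁ (f₂ [ from e ↦ to e ]) u (from e) y z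
  move-level {b} {val} {f₁} {f₂} {e} e<M o F≡ v<u r = record
    { path₁ = path₁ r ; level = cons s (level r) ; path₂ = path₂ r ; above = above r ; small = small r
    ; counted = ≤-trans (count-mono (xs r) drop) (counted r)
    ; chained = λ b≡1 → let (c₁ , c₂ , c₃) = chained r b≡1 in
        c₁ , chain-cons (upd-same f₂ (from e) (to e)) (level r) (chain-upd fresh c₂) , chain-upd fresh′ c₃ }
    where
    s : R₂ₛ (from e) (to e)
    s = (e , e<M , o , refl , refl) , F≡
    drop : ∀ {x} → x ∈ xs r → x ∈ from e ∷ ws r ++ zs r → x ∈ ws r ++ zs r
    drop x∈ (there x∈′)  = x∈′
    -- The vertex taken back is behind u, and `K` only grows along the first path, so it is not a
    -- common vertex.
    drop x∈ (here refl)  =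
      contradiction (<-≤-trans v<u (All.lookup (proj₁ (path₁-grows (path₁ r))) x∈)) (<-irrefl refl)
    fresh : from e ∉ ws r
    fresh x∈ = <-irrefl refl (All.lookup (level-tail s (level r)) x∈)
    fresh′ : from e ∉ zs r
    fresh′ x∈ = <-irrefl F≡ (<-≤-trans (≤-<-trans (≤-reflexive (sym (proj₂ (level-path (level r))))) (above r))
                  (All.lookup (proj₁ (path₂-falls (path₂ r))) x∈))

  -- The level from `to e` to z is glued by the descending arc to the path that ends in `from e`,
  -- and together they become the part before the new level. The new level consists of y alone: the
  -- second path has already been followed to its end.
  move-down : ∀ {b val f₁ f₂ e u y z} → e < M → o₂ e ≢ 0 → F (to e) < F (from e) → F y < F z → K y < K u →
              Realised b val f₁ f₂ u (to e) z (from e) →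
              Realised b val f₁ (f₂ [ from e ↦ to e ]) u y y z
  move-down {b} {val} {f₁} {f₂} {e} {u} {y} e<M o F> F< y<u r = record
    { path₁ = path₁ r ; level = nil ; above = F< ; small = small r
    ; path₂ = path-append (path₂ r) (e , e<M , o , refl , refl) (path-map proj₁ (level r))
    ; counted = ≤-trans (count-mono (xs r) drop) (counted r)
    ; chained = λ b≡1 → let (c₁ , c₂ , c₃) = chained r b≡1 in
        c₁ , one , chain-append (path₂ r) (level r) (upd-same f₂ (from e) (to e))
                     (chain-upd-last (path₂ r) c₃) (chain-upd fresh c₂) }
    where
    fresh : from e ∉ ws r
    fresh x∈ = <-irrefl (sym (proj₁ (All.lookup (proj₁ (level-path (level r))) x∈))) F>
    drop : ∀ {x} → x ∈ xs r → x ∈ y ∷ zs r ++ ws r → x ∈ ws r ++ zs r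
    drop x∈ (here refl) =
      contradiction (<-≤-trans y<u (All.lookup (proj₁ (path₁-grows (path₁ r))) x∈)) (<-irrefl refl)
    drop x∈ (there x∈′) with ∈-++⁻ (zs r) x∈′
    ... | inj₁ x∈zs = ∈-++⁺ʳ (ws r) x∈zs
    ... | inj₂ x∈ws = ∈-++⁺ˡ x∈ws

  -- Inequality of costs in which 0 plays the role of infinity.
  Bounds : ℕ → ℕ → ℕ → Set
  Bounds c old new = old ≢ 0 → new ≢ 0 × new ≤ c + old

  Table : Set
  Table = ℕ → ℕ → ℕ → ℕ → ℕ

  -- The three lists have at least one vertex each, so with 2 + r the case r = 0 is vacuous and r =
  -- 1 is the terminal state. The condition on z and v reflects that the only arc leaving `root`
  -- enters `top`; without it no move would apply to a state with z = `root` and v elsewhere.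
  Solved : ℕ → Table → Set
  Solved r V = ∀ {u v y z xs ws zs} → u < N → v < N → y < N → z < N →
    Path R₁ u top xs → Path R₂ₛ v y ws → Path R₂ root z zs →
    F y < F z → (z ≡ root → v ≡ top) → length xs + length ws + length zs ≤ 2 + r →
    V u v y z ≢ 0 × V u v y z ≤ count xs (ws ++ zs)

  -- The level never rises along the second path, so equal levels at both ends leave no arc that
  -- descends.
  flat : ∀ {b z zs} → Path R₂ b z zs → F z ≡ F b → Path R₂ₛ b z zs
  flat nil e = nil
  flat (cons r@(e , e<M , o , refl , refl) p) F≡ = cons (r , b≡) (flat p (trans F≡ (sym b≡)))
    where b≡ = ≤-antisym (F-decreases e<M o) (≤-trans (≤-reflexive (sym F≡)) (proj₂ (path₂-falls p)))

  record LastDescent (a z : ℕ) (zs : List ℕ) : Set where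
    field
      {z′ x′}   : ℕ
      {zs′ ws′} : List ℕ
      before    : Path R₂ a z′ zs′
      arc       : R₂ z′ x′
      descends  : F x′ < F z′
      after     : Path R₂ₛ x′ z ws′
      split     : zs ≡ zs′ ++ ws′

  lastDescent : ∀ {a z zs} → Path R₂ a z zs → F z < F a → LastDescent a z zs
  lastDescent nil F< = contradiction F< (<-irrefl refl)
  lastDescent (cons r p) F< with m≤n⇒m<n∨m≡n (proj₂ (path₂-falls p))
  ... | inj₁ F<b = let d = lastDescent p F<b in record
    { before = cons r (LastDescent.before d) ; arc = LastDescent.arc d ; descends = LastDescent.descends d
    ; after = LastDescent.after d ; split = cong (_ ∷_) (LastDescent.split d) }
  ... | inj₂ F≡b = record
    { before = nil ; arc = r ; descends = ≤-<-trans (≤-reflexive (sym F≡b)) F< ; after = flat p F≡b ; split = refl }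

  record Round (V V′ : Table) : Set where
    field
      via-first  : ∀ {e v y z} → e < M → v < N → y < N → z < N → o₁ e ≢ 0 → K (from e) ≤ K v →
                   Bounds (bool (from e ≡ᵇ v)) (V (to e) v y z) (V′ (from e) v y z)
      via-level  : ∀ {e u y z} → e < M → u < N → y < N → z < N → o₂ e ≢ 0 → F (to e) ≡ F (from e) → K (from e) < K u →
                   Bounds 0 (V u (to e) y z) (V′ u (from e) y z)
      via-down   : ∀ {e u y z} → e < M → u < N → y < N → z < N → o₂ e ≢ 0 → F (to e) < F (from e) → F z ≡ F (to e) →
                   F y < F z → K y < K u → Bounds 0 (V u (to e) z (from e)) (V′ u y y z)

  chain-bound : ∀ {c old new k} → old ≢ 0 × old ≤ k → Bounds c old new → new ≢ 0 × new ≤ c + k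
  chain-bound {c} (ne , le) B = proj₁ (B ne) , ≤-trans (proj₂ (B ne)) (+-monoʳ-≤ c le)

  count-meet : ∀ u v xs {ys} → v ∈ ys → bool (u ≡ᵇ v) + count xs ys ≤ count (u ∷ xs) ys
  count-meet u v xs {ys} v∈ = +-monoˡ-≤ _ (meet (u ≟ v))
    where
    meet : Dec (u ≡ v) → bool (u ≡ᵇ v) ≤ bool (does (u ∈? ys))
    meet (yes refl) with u ∈? ys
    ... | yes _ = bool≤1 (u ≡ᵇ u)
    ... | no v∉ = contradiction v∈ v∉
    meet (no u≢v) with u ≡ᵇ v | ≡ᵇ⇒≡ u v
    ... | false | _ = z≤n
    ... | true  | f = contradiction (f _) u≢v

  -- The first path is finished. Not being behind `top`, v is `top` or `root`, and z lies strictly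
  -- higher, which determines both. As no arc of the second path leaves `top` within its level, y is
  -- `top` too.
  at-top : ∀ {v y z ws} → v < N → z < N → K top ≤ K v → F v < F z → Path R₂ₛ v y ws →
           v ≡ top × y ≡ top × z ≡ root
  at-top {v} {z = z} v<N z<N K≤ F< p with F top ≤? F v
  ... | no  F≰ = contradiction (K-refines-F v<N top<N (≰⇒> F≰)) (≤⇒≯ K≤)
  ... | yes F≤ with top-level v<N F≤ | top-level z<N (≤-trans F≤ (<⇒≤ F<)) | p
  ... | _         | inj₁ refl | _ = contradiction (≤-<-trans F≤ F<) (<-irrefl refl)
  ... | inj₂ refl | inj₂ refl | _ = contradiction F< (<-irrefl refl)
  ... | inj₁ refl | inj₂ refl | nil = refl , refl , refl
  ... | inj₁ refl | inj₂ refl | cons ((e , e<M , o , s , refl) , F≡) _ =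
        contradiction (trans F≡ (cong F (sym s))) (top-leaves-level e<M o s)

  -- The moves read backwards. The path that is behind gives up its first vertex; if the second one
  -- stands at the end of its level, the part before is cut at its last descent. Either way one
  -- vertex disappears from the lists, and the previous round applies.
  solved-step : ∀ {r V V′} → V′ top top top root ≢ 0 × V′ top top top root ≤ 1 →
                Round V V′ → Solved r V → Solved (suc r) V′
  solved-step {r} {V} {V′} terminal ρ H {u} {v} {y} {z} {xs} {ws} {zs} u<N v<N y<N z<N p w q F< side le
    with K u ≤? K v
  solved-step {r} {V} {V′} terminal ρ H {u} {v} {y} {z} u<N v<N y<N z<N nil w q F< side le
    | yes u≤v with at-top v<N z<N u≤v (subst (_< F z) (proj₂ (level-path w)) F<) w
  ... | refl , refl , refl = proj₁ terminal , ≤-trans (proj₂ terminal)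
        (≤-trans (≤-trans met (m≤m+n _ 0)) (count-meet top top [] (∈-++⁺ˡ (head∈ w))))
    where
    met : 1 ≤ bool (top ≡ᵇ top)
    met with top ≡ᵇ top | ≡⇒≡ᵇ top top refl
    ... | true | _ = ≤-refl
  solved-step {r} {V} {V′} terminal ρ H {u} {v} {y} {z} {_} {ws} {zs} u<N v<N y<N z<N
    (cons {xs = xs} (e , e<M , o , refl , refl) p) w q F< side le | yes u≤v =
    let (ne , b) = chain-bound (H (to<N e<M) v<N y<N z<N p w q F< side (≤-pred le))
                     (Round.via-first ρ e<M v<N y<N z<N o u≤v)
    in ne , ≤-trans b (count-meet (from e) v xs (∈-++⁺ˡ (head∈ w)))
  solved-step {r} {V} {V′} terminal ρ H {u} {v} {y} {z} {xs} {_} {zs} u<N v<N y<N z<N p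
    (cons {xs = ws} ((e , e<M , o , refl , refl) , F≡) w) q F< side le | no u≰v =
    let (ne , b) = chain-bound (H u<N (to<N e<M) y<N z<N p w q F< side′
                       (≤-pred (≤-trans (≤-reflexive (cong (_+ length zs) (sym (+-suc (length xs) (length ws))))) le)))
                     (Round.via-level ρ e<M u<N y<N z<N o F≡ (≰⇒> u≰v))
    in ne , ≤-trans b (count-mono xs (λ _ → there))
    where
    side′ : z ≡ root → to e ≡ top
    side′ z≡ = contradiction F≡ (top-leaves-level e<M o (side z≡))
  solved-step {r} {V} {V′} terminal ρ H {u} {v} {y} {z} {xs} {_} {zs} u<N v<N y<N z<N p nil q F< side le
    | no u≰v with F z <? F root
  -- If z is as high as `root`, it is `root`, so v is `top`; but the first path, which still has to
  -- reach `top`, cannot be ahead of it.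
  ... | no F≮ with top-level z<N (≤-trans (<⇒≤ F-top<F-root) (≮⇒≥ F≮))
  ... | inj₁ refl = contradiction F-top<F-root F≮
  ... | inj₂ refl with side refl
  ... | refl = contradiction (proj₂ (path₁-grows p)) u≰v
  solved-step {r} {V} {V′} terminal ρ H {u} {v} {y} {z} {xs} {_} {zs} u<N v<N y<N z<N p nil q F< side le
    | no u≰v | yes F<root with lastDescent q F<root
  ... | record { zs′ = zs′ ; ws′ = ws′ ; before = before ; arc = e , e<M , o , refl , refl ; descends = F> ; after = after ; split = refl } =
    let (ne , b) = chain-bound (H u<N (to<N e<M) z<N (from<N e<M) p after before
                       (≤-<-trans (≤-reflexive (proj₂ (level-path after))) F>) (root-to-top e<M o) size)
                     (Round.via-down ρ e<M u<N y<N z<N o F> (proj₂ (level-path after)) F< (≰⇒> u≰v))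
    in ne , ≤-trans b (count-mono xs swap)
    where
    swap : ∀ {x} → x ∈ xs → x ∈ ws′ ++ zs′ → x ∈ y ∷ zs′ ++ ws′
    swap _ x∈ with ∈-++⁻ ws′ x∈
    ... | inj₁ x∈ws = there (∈-++⁺ʳ zs′ x∈ws)
    ... | inj₂ x∈zs = there (∈-++⁺ˡ x∈zs)
    size : length xs + length ws′ + length zs′ ≤ 2 + r
    size = ≤-pred (begin
      suc (length xs + length ws′ + length zs′)    ≡⟨ cong suc (+-assoc (length xs) (length ws′) (length zs′)) ⟩
      suc (length xs + (length ws′ + length zs′))  ≡⟨ cong (λ k → suc (length xs + k)) (+-comm (length ws′) (length zs′)) ⟩
      suc (length xs + (length zs′ + length ws′))  ≡⟨ cong (λ k → suc (length xs + k)) (sym (length-++ zs′)) ⟩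
      suc (length xs + length (zs′ ++ ws′))        ≡⟨ cong (_+ length (zs′ ++ ws′)) (sym (+-comm (length xs) 1)) ⟩
      length xs + 1 + length (zs′ ++ ws′)          ≤⟨ le ⟩
      3 + r                                        ∎)
      where open ≤-Reasoning

-- Relaxation over the states

-- Variables: 0 off, 1 n, 2 m, 3 s₁, 4 t₁, 5 s₂, 6 t₂, 7 n + 3, 8 whether paths
-- are reported (0 or 1), 9 the value of both potentials at their targets.
-- Arrays: 1 and 2 the potentials, 3 F, 4 K, 5 from, 6 to, 7 o₁, 8 o₂, 9 the table
-- (0 means unset), 10 and 11 for every state a block with the successors of the
-- vertices on the first and on the second path, 12 scalars.
core : ℕ → Cmd
core j =
  cond (var 20 ⊗ arr 9 (var 22) ⊗ ((arr 9 (var 21) ≐ lit 0) ⊕ (var 23 ⊕ arr 9 (var 22) ≺ arr 9 (var 21))))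
    (put 9 (var 21) (var 23 ⊕ arr 9 (var 22)) ⨟
     -- The limit is 0 unless paths are reported; this alone separates the two running times.
     iter (var 8 ⊗ var 7)
       (put 10 (var 7 ⊗ var 21 ⊕ var 26) (arr 10 (var 7 ⊗ var 22 ⊕ var 26)) ⨟
        put 11 (var 7 ⊗ var 21 ⊕ var 26) (arr 11 (var 7 ⊗ var 22 ⊕ var 26))) ⨟
     put j (var 7 ⊗ var 21 ⊕ var 24) (var 25))
    nop

-- Binding all arguments to the variables 20 to 25 lets one verified `core` serve the three moves.
-- The comparison with 0 turns the guard into 0 or 1.
relax : Exp → Exp → Exp → Exp → ℕ → Exp → Exp → Cmd
relax g s s′ c j p q = bind (lit 0 ≺ g) (bind s (bind s′ (bind c (bind p (bind q (core j))))))

indexE : Exp → Exp → Exp → Exp → Exp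
indexE u v y z = var 7 ⊗ (var 7 ⊗ (var 7 ⊗ u ⊕ v) ⊕ y) ⊕ z

index : ℕ → ℕ → ℕ → ℕ → ℕ → ℕ
index N u v y z = N * (N * (N * u + v) + y) + z

index-injective : ∀ {N u v y z u′ v′ y′ z′} → v < N → y < N → z < N → v′ < N → y′ < N → z′ < N →
                  index N u v y z ≡ index N u′ v′ y′ z′ → u ≡ u′ × v ≡ v′ × y ≡ y′ × z ≡ z′
index-injective v< y< z< v′< y′< z′< i≡ with scaled-injective z< z′< i≡
... | refl , i≡ with scaled-injective y< y′< i≡
... | refl , i≡ with scaled-injective v< v′< i≡
... | refl , refl = refl , refl , refl , refl

scaled-bound : ∀ {N m i j} → i < m → j < N → N * i + j < N * m
scaled-bound {N} {m} {i} {j} i< j< = begin-strict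
  N * i + j   <⟨ +-monoʳ-< (N * i) j< ⟩
  N * i + N   ≡⟨ +-comm (N * i) N ⟩
  N + N * i   ≡⟨ sym (*-suc N i) ⟩
  N * suc i   ≤⟨ *-monoʳ-≤ N i< ⟩
  N * m       ∎
  where open ≤-Reasoning

index-bound : ∀ {N u v y z} → u < N → v < N → y < N → z < N → index N u v y z < N * (N * (N * N))
index-bound u< v< y< z< = scaled-bound (scaled-bound (scaled-bound u< v<) y<) z<

Upd-other-array : ∀ A {j i k} v → k ≢ j → upd A j i v k ≡ A k
Upd-other-array A {j} {i} {k} v k≢j with k ≡ᵇ j | ≡ᵇ⇒≡ k j
... | false | _ = refl
... | true  | f = contradiction (f _) k≢j

module Copying (N s s′ : ℕ) where

  record Copied (i : ℕ) (X X′ : ℕ → ℕ) : Set where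
    field
      others : ∀ r i′ → r ≢ s → i′ < N → X′ (N * r + i′) ≡ X (N * r + i′)
      source : ∀ i′ → i′ < N → X′ (N * s′ + i′) ≡ X (N * s′ + i′)
      copied : ∀ i′ → i′ < i → X′ (N * s + i′) ≡ X (N * s′ + i′)

  open Copied

  copied-zero : ∀ {X} → Copied 0 X X
  copied-zero = record { others = λ _ _ _ _ → refl ; source = λ _ _ → refl ; copied = λ _ () }

  copied-suc : ∀ {i X X′} → i < N → Copied i X X′ → Copied (suc i) X (X′ [ N * s + i ↦ X′ (N * s′ + i) ])
  copied-suc {i} {X} {X′} i<N C = record { others = oth ; source = src ; copied = cop }
    where
    oth : ∀ r i′ → r ≢ s → i′ < N → _
    oth r i′ r≢s i′<N =
      trans (upd-other X′ _ (λ e → r≢s (proj₂ (scaled-injective {N} {r} {i′} {s} {i} i′<N i<N e)))) (others C r i′ r≢s i′<N)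
    src : ∀ i′ → i′ < N → _
    src i′ i′<N with N * s′ + i′ ≟ N * s + i
    ... | no  ne = trans (upd-other X′ _ ne) (source C i′ i′<N)
    -- The written cell belongs to the source block only if both blocks coincide; it then receives
    -- its own content.
    ... | yes e with scaled-injective {N} {s′} {i′} {s} {i} i′<N i<N e
    ... | refl , refl = trans (upd-same X′ (N * s + i) _) (source C i i<N)
    cop : ∀ i′ → i′ < suc i → _
    cop i′ (s≤s i′≤i) with m≤n⇒m<n∨m≡n i′≤i
    ... | inj₂ refl = trans (upd-same X′ (N * s + i) _) (source C i i<N)
    ... | inj₁ i′<i = trans (upd-other X′ _ (λ e → <⇒≢ i′<i (+-cancelˡ-≡ (N * s) _ _ e))) (copied C i′ i′<i)

setIf : Bool → ℕ → ℕ → (ℕ → ℕ) → (ℕ → ℕ)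
setIf true  p q f = f [ p ↦ q ]
setIf false p q f = f

module DP (𝓛 : Layout) where

  open Layout 𝓛

  open Machine 𝓛

  module Core (ρ : ℕ → ℕ) (1≤N : 1 ≤ ρ 7) (N<B : ρ 7 < B) (b≤1 : ρ 8 ≤ 1) (γ s s′ c p q : ℕ)
              (p<N : p < ρ 7) (q<B : q < B) where

    N b P : ℕ
    N = ρ 7
    b = ρ 8
    P = suc (b * N)

    ρ′ : ℕ → ℕ
    ρ′ = ρ [ 20 ↦ γ ] [ 21 ↦ s ] [ 22 ↦ s′ ] [ 23 ↦ c ] [ 24 ↦ p ] [ 25 ↦ q ]

    record Updated (j : ℕ) (A A′ : Mem) : Set where
      field
        static : ∀ k → k < 9 → A′ k ≡ A k
        value  : A′ 9 ≡ A 9 [ s ↦ c + A 9 s′ ]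
        block  : ∀ k → k ≡ 10 ⊎ k ≡ 11 → b ≡ 1 → ∀ i → i < N →
                 A′ k (N * s + i) ≡ setIf (k ≡ᵇ j) p q (λ i → A k (N * s′ + i)) i
        others : ∀ k → k ≡ 10 ⊎ k ≡ 11 → ∀ r i → r ≢ s → i < N → A′ k (N * r + i) ≡ A k (N * r + i)

    open Copying N s s′
    open Copied

    bN≤N : b * N ≤ N
    bN≤N = ≤-trans (*-monoˡ-≤ N b≤1) (≤-reflexive (*-identityˡ N))

    CopyInv : Mem → ℕ → Mem → Set
    CopyInv A i A′ = (∀ k → k < 10 → A′ k ≡ A k) × Copied i (A 10) (A′ 10) × Copied i (A 11) (A′ 11)

    copy-inv-suc : ∀ {A i A′} → i < N → CopyInv A i A′ →
      let A″ = upd A′ 10 (N * s + i) (A′ 10 (N * s′ + i))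
      in CopyInv A (suc i) (upd A″ 11 (N * s + i) (A″ 11 (N * s′ + i)))
    copy-inv-suc {A} {i} {A′} i<N (st , c₁ , c₂) =
      (λ k k<10 → trans (Upd-other-array A″ {11} {N * s + i} _ (<⇒≢ (<-trans k<10 (s≤s (≤-reflexive refl)))))
        (trans (Upd-other-array A′ {10} {N * s + i} _ (<⇒≢ k<10)) (st k k<10))) ,
      copied-suc i<N c₁ , copied-suc i<N c₂
      where A″ = upd A′ 10 (N * s + i) (A′ 10 (N * s′ + i))

    updated : ∀ {j A A′} → j ≡ 10 ⊎ j ≡ 11 → CopyInv (upd A 9 s (c + A 9 s′)) (b * N) A′ →
              Updated j A (upd A′ j (N * s + p) q)
    updated {j} {A} {A′} j≡ (st , c₁ , c₂) = record
      { static = λ k k<9 → trans (Upd-other-array A′ {j} {N * s + p} {k} q (<⇒≢ (<-trans k<9 (10≤ j≡))))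
          (trans (st k (<-trans k<9 ≤-refl)) (Upd-other-array A {9} {s} {k} _ (<⇒≢ k<9)))
      ; value = trans (Upd-other-array A′ {j} {N * s + p} {9} q (<⇒≢ (10≤ j≡))) (st 9 ≤-refl)
      ; block = bl
      ; others = ot }
      where
      10≤ : ∀ {j} → j ≡ 10 ⊎ j ≡ 11 → 10 ≤ j
      10≤ (inj₁ refl) = ≤-refl
      10≤ (inj₂ refl) = n≤1+n 10
      cop : ∀ k → k ≡ 10 ⊎ k ≡ 11 → Copied (b * N) (A k) (A′ k)
      cop k (inj₁ refl) = c₁
      cop k (inj₂ refl) = c₂
      ot : ∀ k → k ≡ 10 ⊎ k ≡ 11 → ∀ r i → r ≢ s → i < N → _
      ot k k≡ r i r≢s i<N = trans (Upd-other A′ {j} {N * s + p} {k} {N * r + i} q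
          (λ { (_ , e) → r≢s (proj₂ (scaled-injective {N} {r} {i} {s} {p} i<N p<N e)) }))
        (others (cop k k≡) r i r≢s i<N)
      bl : ∀ k → k ≡ 10 ⊎ k ≡ 11 → b ≡ 1 → ∀ i → i < N →
           upd A′ j (N * s + p) q k (N * s + i) ≡ setIf (k ≡ᵇ j) p q (λ i → A k (N * s′ + i)) i
      bl k k≡ b≡1 i i<N with k ≡ᵇ j | ≡ᵇ⇒≡ k j
      ... | false | _ = copied (cop k k≡) i (subst (i <_) (sym (trans (cong (_* N) b≡1) (*-identityˡ N))) i<N)
      ... | true  | f with f _
      ... | refl with i ≟ p
      ... | yes refl = trans (upd-same (A′ k) (N * s + p) q) (sym (upd-same (λ i → A k (N * s′ + i)) p q))
      ... | no  i≢p  = trans (upd-other (A′ k) {N * s + p} {N * s + i} q (λ e → i≢p (+-cancelˡ-≡ (N * s) _ _ e)))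
          (trans (copied (cop k k≡) i (subst (i <_) (sym (trans (cong (_* N) b≡1) (*-identityˡ N))) i<N))
            (sym (upd-other (λ i → A k (N * s′ + i)) {p} {i} q i≢p)))

    core-wp : ∀ {j Q A} → j ≡ 10 ⊎ j ≡ 11 →
      (γ ≢ 0 → A 9 s′ ≢ 0 → c + A 9 s′ < B) →
      (∀ A′ → Updated j A A′ → γ ≢ 0 → A 9 s′ ≢ 0 → A 9 s ≡ 0 ⊎ c + A 9 s′ < A 9 s → Q A′) →
      (γ ≡ 0 ⊎ A 9 s′ ≡ 0 ⊎ (A 9 s ≢ 0 × A 9 s ≤ c + A 9 s′) → Q A) →
      wp 26 ρ′ (core j) (P * 1) Q A
    core-wp {j} {Q} {A} j≡ bnd updating keeping =
      wp-cond (s≤s z≤n) _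
        (λ test≢0 → wp-seq _ _ (wp-put (s≤s z≤n) _ _ (bnd (γ≢0 test≢0) (V≢0 test≢0))
          (wp-seq _ _ (wp-iter (CopyInv (upd A 9 s (c + A 9 s′))) (b * N) P (n≤1+n _) (s≤s z≤n) ≤-refl _ refl
              (≤-<-trans bN≤N N<B) ((λ _ _ → refl) , copied-zero , copied-zero)
              (λ i i<bN A′ inv → wp-bounded _ λ bd → wp-seq _ _ (wp-put ≤-refl _ _ (bd 10 _)
                (wp-put ≤-refl _ _ (bd 11 _) (copy-inv-suc (<-≤-trans i<bN bN≤N) inv))))
              λ A′ inv → wp-put {j = j} {ok = okj j≡} (s≤s z≤n) _ _ q<B
                (updating _ (updated j≡ inv) (γ≢0 test≢0) (V≢0 test≢0) (better test≢0))))))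
        (λ test≡0 → wp-nop (s≤s z≤n) (keeping (worse test≡0)))
      where
      test : ℕ
      test = γ * A 9 s′ * (bool (A 9 s ≡ᵇ 0) + bool (c + A 9 s′ <ᵇ A 9 s))
      okj : j ≡ 10 ⊎ j ≡ 11 → okE 26 (arr j (var 7 ⊗ var 21 ⊕ var 24))
      okj (inj₁ refl) = _
      okj (inj₂ refl) = _
      γ≢0 : test ≢ 0 → γ ≢ 0
      γ≢0 t refl = t refl
      V≢0 : test ≢ 0 → A 9 s′ ≢ 0
      V≢0 t z = t (cong (_* (bool (A 9 s ≡ᵇ 0) + bool (c + A 9 s′ <ᵇ A 9 s))) (trans (cong (γ *_) z) (*-zeroʳ γ)))
      better : test ≢ 0 → A 9 s ≡ 0 ⊎ c + A 9 s′ < A 9 s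
      better t with A 9 s ≡ᵇ 0 | ≡ᵇ⇒≡ (A 9 s) 0 | c + A 9 s′ <ᵇ A 9 s | <ᵇ⇒< (c + A 9 s′) (A 9 s)
      ... | true  | f | _     | _ = inj₁ (f _)
      ... | false | _ | true  | f = inj₂ (f _)
      ... | false | _ | false | _ = contradiction (*-zeroʳ (γ * A 9 s′)) t
      worse : test ≡ 0 → γ ≡ 0 ⊎ A 9 s′ ≡ 0 ⊎ (A 9 s ≢ 0 × A 9 s ≤ c + A 9 s′)
      worse t with m*n≡0⇒m≡0∨n≡0 (γ * A 9 s′) t
      ... | inj₁ z with m*n≡0⇒m≡0∨n≡0 γ z
      ... | inj₁ z′ = inj₁ z′
      ... | inj₂ z′ = inj₂ (inj₁ z′)
      worse t | inj₂ z = inj₂ (inj₂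
        ((λ e → 1≢0 (trans (sym (cong bool (T-true (≡⇒≡ᵇ (A 9 s) 0 e)))) (m+n≡0⇒m≡0 _ z))) ,
         ≮⇒≥ (λ l → 1≢0 (trans (sym (cong bool (T-true (<⇒<ᵇ l)))) (m+n≡0⇒n≡0 (bool (A 9 s ≡ᵇ 0)) z)))))
        where
        1≢0 : 1 ≢ 0
        1≢0 ()
        T-true : ∀ {x} → T x → x ≡ true
        T-true {true} _ = refl

  relax-wp : ∀ {ρ j X Q A} γ σ σ′ c p q {g s s′ cE pE qE}
    {_ : okE 20 (lit 0 ≺ g)} {_ : okE 21 s} {_ : okE 22 s′} {_ : okE 23 cE} {_ : okE 24 pE} {_ : okE 25 qE} →
    1 ≤ X →
    Safe (lit 0 ≺ g) ρ A →
    Safe s  (ρ [ 20 ↦ γ ]) A →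
    Safe s′ (ρ [ 20 ↦ γ ] [ 21 ↦ σ ]) A →
    Safe cE (ρ [ 20 ↦ γ ] [ 21 ↦ σ ] [ 22 ↦ σ′ ]) A →
    Safe pE (ρ [ 20 ↦ γ ] [ 21 ↦ σ ] [ 22 ↦ σ′ ] [ 23 ↦ c ]) A →
    Safe qE (ρ [ 20 ↦ γ ] [ 21 ↦ σ ] [ 22 ↦ σ′ ] [ 23 ↦ c ] [ 24 ↦ p ]) A →
    eval (lit 0 ≺ g) ρ A ≡ γ →
    eval s  (ρ [ 20 ↦ γ ]) A ≡ σ →
    eval s′ (ρ [ 20 ↦ γ ] [ 21 ↦ σ ]) A ≡ σ′ →
    eval cE (ρ [ 20 ↦ γ ] [ 21 ↦ σ ] [ 22 ↦ σ′ ]) A ≡ c →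
    eval pE (ρ [ 20 ↦ γ ] [ 21 ↦ σ ] [ 22 ↦ σ′ ] [ 23 ↦ c ]) A ≡ p →
    eval qE (ρ [ 20 ↦ γ ] [ 21 ↦ σ ] [ 22 ↦ σ′ ] [ 23 ↦ c ] [ 24 ↦ p ]) A ≡ q →
    γ < B → σ < B → σ′ < B → c < B → p < B → q < B →
    wp 26 (ρ [ 20 ↦ γ ] [ 21 ↦ σ ] [ 22 ↦ σ′ ] [ 23 ↦ c ] [ 24 ↦ p ] [ 25 ↦ q ]) (core j) X Q A →
    wp 20 ρ (relax g s s′ cE j pE qE) X Q A
  relax-wp γ σ σ′ c p q {_} {_} {_} {_} {_} {_} {k₁} {k₂} {k₃} {k₄} {k₅} {k₆} 1≤X a₁ a₂ a₃ a₄ a₅ a₆ e₁ e₂ e₃ e₄ e₅ e₆ b₁ b₂ b₃ b₄ b₅ b₆ h =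
    wp-bind {ok = k₁} γ 1≤X a₁ e₁ b₁ (wp-bind {ok = k₂} σ 1≤X a₂ e₂ b₂ (wp-bind {ok = k₃} σ′ 1≤X a₃ e₃ b₃
      (wp-bind {ok = k₄} c 1≤X a₄ e₄ b₄ (wp-bind {ok = k₅} p 1≤X a₅ e₅ b₅ (wp-bind {ok = k₆} q 1≤X a₆ e₆ b₆ h)))))

  -- For loops that only improve the memory: what a pass establishes survives all later passes, so
  -- in the end it holds for every counter value.
  iter-all : ∀ {Γ ρ e c X A} {_ : okE Γ e} (Good : Mem → Set) (Le : Mem → Mem → Set) (Q : ℕ → Mem → Set)
    (limit : ℕ) → 1 ≤ limit → 1 ≤ X → Safe e ρ A → eval e ρ A ≡ limit → limit < B →
    (∀ {A} → Le A A) → (∀ {A A′ A″} → Le A A′ → Le A′ A″ → Le A A″) →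
    (∀ {i A A′} → Le A A′ → Q i A → Q i A′) →
    Good A →
    (∀ i → i < limit → ∀ A′ → Good A′ → Le A A′ →
      wp (2 + Γ) (ρ [ Γ ↦ i ] [ suc Γ ↦ limit ]) c X (λ A″ → Good A″ × Le A′ A″ × Q i A″) A′) →
    wp Γ ρ (iter e c) (limit * X) (λ A′ → Good A′ × Le A A′ × (∀ i → i < limit → Q i A′)) A
  iter-all {c = c} {A = A} {ok} Good Le Q limit 1≤limit 1≤X safe e≡ limit<B le-refl le-trans stable good body =
    wp-iter {ok = ok} (λ i A′ → Good A′ × Le A A′ × (∀ i′ → i′ < i → Q i′ A′)) limit limit ≤-refl 1≤limit 1≤X safe e≡ limit<B
      (good , le-refl , λ _ ())
      (λ i i<limit A′ (good′ , le′ , qs) → wp-mono c ≤-refl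
        (λ A″ (good″ , le″ , q) → good″ , le-trans le′ le″ , extend-all i q (λ i′ i′<i → stable le″ (qs i′ i′<i)))
        (body i i<limit A′ good′ le′))
      (λ A′ inv → inv)
    where
    extend-all : ∀ i {A} → Q i A → (∀ i′ → i′ < i → Q i′ A) → ∀ i′ → i′ < suc i → Q i′ A
    extend-all i q qs i′ (s≤s i′≤i) with m≤n⇒m<n∨m≡n i′≤i
    ... | inj₁ i′<i = qs i′ i′<i
    ... | inj₂ refl = q

-- The three moves and the rounds of the dynamic program

eᵈ aᵈ yᵈ zᵈ : Exp
eᵈ = var 12
aᵈ = var 14
yᵈ = var 16
zᵈ = var 18

-- Products of truth values are conjunctions, and `lit 1 ⊖` negates. `aᵈ` is the vertex of the path
-- that stands still: v in the first guard, u in the others. So an arc and three vertices determine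
-- every move, although a state has four.
guard₁ guard₂ guard₃ : Exp
guard₁ = arr 7 eᵈ ⊗ (lit 1 ⊖ (arr 4 aᵈ ≺ arr 4 (arr 5 eᵈ)))
guard₂ = arr 8 eᵈ ⊗ (arr 3 (arr 6 eᵈ) ≐ arr 3 (arr 5 eᵈ)) ⊗ (arr 4 (arr 5 eᵈ) ≺ arr 4 aᵈ)
guard₃ = arr 8 eᵈ ⊗ (arr 3 (arr 6 eᵈ) ≺ arr 3 (arr 5 eᵈ)) ⊗ (arr 3 zᵈ ≐ arr 3 (arr 6 eᵈ)) ⊗
         (arr 3 yᵈ ≺ arr 3 zᵈ) ⊗ (arr 4 yᵈ ≺ arr 4 aᵈ)

dpBody dp : Cmd
dpBody =
  relax guard₁ (indexE (arr 5 eᵈ) aᵈ yᵈ zᵈ) (indexE (arr 6 eᵈ) aᵈ yᵈ zᵈ) (arr 5 eᵈ ≐ aᵈ) 10 (arr 5 eᵈ) (arr 6 eᵈ) ⨟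
  relax guard₂ (indexE aᵈ (arr 5 eᵈ) yᵈ zᵈ) (indexE aᵈ (arr 6 eᵈ) yᵈ zᵈ) (lit 0) 11 (arr 5 eᵈ) (arr 6 eᵈ) ⨟
  relax guard₃ (indexE aᵈ yᵈ yᵈ zᵈ) (indexE aᵈ (arr 6 eᵈ) zᵈ (arr 5 eᵈ)) (lit 0) 11 (arr 5 eᵈ) (arr 6 eᵈ)

dp =
  -- The terminal state has value 1 because `top` lies on both extended paths.
  put 9 (indexE (var 1) (var 1) (var 1) (var 1 ⊕ lit 1)) (lit 1) ⨟
  iter (lit 2 ⊗ var 2 ⊕ lit 4) (iter (var 2 ⊕ lit 3) (iter (var 7) (iter (var 7) (iter (var 7) dpBody))))

bool-≢0 : ∀ {b} → T b → bool b ≢ 0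
bool-≢0 {true} _ ()

bool-true : ∀ {b} → bool b ≢ 0 → T b
bool-true {true}  _ = _
bool-true {false} p = p refl

*-≢0 : ∀ {m n} → m ≢ 0 → n ≢ 0 → m * n ≢ 0
*-≢0 {m} p q e with m*n≡0⇒m≡0∨n≡0 m e
... | inj₁ x = p x
... | inj₂ x = q x

*-≢0ˡ : ∀ {m} n → m * n ≢ 0 → m ≢ 0
*-≢0ˡ n p refl = p refl

*-≢0ʳ : ∀ m {n} → m * n ≢ 0 → n ≢ 0
*-≢0ʳ m p refl = p (*-zeroʳ m)

pos-≢0 : ∀ {m} → bool (0 <ᵇ m) ≢ 0 → m ≢ 0
pos-≢0 p refl = p refl

≢0-pos : ∀ {m} → m ≢ 0 → bool (0 <ᵇ m) ≢ 0
≢0-pos {m} p = bool-≢0 (<⇒<ᵇ (n≢0⇒n>0 p))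

not-< : ∀ {m n} → n ≤ m → 1 ∸ bool (m <ᵇ n) ≢ 0
not-< {m} {n} n≤m with m <ᵇ n | <ᵇ⇒< m n
... | false | _ = λ ()
... | true  | f = contradiction (f _) (≤⇒≯ n≤m)

≤-not-< : ∀ {m n} → 1 ∸ bool (m <ᵇ n) ≢ 0 → n ≤ m
≤-not-< {m} {n} p with m <ᵇ n | <⇒<ᵇ {m} {n}
... | true  | _ = contradiction refl p
... | false | f = ≮⇒≥ f

module DPCorrect (𝓛 : Layout)
  (𝒩 : Network) (ρ₀ : ℕ → ℕ) (m s₁ t₁ s₂ t₂ b big : ℕ) (b≤1 : b ≤ 1)
  (M≡ : m + 3 ≡ Network.M 𝒩) (root≡ : Network.top 𝒩 + 1 ≡ Network.root 𝒩)
  (N⁴<B : Network.N 𝒩 * (Network.N 𝒩 * (Network.N 𝒩 * Network.N 𝒩)) < Layout.B 𝓛)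
  (K<B : 1 + Network.K 𝒩 (Network.top 𝒩) < Layout.B 𝓛) (rounds<B : 2 * m + 4 < Layout.B 𝓛) where

  open Layout 𝓛

  open Machine 𝓛
  open DP 𝓛
  open Network 𝒩
  open NetworkTheory 𝒩

  1≤N : 1 ≤ N
  1≤N = ≤-trans (s≤s z≤n) top<N

  N<B : N < B
  N<B = ≤-<-trans (≤-trans (m≤m*n N N ⦃ >-nonZero 1≤N ⦄)
    (≤-trans (m≤n*m (N * N) N ⦃ >-nonZero 1≤N ⦄) (m≤n*m (N * (N * N)) N ⦃ >-nonZero 1≤N ⦄))) N⁴<B

  ρ : ℕ → ℕ
  ρ = ρ₀ [ 1 ↦ top ] [ 2 ↦ m ] [ 3 ↦ s₁ ] [ 4 ↦ t₁ ] [ 5 ↦ s₂ ] [ 6 ↦ t₂ ] [ 7 ↦ N ] [ 8 ↦ b ] [ 9 ↦ big ]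

  P X : ℕ
  P = suc (b * N)
  X = P * 1

  1≤X : 1 ≤ X
  1≤X = s≤s z≤n

  Static : Mem → Set
  Static A = A 3 ≡ F × A 4 ≡ K × A 5 ≡ from × A 6 ≡ to × A 7 ≡ o₁ × A 8 ≡ o₂

  V : Mem → Table
  V A u v y z = A 9 (index N u v y z)

  next : ℕ → Mem → ℕ → (ℕ → ℕ)
  next k A s i = A k (N * s + i)

  Sound : Mem → Set
  Sound A = ∀ u v y z → u < N → v < N → y < N → z < N → V A u v y z ≢ 0 →
    Realised b (V A u v y z) (next 10 A (index N u v y z)) (next 11 A (index N u v y z)) u v y z

  Good : Mem → Set
  Good A = Static A × Sound A

  Le : Mem → Mem → Set
  Le A A′ = ∀ i → Bounds 0 (A 9 i) (A′ 9 i)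

  le-refl : ∀ {A} → Le A A
  le-refl i ne = ne , ≤-refl

  bounds-trans : ∀ {c x y z} → Bounds c x y → Bounds 0 y z → Bounds c x z
  bounds-trans f g ne with f ne
  ... | ne′ , le with g ne′
  ... | ne″ , le′ = ne″ , ≤-trans le′ le

  bounds-trans′ : ∀ {c x y z} → Bounds 0 x y → Bounds c y z → Bounds c x z
  bounds-trans′ {c} f g ne with f ne
  ... | ne′ , le with g ne′
  ... | ne″ , le′ = ne″ , ≤-trans le′ (+-monoʳ-≤ c le)

  le-trans : ∀ {A A′ A″} → Le A A′ → Le A′ A″ → Le A A″
  le-trans f g i = bounds-trans (f i) (g i)

  static-cong : ∀ {A} (Φ : (F K from to o₁ o₂ : ℕ → ℕ) → ℕ) → Static A →
                Φ (A 3) (A 4) (A 5) (A 6) (A 7) (A 8) ≡ Φ F K from to o₁ o₂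
  static-cong Φ (refl , refl , refl , refl , refl , refl) = refl

  loopEnv : (r e a y z : ℕ) → ℕ → ℕ
  loopEnv r e a y z = ρ [ 10 ↦ r ] [ 11 ↦ 2 * m + 4 ] [ 12 ↦ e ] [ 13 ↦ m + 3 ] [ 14 ↦ a ] [ 15 ↦ N ]
                        [ 16 ↦ y ] [ 17 ↦ N ] [ 18 ↦ z ] [ 19 ↦ N ]

  -- Soundness under updates in place: value and successor block of the target change together, from
  -- a source that is realised at this moment, and blocks of other states are untouched. The move
  -- `mv` supplies the new realisation.
  core-correct : ∀ {j u v y z u′ v′ y′ z′ γ c p q A} →
    u < N → v < N → y < N → z < N → u′ < N → v′ < N → y′ < N → z′ < N → p < N → q < N → γ < B →
    j ≡ 10 ⊎ j ≡ 11 → Good A →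
    (∀ {val f₁ f₂} → γ ≢ 0 → Realised b val f₁ f₂ u′ v′ y′ z′ →
       Realised b (c + val) (setIf (10 ≡ᵇ j) p q f₁) (setIf (11 ≡ᵇ j) p q f₂) u v y z) →
    ∀ r₀ e₀ a₀ y₀ z₀ →
    wp 26 (loopEnv r₀ e₀ a₀ y₀ z₀ [ 20 ↦ γ ] [ 21 ↦ index N u v y z ] [ 22 ↦ index N u′ v′ y′ z′ ] [ 23 ↦ c ] [ 24 ↦ p ] [ 25 ↦ q ]) (core j) X
      (λ A′ → Good A′ × Le A A′ × (γ ≢ 0 → Bounds c (V A u′ v′ y′ z′) (V A′ u v y z))) A
  core-correct {j} {u} {v} {y} {z} {u′} {v′} {y′} {z′} {γ} {c} {p} {q} {A} u< v< y< z< u′< v′< y′< z′< p< q< γ<B j≡ (static , sound) mv r₀ e₀ a₀ y₀ z₀ =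
    core-wp j≡ bnd updating keeping
    where
    open Core (loopEnv r₀ e₀ a₀ y₀ z₀) 1≤N N<B b≤1 γ (index N u v y z) (index N u′ v′ y′ z′) c p q p< (<-trans q< N<B) hiding (N; b; P)
    s s′ : ℕ
    s = index N u v y z
    s′ = index N u′ v′ y′ z′
    source : γ ≢ 0 → A 9 s′ ≢ 0 → Realised b (c + A 9 s′) _ _ u v y z
    source γ≢0 V≢0 = mv γ≢0 (sound u′ v′ y′ z′ u′< v′< y′< z′< V≢0)
    bnd : γ ≢ 0 → A 9 s′ ≢ 0 → c + A 9 s′ < B
    -- The new value fits into a cell because it belongs to realised paths, whose `small` bounds it.
    bnd γ≢0 V≢0 = ≤-<-trans (≤-trans (m≤m+n (c + A 9 s′) (K u)) (Realised.small (source γ≢0 V≢0))) K<B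
    keeping : γ ≡ 0 ⊎ A 9 s′ ≡ 0 ⊎ (A 9 s ≢ 0 × A 9 s ≤ c + A 9 s′) → _
    keeping k = (static , sound) , le-refl {A} , keep k
      where
      keep : γ ≡ 0 ⊎ A 9 s′ ≡ 0 ⊎ (A 9 s ≢ 0 × A 9 s ≤ c + A 9 s′) → γ ≢ 0 → Bounds c (A 9 s′) (A 9 s)
      keep (inj₁ e)        γ≢0 V≢0 = contradiction e γ≢0
      keep (inj₂ (inj₁ e)) γ≢0 V≢0 = contradiction e V≢0
      keep (inj₂ (inj₂ x)) γ≢0 V≢0 = x
    updating : ∀ A′ → Updated j A A′ → γ ≢ 0 → A 9 s′ ≢ 0 → A 9 s ≡ 0 ⊎ c + A 9 s′ < A 9 s →
               Good A′ × Le A A′ × (γ ≢ 0 → Bounds c (A 9 s′) (A′ 9 s))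
    updating A′ U γ≢0 V≢0 better = (static′ , sound′) , le , λ _ _ → new≢0 , ≤-reflexive newV
      where
      open Updated U renaming (static to same)
      static′ : Static A′
      static′ = let (e₃ , e₄ , e₅ , e₆ , e₇ , e₈) = static in
        trans (same 3 (m≤m+n 4 5)) e₃ , trans (same 4 (m≤m+n 5 4)) e₄ , trans (same 5 (m≤m+n 6 3)) e₅ ,
        trans (same 6 (m≤m+n 7 2)) e₆ , trans (same 7 (m≤m+n 8 1)) e₇ , trans (same 8 (m≤m+n 9 0)) e₈
      newV : A′ 9 s ≡ c + A 9 s′
      newV = trans (cong (λ f → f s) value) (upd-same (A 9) s _)
      oldV : ∀ {i} → i ≢ s → A′ 9 i ≡ A 9 i
      oldV {i} i≢s = trans (cong (λ f → f i) value) (upd-other (A 9) _ i≢s)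
      new≢0 : A′ 9 s ≢ 0
      new≢0 e = V≢0 (m+n≡0⇒n≡0 c (trans (sym newV) e))
      le : Le A A′
      le i ne with i ≟ s
      ... | no  i≢s  = subst (λ x → x ≢ 0 × x ≤ A 9 i) (sym (oldV i≢s)) (ne , ≤-refl)
      ... | yes refl = new≢0 , lower better
        where
        lower : A 9 s ≡ 0 ⊎ c + A 9 s′ < A 9 s → A′ 9 s ≤ A 9 s
        lower (inj₁ e) = contradiction e ne
        lower (inj₂ l) = ≤-trans (≤-reflexive newV) (<⇒≤ l)
      sound′ : Sound A′
      sound′ u₁ v₁ y₁ z₁ u₁< v₁< y₁< z₁< ne with index N u₁ v₁ y₁ z₁ ≟ s
      ... | no i≢s = subst (λ x → Realised b x (next 10 A′ (index N u₁ v₁ y₁ z₁)) (next 11 A′ (index N u₁ v₁ y₁ z₁)) u₁ v₁ y₁ z₁) (sym (oldV i≢s))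
            (realised-cong u₁< v₁<
              (λ b≡1 i i<N → sym (others 10 (inj₁ refl) _ i i≢s i<N) , sym (others 11 (inj₂ refl) _ i i≢s i<N))
              (sound u₁ v₁ y₁ z₁ u₁< v₁< y₁< z₁< (subst (_≢ 0) (oldV i≢s) ne)))
      ... | yes i≡s with index-injective {N} {u₁} {v₁} {y₁} {z₁} v₁< y₁< z₁< v< y< z< i≡s
      ... | refl , refl , refl , refl = subst (λ x → Realised b x (next 10 A′ s) (next 11 A′ s) u v y z) (sym newV)
            (realised-cong u< v<
              (λ b≡1 i i<N → sym (block 10 (inj₁ refl) b≡1 i i<N) , sym (block 11 (inj₂ refl) b≡1 i i<N))
              (source γ≢0 V≢0))

  Closed₁ Closed₂ Closed₃ : (e a y z : ℕ) → Mem → Mem → Set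
  Closed₁ e a y z A A′ = o₁ e ≢ 0 → K (from e) ≤ K a →
    Bounds (bool (from e ≡ᵇ a)) (V A (to e) a y z) (V A′ (from e) a y z)
  Closed₂ e a y z A A′ = o₂ e ≢ 0 → F (to e) ≡ F (from e) → K (from e) < K a →
    Bounds 0 (V A a (to e) y z) (V A′ a (from e) y z)
  Closed₃ e a y z A A′ = o₂ e ≢ 0 → F (to e) < F (from e) → F z ≡ F (to e) → F y < F z → K y < K a →
    Bounds 0 (V A a (to e) z (from e)) (V A′ a y y z)

  Closed : (e a y z : ℕ) → Mem → Mem → Set
  Closed e a y z A A′ = Closed₁ e a y z A A′ × Closed₂ e a y z A A′ × Closed₃ e a y z A A′

  closed-stable : ∀ {e a y z A A′ A″} → Le A′ A″ → Closed e a y z A A′ → Closed e a y z A A″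
  closed-stable l (c₁ , c₂ , c₃) =
    (λ p q → bounds-trans (c₁ p q) (l _)) , (λ p q r → bounds-trans (c₂ p q r) (l _)) ,
    (λ p q r s t → bounds-trans (c₃ p q r s t) (l _))

  index<B : ∀ {u v y z} → u < N → v < N → y < N → z < N → index N u v y z < B
  index<B p q r s = <-trans (index-bound p q r s) N⁴<B

  <M : ∀ {e} → e < m + 3 → e < M
  <M = subst (_ <_) M≡

  module Body {r₀ e a y z : ℕ} (e< : e < m + 3) (a< : a < N) (y< : y < N) (z< : z < N) where

    f< : from e < N
    f< = from<N (<M e<)
    t< : to e < N
    t< = to<N (<M e<)

    γ₁ γ₂ γ₃ : ℕ
    γ₁ = bool (0 <ᵇ o₁ e * (1 ∸ bool (K a <ᵇ K (from e))))
    γ₂ = bool (0 <ᵇ o₂ e * bool (F (to e) ≡ᵇ F (from e)) * bool (K (from e) <ᵇ K a))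
    γ₃ = bool (0 <ᵇ o₂ e * bool (F (to e) <ᵇ F (from e)) * bool (F z ≡ᵇ F (to e)) * bool (F y <ᵇ F z) * bool (K y <ᵇ K a))

    step₁ : ∀ A → Good A → wp 20 (loopEnv r₀ e a y z)
      (relax guard₁ (indexE (arr 5 eᵈ) aᵈ yᵈ zᵈ) (indexE (arr 6 eᵈ) aᵈ yᵈ zᵈ) (arr 5 eᵈ ≐ aᵈ) 10 (arr 5 eᵈ) (arr 6 eᵈ)) X
      (λ A′ → Good A′ × Le A A′ × (γ₁ ≢ 0 → Bounds (bool (from e ≡ᵇ a)) (V A (to e) a y z) (V A′ (from e) a y z))) A
    step₁ A good@(st , _) =
      relax-wp γ₁ (index N (from e) a y z) (index N (to e) a y z) (bool (from e ≡ᵇ a)) (from e) (to e)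
        1≤X _ _ _ _ _ _
        (static-cong {A} (λ F K from to o₁ o₂ → bool (0 <ᵇ o₁ e * (1 ∸ bool (K a <ᵇ K (from e))))) st)
        (static-cong {A} (λ F K from to o₁ o₂ → index N (from e) a y z) st)
        (static-cong {A} (λ F K from to o₁ o₂ → index N (to e) a y z) st)
        (static-cong {A} (λ F K from to o₁ o₂ → bool (from e ≡ᵇ a)) st)
        (static-cong {A} (λ F K from to o₁ o₂ → from e) st)
        (static-cong {A} (λ F K from to o₁ o₂ → to e) st)
        (bool<B _) (index<B f< a< y< z<) (index<B t< a< y< z<) (bool<B (from e ≡ᵇ a)) (<-trans f< N<B) (<-trans t< N<B)
        (core-correct f< a< y< z< t< a< y< z< f< t< (bool<B _) (inj₁ refl) good
          (λ γ≢0 → let g = pos-≢0 {o₁ e * (1 ∸ bool (K a <ᵇ K (from e)))} γ≢0 in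
             move-first (<M e<) (*-≢0ˡ _ g) a< (≤-not-< (*-≢0ʳ (o₁ e) g))) r₀ e a y z)

    step₂ : ∀ A → Good A → wp 20 (loopEnv r₀ e a y z)
      (relax guard₂ (indexE aᵈ (arr 5 eᵈ) yᵈ zᵈ) (indexE aᵈ (arr 6 eᵈ) yᵈ zᵈ) (lit 0) 11 (arr 5 eᵈ) (arr 6 eᵈ)) X
      (λ A′ → Good A′ × Le A A′ × (γ₂ ≢ 0 → Bounds 0 (V A a (to e) y z) (V A′ a (from e) y z))) A
    step₂ A good@(st , _) =
      relax-wp γ₂ (index N a (from e) y z) (index N a (to e) y z) 0 (from e) (to e)
        1≤X _ _ _ _ _ _
        (static-cong {A} (λ F K from to o₁ o₂ → bool (0 <ᵇ o₂ e * bool (F (to e) ≡ᵇ F (from e)) * bool (K (from e) <ᵇ K a))) st)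
        (static-cong {A} (λ F K from to o₁ o₂ → index N a (from e) y z) st)
        (static-cong {A} (λ F K from to o₁ o₂ → index N a (to e) y z) st)
        refl
        (static-cong {A} (λ F K from to o₁ o₂ → from e) st)
        (static-cong {A} (λ F K from to o₁ o₂ → to e) st)
        (bool<B _) (index<B a< f< y< z<) (index<B a< t< y< z<) (bool<B false) (<-trans f< N<B) (<-trans t< N<B)
        (core-correct a< f< y< z< a< t< y< z< f< t< (bool<B _) (inj₂ refl) good
          (λ γ≢0 → let g = pos-≢0 {o₂ e * bool (F (to e) ≡ᵇ F (from e)) * bool (K (from e) <ᵇ K a)} γ≢0
                       h = *-≢0ˡ {o₂ e * bool (F (to e) ≡ᵇ F (from e))} _ g in
             move-level (<M e<) (*-≢0ˡ _ h) (≡ᵇ⇒≡ _ _ (bool-true (*-≢0ʳ (o₂ e) h)))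
               (<ᵇ⇒< _ _ (bool-true (*-≢0ʳ (o₂ e * bool (F (to e) ≡ᵇ F (from e))) g)))) r₀ e a y z)

    step₃ : ∀ A → Good A → wp 20 (loopEnv r₀ e a y z)
      (relax guard₃ (indexE aᵈ yᵈ yᵈ zᵈ) (indexE aᵈ (arr 6 eᵈ) zᵈ (arr 5 eᵈ)) (lit 0) 11 (arr 5 eᵈ) (arr 6 eᵈ)) X
      (λ A′ → Good A′ × Le A A′ × (γ₃ ≢ 0 → Bounds 0 (V A a (to e) z (from e)) (V A′ a y y z))) A
    step₃ A good@(st , _) =
      relax-wp γ₃ (index N a y y z) (index N a (to e) z (from e)) 0 (from e) (to e)
        1≤X _ _ _ _ _ _
        (static-cong {A} (λ F K from to o₁ o₂ → bool (0 <ᵇ o₂ e * bool (F (to e) <ᵇ F (from e)) * bool (F z ≡ᵇ F (to e)) * bool (F y <ᵇ F z) * bool (K y <ᵇ K a))) st)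
        refl
        (static-cong {A} (λ F K from to o₁ o₂ → index N a (to e) z (from e)) st)
        refl
        (static-cong {A} (λ F K from to o₁ o₂ → from e) st)
        (static-cong {A} (λ F K from to o₁ o₂ → to e) st)
        (bool<B _) (index<B a< y< y< z<) (index<B a< t< z< f<) (bool<B false) (<-trans f< N<B) (<-trans t< N<B)
        (core-correct a< y< y< z< a< t< z< f< f< t< (bool<B _) (inj₂ refl) good
          (λ γ≢0 → let g₅ = pos-≢0 {p₄ * bool (K y <ᵇ K a)} γ≢0
                       g₄ = *-≢0ˡ {p₄} _ g₅
                       g₃ = *-≢0ˡ {p₃} _ g₄
                       g₂ = *-≢0ˡ {p₂} _ g₃ in
             move-down (<M e<) (*-≢0ˡ _ g₂) (<ᵇ⇒< _ _ (bool-true (*-≢0ʳ (o₂ e) g₂)))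
               (<ᵇ⇒< _ _ (bool-true (*-≢0ʳ p₃ g₄))) (<ᵇ⇒< _ _ (bool-true (*-≢0ʳ p₄ g₅)))) r₀ e a y z)
      where
      p₂ p₃ p₄ : ℕ
      p₂ = o₂ e * bool (F (to e) <ᵇ F (from e))
      p₃ = p₂ * bool (F z ≡ᵇ F (to e))
      p₄ = p₃ * bool (F y <ᵇ F z)

    -- The claim compares with the table `A₀` from the start of the round. The sources read here may
    -- have improved since, and the targets may improve further; both only help.
    body-correct : ∀ {A₀} A → Good A → Le A₀ A →
      wp 20 (loopEnv r₀ e a y z) dpBody X (λ A′ → Good A′ × Le A A′ × Closed e a y z A₀ A′) A
    body-correct {A₀} A good le =
      wp-seq _ _ (wp-mono _ ≤-refl (λ A₁ (good₁ , le₁ , q₁) →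
        wp-seq _ _ (wp-mono _ ≤-refl (λ A₂ (good₂ , le₂ , q₂) →
          wp-mono _ ≤-refl (λ A₃ (good₃ , le₃ , q₃) →
            good₃ , le-trans {A} {A₁} {A₃} le₁ (le-trans {A₁} {A₂} {A₃} le₂ le₃) ,
            (λ o k → bounds-trans (bounds-trans′ (le _) (q₁ (≢0-pos (*-≢0 o (not-< k))))) (le-trans {A₁} {A₂} {A₃} le₂ le₃ _)) ,
            (λ o f k → bounds-trans (bounds-trans′ {0} (le-trans {A₀} {A} {A₁} le le₁ _)
               (q₂ (≢0-pos (*-≢0 (*-≢0 o (bool-≢0 (≡⇒≡ᵇ _ _ f))) (bool-≢0 (<⇒<ᵇ k)))))) (le₃ _)) ,
            (λ o f g h k → bounds-trans′ {0} (le-trans {A₀} {A} {A₂} le (le-trans {A} {A₁} {A₂} le₁ le₂) _)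
               (q₃ (≢0-pos (*-≢0 (*-≢0 (*-≢0 (*-≢0 o (bool-≢0 (<⇒<ᵇ f))) (bool-≢0 (≡⇒≡ᵇ _ _ g))) (bool-≢0 (<⇒<ᵇ h))) (bool-≢0 (<⇒<ᵇ k)))))))
            (step₃ A₂ good₂))
          (step₂ A₁ good₁)))
        (step₁ A good))

  rounds : ℕ
  rounds = 2 * m + 4

  T₁ T₂ T₃ T₄ T₅ : ℕ
  T₁ = N * X
  T₂ = N * T₁
  T₃ = N * T₂
  T₄ = (m + 3) * T₃
  T₅ = rounds * T₄

  1≤T₁ : 1 ≤ T₁
  1≤T₁ = *-mono-≤ 1≤N 1≤X
  1≤T₂ : 1 ≤ T₂
  1≤T₂ = *-mono-≤ 1≤N 1≤T₁
  1≤T₃ : 1 ≤ T₃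
  1≤T₃ = *-mono-≤ 1≤N 1≤T₂
  1≤T₄ : 1 ≤ T₄
  1≤T₄ = *-mono-≤ (≤-trans (s≤s z≤n) (m≤n+m 3 m)) 1≤T₃
  1≤T₅ : 1 ≤ T₅
  1≤T₅ = *-mono-≤ (≤-trans (s≤s z≤n) (m≤n+m 4 (2 * m))) 1≤T₄

  m+3<B : m + 3 < B
  m+3<B = ≤-<-trans (+-mono-≤ (m≤n*m m 2) (n≤1+n 3)) rounds<B

  round-correct : ∀ r A → Good A → wp 12 (ρ [ 10 ↦ r ] [ 11 ↦ rounds ])
    (iter (var 2 ⊕ lit 3) (iter (var 7) (iter (var 7) (iter (var 7) dpBody)))) T₄
    (λ A′ → Good A′ × Le A A′ × (∀ e → e < m + 3 → ∀ a → a < N → ∀ y → y < N → ∀ z → z < N → Closed e a y z A A′)) A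
  round-correct r A₀ good =
    iter-all Good Le (λ e A → ∀ a → a < N → ∀ y → y < N → ∀ z → z < N → Closed e a y z A₀ A) (m + 3) (≤-trans (s≤s z≤n) (m≤n+m 3 m)) 1≤T₃ _ refl m+3<B
      (λ {A} → le-refl {A}) (λ {A} {A′} {A″} → le-trans {A} {A′} {A″})
      (λ {e} {A} {A′} l q a a< y y< z z< → closed-stable {e} {a} {y} {z} {A₀} {A} {A′} l (q a a< y y< z z<)) good
      (λ e e< A₁ good₁ le₁ →
    iter-all Good Le (λ a A → ∀ y → y < N → ∀ z → z < N → Closed e a y z A₀ A) N 1≤N 1≤T₂ _ refl N<B
      (λ {A} → le-refl {A}) (λ {A} {A′} {A″} → le-trans {A} {A′} {A″})
      (λ {a} {A} {A′} l q y y< z z< → closed-stable {e} {a} {y} {z} {A₀} {A} {A′} l (q y y< z z<)) good₁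
      (λ a a< A₂ good₂ le₂ →
    iter-all Good Le (λ y A → ∀ z → z < N → Closed e a y z A₀ A) N 1≤N 1≤T₁ _ refl N<B
      (λ {A} → le-refl {A}) (λ {A} {A′} {A″} → le-trans {A} {A′} {A″})
      (λ {y} {A} {A′} l q z z< → closed-stable {e} {a} {y} {z} {A₀} {A} {A′} l (q z z<)) good₂
      (λ y y< A₃ good₃ le₃ →
    iter-all Good Le (λ z A → Closed e a y z A₀ A) N 1≤N 1≤X _ refl N<B
      (λ {A} → le-refl {A}) (λ {A} {A′} {A″} → le-trans {A} {A′} {A″})
      (λ {z} {A} {A′} l q → closed-stable {e} {a} {y} {z} {A₀} {A} {A′} l q) good₃
      (λ z z< A₄ good₄ le₄ → Body.body-correct {r} e< a< y< z< {A₀} A₄ good₄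
        (le-trans {A₀} {A₁} {A₄} le₁ (le-trans {A₁} {A₂} {A₄} le₂ (le-trans {A₂} {A₃} {A₄} le₃ le₄)))))))

  dp-correct : ∀ A → Static A → (∀ i → A 9 i ≡ 0) →
    wp 10 ρ dp T₅ (λ A′ → Good A′ × Solved rounds (V A′)) A
  dp-correct A static zeros =
    wp-seq _ _ (wp-put 1≤T₅ _ _ (bool<B true)
      (wp-iter (λ i A → Good A × Solved i (V A) × Terminal A) rounds rounds ≤-refl
        (≤-trans (s≤s z≤n) (m≤n+m 4 (2 * m))) 1≤T₄ _ refl rounds<B
        ((static , sound) , solved-zero , terminal)
        (λ r _ A (good , solved , term) → wp-mono _ ≤-refl (λ A′ (good′ , le , closed) →
            let term′ = proj₁ (le _ (proj₁ term)) , ≤-trans (proj₂ (le _ (proj₁ term))) (proj₂ term) in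
            good′ , solved-step {V = V A} {V A′} term′ (round {A} {A′} closed) solved , term′)
          (round-correct r A good))
        (λ A (good , solved , _) → good , solved)))
    where
    Terminal : Mem → Set
    Terminal A = V A top top top root ≢ 0 × V A top top top root ≤ 1
    t : ℕ
    t = index N top top top (top + 1)
    A₁ : Mem
    A₁ = upd A 9 t 1
    t≡ : index N top top top root ≡ t
    t≡ = cong (index N top top top) (sym root≡)
    Vt : V A₁ top top top root ≡ 1
    Vt = trans (cong (A₁ 9) t≡) (upd-same (A 9) t 1)
    terminal : Terminal A₁
    terminal = (λ e → 1+n≢0 (trans (sym Vt) e)) , ≤-reflexive Vt
    sound : Sound A₁
    sound u v y z u< v< y< z< ne with index N u v y z ≟ t
    ... | no  i≢t = contradiction (trans (upd-other (A 9) 1 i≢t) (zeros _)) ne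
    ... | yes i≡t with index-injective {N} {u} {v} {y} {z} {top} {top} {top} {root} v< y< z< top<N top<N root<N (trans i≡t (sym t≡))
    ... | refl , refl , refl , refl = subst (λ x → Realised b x (next 10 A₁ (index N top top top root)) (next 11 A₁ (index N top top top root)) top top top root) (sym Vt) realised-terminal
    solved-zero : Solved 0 (V A₁)
    solved-zero _ _ _ _ p w q _ _ le =
      contradiction (≤-trans (+-mono-≤ (+-mono-≤ (path-length p) (path-length w)) (path-length q)) le) (λ { (s≤s (s≤s ())) })
    round : ∀ {A A′} →
      (∀ e → e < m + 3 → ∀ a → a < N → ∀ y → y < N → ∀ z → z < N → Closed e a y z A A′) → Round (V A) (V A′)
    round {A} {A′} closed = record
      { via-first = λ {e} {v} {y} {z} e< v< y< z< → proj₁ (closed e (M< e<) v v< y y< z z<)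
      ; via-level = λ {e} {u} {y} {z} e< u< y< z< → proj₁ (proj₂ (closed e (M< e<) u u< y y< z z<))
      ; via-down  = λ {e} {u} {y} {z} e< u< y< z< → proj₂ (proj₂ (closed e (M< e<) u u< y y< z z<)) }
      where
      M< : ∀ {e} → e < M → e < m + 3
      M< = subst (_ <_) (sym M≡)

-- Bellman–Ford

sourceE targetE weightE : Exp → Exp
sourceE e = inp (lit 6 ⊕ lit 3 ⊗ e)
targetE e = inp (lit 7 ⊕ lit 3 ⊗ e)
weightE e = inp (lit 8 ⊕ lit 3 ⊗ e)

-- The sum U of all weights bounds each of them, so m * U + 1 exceeds the weight of every path and
-- can serve as the potential at the targets.
weightSum : Cmd
weightSum = iter (var 2) (put 12 (lit 0) (arr 12 (lit 0) ⊕ weightE (var 9)))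

-- With distances subtracted from a constant, relaxation takes maxima, 0 means unreachable, and
-- truncated subtraction stops there: the strict comparison never fires for an unreached target.
relaxArc : ℕ → Cmd
relaxArc j =
  cond (arr j (sourceE (var 12)) ≺ arr j (targetE (var 12)) ⊖ weightE (var 12))
    (put j (sourceE (var 12)) (arr j (targetE (var 12)) ⊖ weightE (var 12)))
    nop

bellmanFord : ℕ → ℕ → Cmd
bellmanFord j x = put j (var x) (var 9) ⨟ iter (var 2 ⊕ lit 1) (iter (var 2) (relaxArc j))

-- The three entries behind the regular ones belong to the added vertices `top`, `root` and bottom,
-- or to the added arcs from t₁ to `top`, from `top` to s₂ and from `root` to `top`.
fill : ℕ → Exp → Exp → Exp → Exp → Exp → Cmd
fill j l e a b c =
  iter l (put j (var 10) e) ⨟ put j l a ⨟ put j (l ⊕ lit 1) b ⨟ put j (l ⊕ lit 2) c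

Agree : ℕ → Mem → Mem → Set
Agree j A A′ = ∀ k → k ≢ j → A′ k ≡ A k

agree-upd : ∀ {j A A′ i v} → Agree j A A′ → Agree j A (upd A′ j i v)
agree-upd {A′ = A′} {v = v} ag k k≢j = trans (Upd-other-array A′ v k≢j) (ag k k≢j)

module Fill (𝓛 : Layout) where

  open Layout 𝓛

  open Machine 𝓛

  record Filled (j limit : ℕ) (φ : ℕ → ℕ) (va vb vc : ℕ) (A A′ : Mem) : Set where
    field
      agree   : Agree j A A′
      entries : ∀ i → i < limit → A′ j i ≡ φ i
      entry₀  : A′ j limit ≡ va
      entry₁  : A′ j (limit + 1) ≡ vb
      entry₂  : A′ j (limit + 2) ≡ vc

  -- The hypotheses range over all memories that agree with A outside array j, because the
  -- expressions are evaluated while this array is being overwritten.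
  fill-correct : ∀ {ρ j l e a b c X A} limit (φ : ℕ → ℕ) va vb vc
    {_ : okE 10 l} {_ : okE 12 (arr j (var 10))} {_ : okE 12 e}
    {_ : okE 10 (arr j l)} {_ : okE 10 a} {_ : okE 10 (arr j (l ⊕ lit 1))} {_ : okE 10 b}
    {_ : okE 10 (arr j (l ⊕ lit 2))} {_ : okE 10 c} →
    limit < B → 1 ≤ limit → limit ≤ X →
    (∀ A′ → Agree j A A′ → Safe l ρ A′ × eval l ρ A′ ≡ limit) →
    (∀ A′ → Agree j A A′ → ∀ i → i < limit →
       Safe e (ρ [ 10 ↦ i ] [ 11 ↦ limit ]) A′ × eval e (ρ [ 10 ↦ i ] [ 11 ↦ limit ]) A′ ≡ φ i × φ i < B) →
    (∀ A′ → Agree j A A′ → Safe a ρ A′ × eval a ρ A′ ≡ va × va < B) →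
    (∀ A′ → Agree j A A′ → Safe b ρ A′ × eval b ρ A′ ≡ vb × vb < B) →
    (∀ A′ → Agree j A A′ → Safe c ρ A′ × eval c ρ A′ ≡ vc × vc < B) →
    wp 10 ρ (fill j l e a b c) X (Filled j limit φ va vb vc A) A
  fill-correct {ρ} {j} {l} {e} {a} {b} {c} {X} {A} limit φ va vb vc {k₁} {k₂} {k₃} {k₄} {k₅} {k₆} {k₇} {k₈} {k₉}
    limit<B 1≤limit limit≤X hl he ha hb hc =
    wp-seq _ _ (wp-mono _ (≤-trans (≤-reflexive (*-identityʳ limit)) limit≤X) (λ A₁ x → x)
      (wp-iter {ok = k₁} Inv limit limit ≤-refl 1≤limit ≤-refl (proj₁ (hl A (λ _ _ → refl))) (proj₂ (hl A (λ _ _ → refl))) limit<B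
        ((λ _ _ → refl) , λ _ ()) loop finish))
    where
    1≤X : 1 ≤ X
    1≤X = ≤-trans 1≤limit limit≤X
    Inv : ℕ → Mem → Set
    Inv i A′ = Agree j A A′ × (∀ i′ → i′ < i → A′ j i′ ≡ φ i′)
    loop : ∀ i → i < limit → ∀ A′ → Inv i A′ →
           wp 12 (ρ [ 10 ↦ i ] [ 11 ↦ limit ]) (put j (var 10) e) 1 (Inv (suc i)) A′
    loop i i< A′ (ag , en) with he A′ ag i i<
    ... | s , e≡ , b< = wp-put {ok = k₂} {k₃} ≤-refl _ s (subst (_< B) (sym e≡) b<)
        (agree-upd ag , entry)
      where
      entry : ∀ i′ → i′ < suc i → upd A′ j i _ j i′ ≡ φ i′
      entry i′ (s≤s i′≤i) with m≤n⇒m<n∨m≡n i′≤i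
      ... | inj₂ refl = trans (Upd-same A′ j i _) e≡
      ... | inj₁ i′<i = trans (Upd-other A′ {j} {i} {j} {i′} _ (λ { (_ , p) → <⇒≢ i′<i p })) (en i′ i′<i)
    finish : ∀ A′ → Inv limit A′ →
             wp 10 ρ (put j l a ⨟ put j (l ⊕ lit 1) b ⨟ put j (l ⊕ lit 2) c) X (Filled j limit φ va vb vc A) A′
    finish A₁ (ag₁ , en) with hl A₁ ag₁ | ha A₁ ag₁
    ... | sl₁ , l₁ | sa , a≡ , a< =
      wp-seq _ _ (wp-put {ok = k₄} {k₅} 1≤X sl₁ sa (subst (_< B) (sym a≡) a<) rest₁)
      where
      i₁ = eval l ρ A₁
      A₂ = upd A₁ j i₁ (eval a ρ A₁)
      ag₂ : Agree j A A₂
      ag₂ = agree-upd ag₁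
      rest₁ : wp 10 ρ (put j (l ⊕ lit 1) b ⨟ put j (l ⊕ lit 2) c) X (Filled j limit φ va vb vc A) A₂
      rest₁ with hl A₂ ag₂ | hb A₂ ag₂
      ... | sl₂ , l₂ | sb , b≡ , b< = wp-seq _ _ (wp-put {ok = k₆} {k₇} 1≤X (sl₂ , tt) sb (subst (_< B) (sym b≡) b<) rest₂)
        where
        A₃ = upd A₂ j (eval l ρ A₂ + 1) (eval b ρ A₂)
        ag₃ : Agree j A A₃
        ag₃ = agree-upd ag₂
        rest₂ : wp 10 ρ (put j (l ⊕ lit 2) c) X (Filled j limit φ va vb vc A) A₃
        rest₂ with hl A₃ ag₃ | hc A₃ ag₃
        ... | sl₃ , l₃ | sc , c≡ , c< = wp-put {ok = k₈} {k₉} 1≤X (sl₃ , tt) sc (subst (_< B) (sym c≡) c<) record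
          { agree   = agree-upd ag₃
          ; entries = λ i i< → trans (read₃ (<⇒≢ (<-≤-trans i< (m≤m+n limit 2))))
              (trans (read₂ (<⇒≢ (<-≤-trans i< (m≤m+n limit 1)))) (trans (read₁ (<⇒≢ i<)) (en i i<)))
          ; entry₀  = trans (read₃ (λ p → m≢1+m+n limit (trans p (+-suc limit 1))))
              (trans (read₂ (λ p → m≢1+m+n limit (trans p (+-suc limit 0))))
                (trans (cong (λ i → A₂ j i) (sym l₁)) (trans (Upd-same A₁ j i₁ _) a≡)))
          ; entry₁  = trans (read₃ (λ p → <⇒≢ (+-monoʳ-< limit ≤-refl) p))
              (trans (cong (λ i → A₃ j (i + 1)) (sym l₂)) (trans (Upd-same A₂ j _ _) b≡))
          ; entry₂  = trans (cong (λ i → A₄ j (i + 2)) (sym l₃)) (trans (Upd-same A₃ j _ _) c≡) }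
          where
          A₄ = upd A₃ j (eval l ρ A₃ + 2) (eval c ρ A₃)
          read₁ : ∀ {i} → i ≢ limit → A₂ j i ≡ A₁ j i
          read₁ {i} ne = Upd-other A₁ {j} {i₁} {j} {i} _ (λ { (_ , p) → ne (trans p l₁) })
          read₂ : ∀ {i} → i ≢ limit + 1 → A₃ j i ≡ A₂ j i
          read₂ {i} ne = Upd-other A₂ {j} {_} {j} {i} _ (λ { (_ , p) → ne (trans p (cong (_+ 1) l₂)) })
          read₃ : ∀ {i} → i ≢ limit + 2 → A₄ j i ≡ A₃ j i
          read₃ {i} ne = Upd-other A₃ {j} {_} {j} {i} _ (λ { (_ , p) → ne (trans p (cong (_+ 2) l₃)) })

module Preprocess (𝓛 : Layout)
  {n m : ℕ} (G : Digraph n m) (1≤m : 1 ≤ m) (input<off : 9 + 3 * m < Layout.off 𝓛)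
  (W : ℕ) (weight≤W : ∀ e → Digraph.weight G e ≤ W) (m*W<B : m * W < Layout.B 𝓛) (m+3<B : m + 3 < Layout.B 𝓛) where

  open Layout 𝓛

  open Machine 𝓛
  open Digraph G
  open Graph G

  record Input (A : Mem) : Set where
    field
      source : ∀ e → A 0 (6 + 3 * toℕ e) ≡ toℕ (src e)
      target : ∀ e → A 0 (7 + 3 * toℕ e) ≡ toℕ (tgt e)
      cost   : ∀ e → A 0 (8 + 3 * toℕ e) ≡ weight e

  open Input

  input-cong : ∀ {A A′} → A′ 0 ≡ A 0 → Input A → Input A′
  input-cong e I = record
    { source = λ f → trans (cong (λ g → g (6 + 3 * toℕ f)) e) (source I f)
    ; target = λ f → trans (cong (λ g → g (7 + 3 * toℕ f)) e) (target I f)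
    ; cost = λ f → trans (cong (λ g → g (8 + 3 * toℕ f)) e) (cost I f) }

  in-input : ∀ {k i} → k < 9 → i < m → k + 3 * i < off
  in-input {k} {i} k<9 i<m = <-trans (+-mono-<-≤ k<9 (*-monoʳ-≤ 3 (<⇒≤ i<m))) input<off

  private
    m<B : m < B
    m<B = ≤-<-trans (m≤m+n m 3) m+3<B

  module WeightSum (ρ : ℕ → ℕ) (ρ2 : ρ 2 ≡ m) where

    Sum : ℕ → Mem → Mem → Set
    Sum i A A′ = Agree 12 A A′ × (∀ e → toℕ e < i → weight e ≤ A′ 12 0) × A′ 12 0 ≤ i * W

    weightSum-correct : ∀ A → Input A → A 12 0 ≡ 0 → wp 9 ρ weightSum (m * 1) (Sum m A) A
    weightSum-correct A I acc≡0 = wp-iter (λ i → Sum i A) m m ≤-refl 1≤m ≤-refl _ ρ2 m<B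
      ((λ _ _ → refl) , (λ _ ()) , ≤-reflexive acc≡0)
      body (λ _ x → x)
      where
      body : ∀ i → i < m → ∀ A′ → Sum i A A′ → wp 11 _ (put 12 (lit 0) (arr 12 (lit 0) ⊕ weightE (var 9))) 1 (Sum (suc i) A) A′
      body i i<m A′ (ag , ws , le) =
        wp-put ≤-refl _ (_ , _ , in-input {8} ≤-refl i<m) (≤-<-trans le′ (≤-<-trans (*-monoˡ-≤ W i<m) m*W<B))
          (agree-upd {i = 0} ag , ws′ , le′)
        where
        f = fromℕ< i<m
        I′ = input-cong {A} {A′} (ag 0 (λ ())) I
        w≡ : A′ 0 (8 + 3 * i) ≡ weight f
        w≡ = trans (cong (λ k → A′ 0 (8 + 3 * k)) (sym (Fin.toℕ-fromℕ< i<m))) (cost I′ f)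
        le′ : A′ 12 0 + A′ 0 (8 + 3 * i) ≤ W + i * W
        le′ = ≤-trans (+-mono-≤ le (≤-trans (≤-reflexive w≡) (weight≤W f))) (≤-reflexive (+-comm (i * W) W))
        ws′ : ∀ e → toℕ e < suc i → weight e ≤ A′ 12 0 + A′ 0 (8 + 3 * i)
        ws′ e (s≤s e≤i) with m≤n⇒m<n∨m≡n e≤i
        ... | inj₁ e<i = ≤-trans (ws e e<i) (m≤m+n _ _)
        ... | inj₂ refl = ≤-trans (≤-reflexive (sym (cost I′ e))) (m≤n+m (A′ 0 (8 + 3 * toℕ e)) (A′ 12 0))

  module BF (ρ : ℕ → ℕ) (ρ2 : ρ 2 ≡ m) (top U : ℕ) (ρ9 : ρ 9 ≡ top) (top<B : top < B)
            (w≤U : ∀ e → weight e ≤ U) (m*U<top : m * U < top)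
            (j : ℕ) (okj : T (0 <ᵇ j) × T (j <ᵇ 16)) (x : ℕ) (okx : T (x <ᵇ 10)) (t : Fin n) (ρx : ρ x ≡ toℕ t) where

    open BellmanFord top U w≤U m*U<top t

    ⟦_⟧ : (ℕ → ℕ) → Fin n → ℕ
    ⟦ X ⟧ v = X (toℕ v)

    0≢j : 0 ≢ j
    0≢j refl = proj₁ okj

    Sensible : Mem → Mem → Set
    Sensible A A′ = Agree j A A′ × A′ j (toℕ t) ≡ top × Attained ⟦ A′ j ⟧

    Inner : Mem → Mem → ℕ → Mem → Set
    Inner A A₀ i A′ = Sensible A A′ × (∀ v → ⟦ A₀ j ⟧ v ≤ ⟦ A′ j ⟧ v) ×
      (∀ e → toℕ e < i → ⟦ A₀ j ⟧ (tgt e) ≤ ⟦ A′ j ⟧ (src e) + weight e)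

    Outer : Mem → ℕ → Mem → Set
    Outer A r A′ = Sensible A A′ × Covers r ⟦ A′ j ⟧

    -- In either branch the source ends with at least what the target offers, and the target offers
    -- at least what it did at the start `A₀` of the sweep, since values never fall.
    relaxArc-correct : ∀ {A A₀ r} → Input A → ∀ i → i < m → ∀ A′ → Inner A A₀ i A′ →
      wp 14 (ρ [ 10 ↦ r ] [ 11 ↦ m + 1 ] [ 12 ↦ i ] [ 13 ↦ m ]) (relaxArc j) 1 (Inner A A₀ (suc i)) A′
    relaxArc-correct {A} {A₀} I i i<m A′ ((ag , At , att) , mono , rel) =
      wp-bounded _ λ bd →
      wp-cond {ok = ((_ , _ , okj) , (_ , _ , okj) , _)} ≤-refl (s₆ , s₇ , s₈)
        (λ lt≢0 → wp-put {ok = _ , _ , okj} {(_ , _ , okj) , _ , _} ≤-refl s₆ (s₇ , s₈)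
          (≤-<-trans (m∸n≤m (A′ j τ) ω) (bd j τ))
          (updated (<ᵇ⇒< _ _ (bool-true lt≢0))))
        (λ lt≡0 → wp-nop ≤-refl ((ag , At , att) , mono , λ e e< → kept lt≡0 e (m≤n⇒m<n∨m≡n (≤-pred e<))))
      where
      f = fromℕ< i<m
      I′ = input-cong {A} {A′} (ag 0 0≢j) I
      σ τ ω : ℕ
      σ = A′ 0 (6 + 3 * i)
      τ = A′ 0 (7 + 3 * i)
      ω = A′ 0 (8 + 3 * i)
      i≡ : i ≡ toℕ f
      i≡ = sym (Fin.toℕ-fromℕ< i<m)
      s₆ = _ , in-input {6} (m≤m+n 7 2) i<m
      s₇ = _ , in-input {7} (m≤m+n 8 1) i<m
      s₈ = _ , in-input {8} ≤-refl i<m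
      σ≡ : σ ≡ toℕ (src f)
      σ≡ = trans (cong (λ k → A′ 0 (6 + 3 * k)) i≡) (source I′ f)
      τ≡ : τ ≡ toℕ (tgt f)
      τ≡ = trans (cong (λ k → A′ 0 (7 + 3 * k)) i≡) (target I′ f)
      ω≡ : ω ≡ weight f
      ω≡ = trans (cong (λ k → A′ 0 (8 + 3 * k)) i≡) (cost I′ f)
      tgt≤ : ⟦ A₀ j ⟧ (tgt f) ≤ (A′ j τ ∸ ω) + weight f
      tgt≤ = ≤-trans (mono (tgt f)) (≤-trans (m≤n+m∸n (⟦ A′ j ⟧ (tgt f)) (weight f))
        (≤-reflexive (trans (+-comm (weight f) _) (cong₂ (λ a b → A′ j a ∸ b + weight f) (sym τ≡) (sym ω≡)))))
      kept : bool (A′ j σ <ᵇ A′ j τ ∸ ω) ≡ 0 → ∀ e → toℕ e < i ⊎ toℕ e ≡ i → ⟦ A₀ j ⟧ (tgt e) ≤ ⟦ A′ j ⟧ (src e) + weight e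
      kept lt≡0 e (inj₁ e<i) = rel e e<i
      kept lt≡0 e (inj₂ e≡i) with Fin.toℕ-injective {i = e} {f} (trans e≡i i≡)
      ... | refl = ≤-trans tgt≤ (+-monoˡ-≤ (weight f)
            (≤-trans (≮⇒≥ (λ l → bool-≢0 (<⇒<ᵇ l) lt≡0)) (≤-reflexive (cong (A′ j) σ≡))))
      updated : A′ j σ < A′ j τ ∸ ω → Inner A A₀ (suc i) (upd A′ j σ (A′ j τ ∸ ω))
      updated σ< = (agree-upd ag , At′ , att′) , (λ v → ≤-trans (mono v) (mono′ v)) , rel′
        where
        A″ = upd A′ j σ (A′ j τ ∸ ω)
        new : ∀ v → toℕ v ≡ σ → A″ j (toℕ v) ≡ A′ j τ ∸ ω
        new v v≡ = trans (cong (A″ j) v≡) (Upd-same A′ j σ _)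
        old : ∀ v → toℕ v ≢ σ → A″ j (toℕ v) ≡ A′ j (toℕ v)
        old v v≢ = Upd-other A′ {j} {σ} {j} {toℕ v} _ (λ { (_ , e) → v≢ e })
        small : A′ j τ ∸ ω ≤ top
        small = ≤-trans (m∸n≤m (A′ j τ) ω) (≤-trans (≤-reflexive (cong (A′ j) τ≡)) (attained≤ {g = ⟦ A′ j ⟧} att (tgt f)))
        At′ : A″ j (toℕ t) ≡ top
        At′ with toℕ t ≟ σ
        ... | no  t≢ = trans (old t t≢) At
        -- An update strictly raises a cell, but t already holds `top`, which no attained value
        -- exceeds.
        ... | yes t≡ = contradiction (<-≤-trans σ< small) (λ l → <-irrefl (trans (cong (A′ j) (sym t≡)) At) l)
        mono′ : ∀ v → A′ j (toℕ v) ≤ A″ j (toℕ v)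
        mono′ v with toℕ v ≟ σ
        ... | no  v≢ = ≤-reflexive (sym (old v v≢))
        ... | yes v≡ = ≤-trans (≤-reflexive (cong (A′ j) v≡)) (≤-trans (<⇒≤ σ<) (≤-reflexive (sym (new v v≡))))
        att′ : Attained ⟦ A″ j ⟧
        att′ v 0< with toℕ v ≟ σ
        ... | no  v≢ = subst (λ y → Σ[ p ∈ Wk v t ] (y + wt p ≡ top)) (sym (old v v≢)) (att v (subst (0 <_) (old v v≢) 0<))
        ... | yes v≡ with Fin.toℕ-injective {i = v} {src f} (trans v≡ σ≡)
        ... | refl = subst (λ y → Σ[ p ∈ Wk v t ] (y + wt p ≡ top)) (sym (new v v≡))
              (attained-step {⟦ A′ j ⟧} f att (cong₂ (λ a b → A′ j a ∸ b) (sym τ≡) (sym ω≡)) (subst (0 <_) (new v v≡) 0<))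
        rel′ : ∀ e → toℕ e < suc i → ⟦ A₀ j ⟧ (tgt e) ≤ ⟦ A″ j ⟧ (src e) + weight e
        rel′ e (s≤s e≤i) with m≤n⇒m<n∨m≡n e≤i
        ... | inj₁ e<i = ≤-trans (rel e e<i) (+-monoˡ-≤ (weight e) (mono′ (src e)))
        ... | inj₂ e≡i with Fin.toℕ-injective {i = e} {f} (trans e≡i i≡)
        ... | refl = ≤-trans tgt≤ (≤-reflexive (cong (_+ weight f) (sym (new (src f) (sym σ≡)))))

    bellmanFord-correct : ∀ A → Input A → (∀ i → A j i ≡ 0) →
      wp 10 ρ (bellmanFord j x) ((m + 1) * (m * 1))
        (λ A′ → Agree j A A′ × Potential top t ⟦ A′ j ⟧ × (∀ {s} → Wk s t → 0 < ⟦ A′ j ⟧ s)) A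
    bellmanFord-correct A I zeros =
      wp-seq _ _ (wp-put {ok = okx , _ , okj} 1≤ _ _ (subst (_< B) (sym ρ9) top<B)
        (wp-iter (Outer A) (m + 1) (m + 1) ≤-refl (m≤n+m 1 m) (*-mono-≤ 1≤m (≤-refl {1})) _ (cong (_+ 1) ρ2) m+1<B
          init
          (λ r _ A₀ (sens , cov) →
            wp-iter (Inner A A₀) m m ≤-refl 1≤m ≤-refl _ ρ2 m<B (sens , (λ _ → ≤-refl) , λ _ ())
              (relaxArc-correct {A} {A₀} {r} I)
              (λ A′ (sens′ , mono , rel) → sens′ , covers-step {g = ⟦ A₀ j ⟧} {⟦ A′ j ⟧} cov mono (λ e → rel e (Fin.toℕ<n e))))
          (λ A′ ((ag , At , att) , cov) →
            let cov′ = subst (λ r → Covers r ⟦ A′ j ⟧) (+-comm m 1) cov in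
            ag , potential {⟦ A′ j ⟧} At att cov′ , reachable {⟦ A′ j ⟧} cov′)))
      where
      1≤ : 1 ≤ (m + 1) * (m * 1)
      1≤ = *-mono-≤ (m≤n+m 1 m) (*-mono-≤ 1≤m (≤-refl {1}))
      m+1<B : m + 1 < B
      m+1<B = ≤-<-trans (+-monoʳ-≤ m (s≤s z≤n)) m+3<B
      A₁ = upd A j (ρ x) (ρ 9)
      At : A₁ j (toℕ t) ≡ top
      At = trans (cong (A₁ j) (sym ρx)) (trans (Upd-same A j (ρ x) (ρ 9)) ρ9)
      init : Outer A 0 A₁
      init = (agree-upd {i = ρ x} (λ _ _ → refl) , At , att) , covers-zero {⟦ A₁ j ⟧} At
        where
        att : Attained ⟦ A₁ j ⟧
        att v 0< with toℕ v ≟ ρ x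
        ... | no  v≢ = contradiction (trans (Upd-other A {j} {ρ x} {j} {toℕ v} _ (λ { (_ , e) → v≢ e })) (zeros (toℕ v))) (λ z → <-irrefl (sym z) 0<)
        ... | yes v≡ with Fin.toℕ-injective {i = v} {t} (trans v≡ ρx)
        ... | refl = ε , trans (+-identityʳ _) At

-- The network of an instance

subset : ∀ {n} → List (Fin n) → Subset n
subset vs = ⋃ (map ⁅_⁆ vs)

∈-subset⁺ : ∀ {n} {x : Fin n} {vs} → x ∈ vs → x ∈ₛ subset vs
∈-subset⁺ (here refl)       = Sub.x∈p∪q⁺ (inj₁ (Sub.x∈⁅x⁆ _))
∈-subset⁺ {vs = v ∷ vs} (there x∈) = Sub.x∈p∪q⁺ {p = ⁅ v ⁆} (inj₂ (∈-subset⁺ x∈))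

∈-subset⁻ : ∀ {n} {x : Fin n} vs → x ∈ₛ subset vs → x ∈ vs
∈-subset⁻ []       x∈ = contradiction x∈ Sub.∉⊥
∈-subset⁻ (v ∷ vs) x∈ with Sub.x∈p∪q⁻ ⁅ v ⁆ (subset vs) x∈
... | inj₁ x∈v  = here (Sub.x∈⁅y⁆⇒x≡y v x∈v)
... | inj₂ x∈vs = there (∈-subset⁻ vs x∈vs)

insert-count : ∀ {n} (x : Fin n) (p q : Subset n) → x ∉ₛ p →
               ∣ (⁅ x ⁆ ∪ p) ∩ q ∣ ≡ bool (does (x Sub.∈? q)) + ∣ p ∩ q ∣
insert-count Fin.zero (inside ∷ p) q x∉ = contradiction here x∉
insert-count Fin.zero (outside ∷ p) (inside ∷ q) x∉ = cong (λ r → suc ∣ r ∩ q ∣) (Sub.∪-identityˡ p)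
insert-count Fin.zero (outside ∷ p) (outside ∷ q) x∉ = cong (λ r → ∣ r ∩ q ∣) (Sub.∪-identityˡ p)
insert-count (Fin.suc x) (inside ∷ p) (inside ∷ q) x∉ =
  trans (cong suc (insert-count x p q (λ x∈ → x∉ (there x∈)))) (sym (+-suc _ _))
insert-count (Fin.suc x) (inside ∷ p) (outside ∷ q) x∉ = insert-count x p q (λ x∈ → x∉ (there x∈))
insert-count (Fin.suc x) (outside ∷ p) (inside ∷ q) x∉ = insert-count x p q (λ x∈ → x∉ (there x∈))
insert-count (Fin.suc x) (outside ∷ p) (outside ∷ q) x∉ = insert-count x p q (λ x∈ → x∉ (there x∈))

-- Bridge between the cardinality in the problem and counting along lists: as the vertices are
-- distinct, each insertion contributes exactly its own indicator.
card-count : ∀ {n} (vs : List (Fin n)) (q : Subset n) (ys : List ℕ) →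
             (∀ x → x ∈ₛ q → toℕ x ∈ ys) → (∀ x → toℕ x ∈ ys → x ∈ₛ q) → Unique vs →
             ∣ subset vs ∩ q ∣ ≡ count (map toℕ vs) ys
card-count {n} []  q ys to from u = trans (cong ∣_∣ (Sub.∩-zeroˡ q)) (Sub.∣⊥∣≡0 n)
card-count (v ∷ vs) q ys to from (v∉ ∷ u) =
  trans (insert-count v (subset vs) q (λ v∈ → All.lookup v∉ (∈-subset⁻ vs v∈) refl))
    (cong₂ _+_ (cong bool decided) (card-count vs q ys to from u))
  where
  decided : does (v Sub.∈? q) ≡ does (toℕ v ∈? ys)
  decided with v Sub.∈? q
  ... | yes v∈ = sym (dec-true (toℕ v ∈? ys) (to v v∈))
  ... | no  v∉ = sym (dec-false (toℕ v ∈? ys) (λ v∈ → v∉ (from v v∈)))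

count-append : ∀ xs {zs} ys → count (xs ++ zs) ys ≡ count xs ys + count zs ys
count-append []       ys = refl
count-append (x ∷ xs) ys = trans (cong (bool (does (x ∈? ys)) +_) (count-append xs ys)) (sym (+-assoc (bool (does (x ∈? ys))) _ _))

-- Serves vertices and arcs alike: both kinds of arrays have three added entries at their end.
data Class (n : ℕ) : ℕ → Set where
  inner  : (v : Fin n) → Class n (toℕ v)
  first  : Class n n
  second : Class n (n + 1)
  third  : Class n (n + 2)

classify : ∀ n x → x < n + 3 → Class n x
classify n x x< with x <? n
... | yes x<n = subst (Class n) (Fin.toℕ-fromℕ< x<n) (inner (fromℕ< x<n))
... | no  x≮n with m≤n⇒∃[o]m+o≡n (≮⇒≥ x≮n)
... | 0 , refl = subst (Class n) (sym (+-identityʳ n)) first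
... | 1 , refl = second
... | 2 , refl = third
... | suc (suc (suc k)) , refl = contradiction (+-cancelˡ-< n _ _ x<) (λ { (s≤s (s≤s (s≤s ()))) })

module Build {n m : ℕ} (I : Instance n m) (big : ℕ) (g₁ g₂ : Fin n → ℕ)
  (Π₁ : Graph.Potential (Instance.graph I) big (Instance.t₁ I) g₁)
  (Π₂ : Graph.Potential (Instance.graph I) big (Instance.t₂ I) g₂)
  (F K from to o₁ o₂ : ℕ → ℕ) where

  open Instance I
  open Digraph graph
  open Graph graph
  module Π₁ = Potential Π₁
  module Π₂ = Potential Π₂

  -- The second path is extended at its start by root = n + 1 and top = n, the first
  -- one at its end by top; n + 2 forms a level below all others, where the search
  -- starts.
  record Arrays : Set where
    field
      -- The level g₁ - g₂, shifted by big + 1 to become a positive natural number. It is at most 2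
      -- big + 1, which explains the levels of `top` and `root`.
      F-vertex  : ∀ v → F (toℕ v) ≡ 1 + g₁ v + (big ∸ g₂ v)
      F-top     : F n ≡ 2 * big + 2
      F-root    : F (n + 1) ≡ 2 * big + 3
      F-bottom  : F (n + 2) ≡ 0
      -- As g₁ ≤ big, this number encodes the pair of F and g₁ in lexicographic order.
      K-vertex  : ∀ v → K (toℕ v) ≡ F (toℕ v) * (big + 1) + g₁ v
      K-top     : K n ≡ F n * (big + 1)
      K-root    : K (n + 1) ≡ F (n + 1) * (big + 1)
      K-bottom  : K (n + 2) ≡ 0
      from-arc  : ∀ e → from (toℕ e) ≡ toℕ (src e)
      from-0    : from m ≡ toℕ t₁
      from-1    : from (m + 1) ≡ n
      from-2    : from (m + 2) ≡ n + 1
      to-arc    : ∀ e → to (toℕ e) ≡ toℕ (tgt e)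
      to-0      : to m ≡ n
      to-1      : to (m + 1) ≡ toℕ s₂
      to-2      : to (m + 2) ≡ n
      o₁-arc    : ∀ e → o₁ (toℕ e) ≡ bool (g₁ (tgt e) ≡ᵇ g₁ (src e) + weight e)
      o₁-0      : o₁ m ≡ 1
      o₁-1      : o₁ (m + 1) ≡ 0
      o₁-2      : o₁ (m + 2) ≡ 0
      o₂-arc    : ∀ e → o₂ (toℕ e) ≡ bool (g₂ (tgt e) ≡ᵇ g₂ (src e) + weight e)
      o₂-0      : o₂ m ≡ 0
      o₂-1      : o₂ (m + 1) ≡ 1
      o₂-2      : o₂ (m + 2) ≡ 1

  module WithArrays (𝒜 : Arrays) where
    open Arrays 𝒜

    tight₁ : ∀ e → o₁ (toℕ e) ≢ 0 → Π₁.Tight e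
    tight₁ e o = ≡ᵇ⇒≡ _ _ (bool-true (subst (_≢ 0) (o₁-arc e) o))

    tight₂ : ∀ e → o₂ (toℕ e) ≢ 0 → Π₂.Tight e
    tight₂ e o = ≡ᵇ⇒≡ _ _ (bool-true (subst (_≢ 0) (o₂-arc e) o))

    K-scaled : ∀ x → x < n + 3 → Σ[ k ∈ ℕ ] (K x ≡ (big + 1) * F x + k × k < big + 1)
    K-scaled x x< with classify n x x<
    ... | inner v = g₁ v , trans (K-vertex v) (cong (_+ g₁ v) (*-comm (F (toℕ v)) (big + 1))) , ≤-trans (s≤s (Π₁.g≤top v)) (≤-reflexive (+-comm 1 big))
    ... | first   = 0 , trans K-top (trans (*-comm (F n) (big + 1)) (sym (+-identityʳ _))) , m≤n+m 1 big
    ... | second  = 0 , trans K-root (trans (*-comm (F (n + 1)) (big + 1)) (sym (+-identityʳ _))) , m≤n+m 1 big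
    ... | third   = 0 , trans K-bottom (sym (trans (+-identityʳ _) (trans (cong ((big + 1) *_) F-bottom) (*-zeroʳ (big + 1))))) , m≤n+m 1 big

    K-refines : ∀ {u v} → u < n + 3 → v < n + 3 → F u < F v → K u < K v
    K-refines {u} {v} u< v< Fu<Fv with K-scaled u u< | K-scaled v v<
    ... | k , Ku , k< | k′ , Kv , _ = subst₂ _<_ (sym Ku) (sym Kv)
          (<-≤-trans (scaled-bound {big + 1} {F v} {F u} Fu<Fv k<) (m≤m+n _ k′))

    F-vertex<top : ∀ v → F (toℕ v) < F n
    F-vertex<top v = begin-strict
      F (toℕ v)                  ≡⟨ F-vertex v ⟩
      1 + g₁ v + (big ∸ g₂ v)    ≤⟨ +-mono-≤ (s≤s (Π₁.g≤top v)) (m∸n≤m big (g₂ v)) ⟩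
      1 + big + big              <⟨ ≤-reflexive (trans (cong (λ k → 2 + (big + k)) (sym (+-identityʳ big))) (+-comm 2 (2 * big))) ⟩
      2 * big + 2                ≡⟨ sym F-top ⟩
      F n                        ∎
      where open ≤-Reasoning

    top<root : F n < F (n + 1)
    top<root = subst₂ _<_ (sym F-top) (sym F-root) (+-monoʳ-< (2 * big) ≤-refl)

    -- g₁ grows by the full weight of the arc, and feasibility allows g₂ to grow by no more.
    F-arc₁ : ∀ e → Π₁.Tight e → F (toℕ (src e)) ≤ F (toℕ (tgt e))
    F-arc₁ e τ = begin
      F (toℕ (src e))                                   ≡⟨ F-vertex (src e) ⟩
      1 + g₁ (src e) + (big ∸ g₂ (src e))               ≤⟨ +-monoʳ-≤ (1 + g₁ (src e)) drop ⟩
      1 + g₁ (src e) + (weight e + (big ∸ g₂ (tgt e)))  ≡⟨ sym (+-assoc (1 + g₁ (src e)) (weight e) _) ⟩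
      1 + (g₁ (src e) + weight e) + (big ∸ g₂ (tgt e))  ≡⟨ cong (λ k → 1 + k + (big ∸ g₂ (tgt e))) (sym τ) ⟩
      1 + g₁ (tgt e) + (big ∸ g₂ (tgt e))               ≡⟨ sym (F-vertex (tgt e)) ⟩
      F (toℕ (tgt e))                                   ∎
      where
      open ≤-Reasoning
      drop : big ∸ g₂ (src e) ≤ weight e + (big ∸ g₂ (tgt e))
      drop = ≤-trans (∸-monoʳ-≤ big (m≤n+o⇒m∸o≤n {g₂ (tgt e)} {g₂ (src e)} {weight e} (Π₂.feasible e)))
        (m∸[n∸o]≤ (g₂ (tgt e)) (weight e))
        where
        m≤n+o⇒m∸o≤n : ∀ {x y z} → x ≤ y + z → x ∸ z ≤ y
        m≤n+o⇒m∸o≤n {x} {y} {z} le = ≤-trans (∸-monoˡ-≤ z le) (≤-reflexive (m+n∸n≡m y z))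
        m∸[n∸o]≤ : ∀ y z → big ∸ (y ∸ z) ≤ z + (big ∸ y)
        m∸[n∸o]≤ y z = m≤n+o⇒m∸n≤o big (y ∸ z) (begin
          big                         ≤⟨ m≤n+m∸n big y ⟩
          y + (big ∸ y)               ≤⟨ +-monoˡ-≤ (big ∸ y) (m≤n+m∸n y z) ⟩
          z + (y ∸ z) + (big ∸ y)     ≡⟨ cong (_+ (big ∸ y)) (+-comm z (y ∸ z)) ⟩
          y ∸ z + z + (big ∸ y)       ≡⟨ +-assoc (y ∸ z) z _ ⟩
          y ∸ z + (z + (big ∸ y))     ∎)

    F-arc₂ : ∀ e → Π₂.Tight e → F (toℕ (tgt e)) ≤ F (toℕ (src e))
    F-arc₂ e τ = begin
      F (toℕ (tgt e))                                   ≡⟨ F-vertex (tgt e) ⟩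
      1 + g₁ (tgt e) + (big ∸ g₂ (tgt e))               ≤⟨ +-monoˡ-≤ (big ∸ g₂ (tgt e)) (s≤s (Π₁.feasible e)) ⟩
      1 + (g₁ (src e) + weight e) + (big ∸ g₂ (tgt e))  ≡⟨ +-assoc (1 + g₁ (src e)) (weight e) _ ⟩
      1 + g₁ (src e) + (weight e + (big ∸ g₂ (tgt e)))  ≡⟨ cong (1 + g₁ (src e) +_) lift ⟩
      1 + g₁ (src e) + (big ∸ g₂ (src e))               ≡⟨ sym (F-vertex (src e)) ⟩
      F (toℕ (src e))                                   ∎
      where
      open ≤-Reasoning
      lift : weight e + (big ∸ g₂ (tgt e)) ≡ big ∸ g₂ (src e)
      lift = trans (sym (+-∸-assoc (weight e) (Π₂.g≤top (tgt e))))
        (trans (cong₂ _∸_ (+-comm (weight e) big) τ)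
          ([m+n]∸[o+n] big (g₂ (src e)) (weight e)))
        where
        [m+n]∸[o+n] : ∀ x y z → (x + z) ∸ (y + z) ≡ x ∸ y
        [m+n]∸[o+n] x y z = trans (cong₂ _∸_ (+-comm x z) (+-comm y z)) ([m+n]∸[m+o]≡n∸o z x y)

    -- On one level every arc of the second path is also an arc of the first.
    level-tight : ∀ e → Π₂.Tight e → F (toℕ (tgt e)) ≡ F (toℕ (src e)) → g₁ (src e) < g₁ (tgt e)
    level-tight e τ F≡ with g₁ (src e) <? g₁ (tgt e)
    ... | yes l = l
    ... | no  l = contradiction F≡ (<⇒≢ (subst₂ _<_ (sym (F-vertex (tgt e))) (sym (F-vertex (src e)))
          (+-mono-≤-< (s≤s (≮⇒≥ l)) (∸-monoʳ-< (≤-trans (m<m+n (g₂ (src e)) (positive e)) (≤-reflexive (sym τ))) (Π₂.g≤top (tgt e))))))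

    K-inner : ∀ u v → F (toℕ u) ≤ F (toℕ v) → g₁ u < g₁ v → K (toℕ u) < K (toℕ v)
    K-inner u v F≤ g< = subst₂ _<_ (sym (K-vertex u)) (sym (K-vertex v)) (+-mono-≤-< (*-monoˡ-≤ (big + 1) F≤) g<)

    inner<N : ∀ (v : Fin n) → toℕ v < n + 3
    inner<N v = <-≤-trans (Fin.toℕ<n v) (m≤m+n n 3)
    n<N : n < n + 3
    n<N = subst (n <_) (+-comm 3 n) (s≤s (m≤n+m n 2))
    n+1<N : n + 1 < n + 3
    n+1<N = +-monoʳ-< n (s≤s (s≤s z≤n))
    n+2<N : n + 2 < n + 3
    n+2<N = +-monoʳ-< n ≤-refl
    n≢n+1 : n ≢ n + 1
    n≢n+1 = <⇒≢ (m<m+n n (s≤s z≤n))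
    v≢n : ∀ (v : Fin n) → toℕ v ≢ n
    v≢n v = <⇒≢ (Fin.toℕ<n v)
    v≢n+1 : ∀ (v : Fin n) → toℕ v ≢ n + 1
    v≢n+1 v = <⇒≢ (<-≤-trans (Fin.toℕ<n v) (m≤m+n n 1))

    network : Network
    network = record
      { N = n + 3 ; M = m + 3 ; top = n ; root = n + 1
      ; F = F ; K = K ; from = from ; to = to ; o₁ = o₁ ; o₂ = o₂
      ; from<N = λ {e} e< → from< e (classify m e e<)
      ; to<N = λ {e} e< → to< e (classify m e e<)
      ; K-refines-F = K-refines
      ; K-increases = λ {e} e< → inc e (classify m e e<)
      ; F-decreases = λ {e} e< → dec e (classify m e e<)
      ; K-increases-level = λ {e} e< → level e (classify m e e<)
      ; top<N = n<N
      ; root<N = n+1<N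
      ; top-level = λ {v} v< → tops v (classify n v v<)
      ; F-top<F-root = top<root
      ; top-leaves-level = λ {e} e< → leaves e (classify m e e<)
      ; root-to-top = λ {e} e< → roots e (classify m e e<) }
      where
      from< : ∀ e → Class m e → from e < n + 3
      from< _ (inner e) = subst (_< n + 3) (sym (from-arc e)) (inner<N (src e))
      from< _ first     = subst (_< n + 3) (sym from-0) (inner<N t₁)
      from< _ second    = subst (_< n + 3) (sym from-1) n<N
      from< _ third     = subst (_< n + 3) (sym from-2) n+1<N
      to< : ∀ e → Class m e → to e < n + 3
      to< _ (inner e) = subst (_< n + 3) (sym (to-arc e)) (inner<N (tgt e))
      to< _ first     = subst (_< n + 3) (sym to-0) n<N
      to< _ second    = subst (_< n + 3) (sym to-1) (inner<N s₂)
      to< _ third     = subst (_< n + 3) (sym to-2) n<N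
      inc : ∀ e → Class m e → o₁ e ≢ 0 → K (from e) < K (to e)
      inc _ (inner e) o = subst₂ (λ x y → K x < K y) (sym (from-arc e)) (sym (to-arc e))
        (K-inner (src e) (tgt e) (F-arc₁ e (tight₁ e o)) (<-≤-trans (m<m+n (g₁ (src e)) (positive e)) (≤-reflexive (sym (tight₁ e o)))))
      inc _ first o = subst₂ (λ x y → K x < K y) (sym from-0) (sym to-0) (K-refines (inner<N t₁) n<N (F-vertex<top t₁))
      inc _ second o = contradiction o₁-1 o
      inc _ third o  = contradiction o₁-2 o
      dec : ∀ e → Class m e → o₂ e ≢ 0 → F (to e) ≤ F (from e)
      dec _ (inner e) o = subst₂ (λ x y → F y ≤ F x) (sym (from-arc e)) (sym (to-arc e)) (F-arc₂ e (tight₂ e o))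
      dec _ first o  = contradiction o₂-0 o
      dec _ second o = subst₂ (λ x y → F y ≤ F x) (sym from-1) (sym to-1) (<⇒≤ (F-vertex<top s₂))
      dec _ third o  = subst₂ (λ x y → F y ≤ F x) (sym from-2) (sym to-2) (<⇒≤ top<root)
      level : ∀ e → Class m e → o₂ e ≢ 0 → F (to e) ≡ F (from e) → K (from e) < K (to e)
      level _ (inner e) o F≡ = subst₂ (λ x y → K x < K y) (sym (from-arc e)) (sym (to-arc e))
          (K-inner (src e) (tgt e) (≤-reflexive (sym F≡′)) (level-tight e (tight₂ e o) F≡′))
        where F≡′ = subst₂ (λ x y → F y ≡ F x) (from-arc e) (to-arc e) F≡
      level _ first o F≡  = contradiction o₂-0 o
      level _ second o F≡ = contradiction (subst₂ (λ x y → F y ≡ F x) from-1 to-1 F≡) (<⇒≢ (F-vertex<top s₂))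
      level _ third o F≡  = contradiction (subst₂ (λ x y → F y ≡ F x) from-2 to-2 F≡) (<⇒≢ top<root)
      tops : ∀ v → Class n v → F n ≤ F v → v ≡ n ⊎ v ≡ n + 1
      tops _ (inner v) le = contradiction le (<⇒≱ (F-vertex<top v))
      tops _ first le  = inj₁ refl
      tops _ second le = inj₂ refl
      tops _ third le  = contradiction le (<⇒≱ (subst₂ _<_ (sym F-bottom) (sym F-top) (≤-trans (s≤s z≤n) (m≤n+m 2 (2 * big)))))
      leaves : ∀ e → Class m e → o₂ e ≢ 0 → from e ≡ n → F (to e) ≢ F (from e)
      leaves _ (inner e) o f≡ F≡ = v≢n (src e) (trans (sym (from-arc e)) f≡)
      leaves _ first o f≡ F≡  = o o₂-0
      leaves _ second o f≡ F≡ = <⇒≢ (F-vertex<top s₂) (subst₂ (λ x y → F y ≡ F x) from-1 to-1 F≡)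
      leaves _ third o f≡ F≡  = n≢n+1 (trans (sym f≡) from-2)
      roots : ∀ e → Class m e → o₂ e ≢ 0 → from e ≡ n + 1 → to e ≡ n
      roots _ (inner e) o f≡ = contradiction (trans (sym (from-arc e)) f≡) (v≢n+1 (src e))
      roots _ first o f≡  = contradiction o₂-0 o
      roots _ second o f≡ = contradiction (trans (sym from-1) f≡) n≢n+1
      roots _ third o f≡  = to-2

    open NetworkTheory network

    arc<M : ∀ (e : Fin m) → toℕ e < m + 3
    arc<M e = <-≤-trans (Fin.toℕ<n e) (m≤m+n m 3)

    names : ∀ {u v} → Wk u v → List ℕ
    names p = map toℕ (vs p)

    path₁⁺ : ∀ {u} (p : Wk u t₁) → Π₁.AllTight p → Path R₁ (toℕ u) n (names p ++ n ∷ [])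
    path₁⁺ ε [] = cons (m , m<m+n m (s≤s z≤n) , (λ o → 1+n≢0 (trans (sym o₁-0) o)) , from-0 , to-0) nil
    path₁⁺ ((e , refl , refl) ◅ p) (τ ∷ τs) =
      cons (toℕ e , arc<M e , subst (_≢ 0) (sym (o₁-arc e)) (bool-≢0 (≡⇒≡ᵇ _ _ τ)) , from-arc e , to-arc e) (path₁⁺ p τs)

    path₁⁻ : ∀ {x z xs} → Path R₁ x z xs → ∀ u → x ≡ toℕ u → z ≡ n →
             Σ[ p ∈ Wk u t₁ ] (Π₁.AllTight p × xs ≡ names p ++ n ∷ [])
    path₁⁻ nil u x≡ z≡ = contradiction (trans (sym x≡) z≡) (v≢n u)
    path₁⁻ (cons (e , e< , o , f≡ , t≡) p) u x≡ z≡ with classify m e e<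
    path₁⁻ (cons (_ , e< , o , f≡ , t≡) p) u refl z≡ | inner e with Fin.toℕ-injective {i = src e} {u} (trans (sym (from-arc e)) f≡)
    ... | refl with path₁⁻ p (tgt e) (trans (sym t≡) (to-arc e)) z≡
    ... | q , τs , refl = (e , refl , refl) ◅ q , tight₁ e o ∷ τs , refl
    path₁⁻ (cons (_ , e< , o , f≡ , t≡) p) u refl refl | first with Fin.toℕ-injective {i = t₁} {u} (trans (sym from-0) f≡)
    ... | refl with trans (sym t≡) to-0 | p
    ... | refl | nil = ε , [] , refl
    -- No arc of the first path leaves `top`, so the path ends on its first arrival there.
    ... | refl | cons (e′ , e′< , o′ , f′≡ , _) _ = contradiction f′≡ (nothing e′ (classify m e′ e′<) o′)
      where
      nothing : ∀ e → Class m e → o₁ e ≢ 0 → from e ≢ n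
      nothing _ (inner e) o f≡ = v≢n (src e) (trans (sym (from-arc e)) f≡)
      nothing _ first o f≡ = v≢n t₁ (trans (sym from-0) f≡)
      nothing _ second o f≡ = o o₁-1
      nothing _ third o f≡ = o o₁-2
    path₁⁻ (cons (_ , e< , o , f≡ , t≡) p) u x≡ z≡ | second = contradiction o₁-1 o
    path₁⁻ (cons (_ , e< , o , f≡ , t≡) p) u x≡ z≡ | third = contradiction o₁-2 o

    path₂⁺ : ∀ {u} (p : Wk u t₂) → Π₂.AllTight p → Path R₂ (toℕ u) (toℕ t₂) (names p)
    path₂⁺ ε [] = nil
    path₂⁺ ((e , refl , refl) ◅ p) (τ ∷ τs) =
      cons (toℕ e , arc<M e , subst (_≢ 0) (sym (o₂-arc e)) (bool-≢0 (≡⇒≡ᵇ _ _ τ)) , from-arc e , to-arc e) (path₂⁺ p τs)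

    root-path⁺ : (p : Wk s₂ t₂) → Π₂.AllTight p → Path R₂ (n + 1) (toℕ t₂) (n + 1 ∷ n ∷ names p)
    root-path⁺ p τs =
      cons (m + 2 , +-monoʳ-< m ≤-refl , (λ o → 1+n≢0 (trans (sym o₂-2) o)) , from-2 , to-2)
        (cons (m + 1 , +-monoʳ-< m (s≤s (s≤s z≤n)) , (λ o → 1+n≢0 (trans (sym o₂-1) o)) , from-1 , to-1) (path₂⁺ p τs))

    path₂⁻ : ∀ {x z zs} → Path R₂ x z zs → ∀ u → x ≡ toℕ u → z ≡ toℕ t₂ →
             Σ[ p ∈ Wk u t₂ ] (Π₂.AllTight p × zs ≡ names p)
    path₂⁻ nil u x≡ z≡ with Fin.toℕ-injective {i = u} {t₂} (trans (sym x≡) z≡)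
    ... | refl = ε , [] , cong (_∷ []) x≡
    path₂⁻ (cons (e , e< , o , f≡ , t≡) p) u x≡ z≡ with classify m e e<
    path₂⁻ (cons (_ , e< , o , f≡ , t≡) p) u refl z≡ | inner e with Fin.toℕ-injective {i = src e} {u} (trans (sym (from-arc e)) f≡)
    ... | refl with path₂⁻ p (tgt e) (trans (sym t≡) (to-arc e)) z≡
    ... | q , τs , refl = (e , refl , refl) ◅ q , tight₂ e o ∷ τs , refl
    path₂⁻ (cons (_ , e< , o , f≡ , t≡) p) u x≡ z≡ | first = contradiction o₂-0 o
    path₂⁻ (cons (_ , e< , o , f≡ , t≡) p) u x≡ z≡ | second = contradiction (trans (sym (trans f≡ x≡)) from-1) (v≢n u)
    path₂⁻ (cons (_ , e< , o , f≡ , t≡) p) u x≡ z≡ | third = contradiction (trans (sym (trans f≡ x≡)) from-2) (v≢n+1 u)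

    top-path⁻ : ∀ {x z zs} → Path R₂ x z zs → x ≡ n → z ≡ toℕ t₂ →
                Σ[ p ∈ Wk s₂ t₂ ] (Π₂.AllTight p × zs ≡ n ∷ names p)
    top-path⁻ nil x≡ z≡ = contradiction (trans (sym z≡) x≡) (v≢n t₂)
    top-path⁻ (cons (e , e< , o , f≡ , t≡) p) x≡ z≡ with classify m e e<
    ... | inner e = contradiction (trans (sym (from-arc e)) (trans f≡ x≡)) (v≢n (src e))
    ... | first = contradiction o₂-0 o
    ... | third = contradiction (trans (sym (trans f≡ x≡)) from-2) n≢n+1
    ... | second with path₂⁻ p s₂ (trans (sym t≡) to-1) z≡
    ... | q , τs , refl = q , τs , cong (_∷ names q) x≡

    root-path⁻ : ∀ {x z zs} → Path R₂ x z zs → x ≡ n + 1 → z ≡ toℕ t₂ →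
                 Σ[ p ∈ Wk s₂ t₂ ] (Π₂.AllTight p × zs ≡ n + 1 ∷ n ∷ names p)
    root-path⁻ nil x≡ z≡ = contradiction (trans (sym z≡) x≡) (v≢n+1 t₂)
    root-path⁻ (cons (e , e< , o , f≡ , t≡) p) x≡ z≡ with classify m e e<
    ... | inner e = contradiction (trans (sym (from-arc e)) (trans f≡ x≡)) (v≢n+1 (src e))
    ... | first = contradiction o₂-0 o
    ... | second = contradiction (trans (sym from-1) (trans f≡ x≡)) n≢n+1
    ... | third with top-path⁻ p (trans (sym t≡) to-2) z≡
    ... | q , τs , refl = q , τs , cong (_∷ n ∷ names q) x≡

    -- Of the added vertices only `top` is on both extended lists; it accounts for the summand 1.
    common-count : ∀ {s₁ t₁ s₂ t₂} (p : Wk s₁ t₁) (q : Wk s₂ t₂) → Unique (vs p) →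
      count (names p ++ n ∷ []) (n + 1 ∷ n ∷ names q) ≡ 1 + ∣ subset (vs p) ∩ subset (vs q) ∣
    common-count p q u =
      trans (count-append (names p) ys) (trans (cong₂ _+_ (sym (card-count (vs p) (subset (vs q)) ys in⁺ in⁻ u)) top-counted) (+-comm _ 1))
      where
      ys = n + 1 ∷ n ∷ names q
      top-counted : count (n ∷ []) ys ≡ 1
      top-counted = cong (λ b → bool b + 0) (dec-true (n ∈? ys) (there (here refl)))
      in⁺ : ∀ x → x ∈ₛ subset (vs q) → toℕ x ∈ ys
      in⁺ x x∈ = there (there (∈-map⁺ toℕ (∈-subset⁻ (vs q) x∈)))
      in⁻ : ∀ x → toℕ x ∈ ys → x ∈ₛ subset (vs q)
      in⁻ x (here e) = contradiction e (v≢n+1 x)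
      in⁻ x (there (here e)) = contradiction e (v≢n x)
      in⁻ x (there (there x∈)) with ∈-map⁻ toℕ x∈
      ... | y , y∈ , e with Fin.toℕ-injective {i = x} {y} e
      ... | refl = ∈-subset⁺ y∈

    module Answers (0<g₁ : 0 < g₁ s₁) (0<g₂ : 0 < g₂ s₂) where

      some-pair : ShortestPair I
      some-pair = let (p , τs) = Π₁.attained-tight s₁ 0<g₁ ; (q , υs) = Π₂.attained-tight s₂ 0<g₂ in
                  Π₁.tight⇒shortest p τs , Π₂.tight⇒shortest q υs

      complete : ∀ {V} → Solved (2 * m + 4) V → (Q : ShortestPair I) →
                 V (toℕ s₁) (n + 2) (n + 2) (toℕ t₂) ≢ 0 × V (toℕ s₁) (n + 2) (n + 2) (toℕ t₂) ≤ 1 + common I Q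
      complete {V} H (P , Q) = proj₁ solved , (begin
          V (toℕ s₁) (n + 2) (n + 2) (toℕ t₂)                        ≤⟨ proj₂ solved ⟩
          count (names p ++ n ∷ []) (n + 2 ∷ n + 1 ∷ n ∷ names q)  ≤⟨ count-mono (names p ++ n ∷ []) drop ⟩
          count (names p ++ n ∷ []) (n + 1 ∷ n ∷ names q)            ≡⟨ common-count p q (ShortestPath.isPath P) ⟩
          1 + common I (P , Q)                                       ∎)
        where
        open ≤-Reasoning
        p = ShortestPath.walk P
        q = ShortestPath.walk Q
        ps = path₁⁺ p (Π₁.shortest⇒tight 0<g₁ P)
        qs = root-path⁺ q (Π₂.shortest⇒tight 0<g₂ Q)
        -- At most m + 1 vertices and `top`, the single bottom vertex, then `root`, `top` and at
        -- most m + 1 vertices: 2 m + 6 in all, hence 2 m + 4 rounds.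
        len : length (names p ++ n ∷ []) + 1 + length (n + 1 ∷ n ∷ names q) ≤ 2 + (2 * m + 4)
        len = begin
          length (names p ++ n ∷ []) + 1 + (2 + length (names q))
            ≡⟨ cong₂ (λ a b → a + 1 + (2 + b)) (trans (length-++ (names p)) (cong (_+ 1) (trans (length-map toℕ (vs p)) (length-vs p))))
                 (trans (length-map toℕ (vs q)) (length-vs q)) ⟩
          suc (size p) + 1 + 1 + (2 + suc (size q))
            ≤⟨ +-mono-≤ (+-monoˡ-≤ 1 (+-monoˡ-≤ 1 (s≤s (size≤m p (ShortestPath.isPath P))))) (s≤s (s≤s (s≤s (size≤m q (ShortestPath.isPath Q))))) ⟩
          suc m + 1 + 1 + (3 + m)
            ≡⟨ solve 1 (λ m → con 1 :+ m :+ con 1 :+ con 1 :+ (con 3 :+ m) := con 2 :+ (con 2 :* m :+ con 4)) refl m ⟩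
          2 + (2 * m + 4) ∎
          where
          open +-*-Solver
        solved = H (inner<N s₁) n+2<N n+2<N (inner<N t₂) ps nil qs
          (subst₂ _<_ (sym F-bottom) (sym (F-vertex t₂)) (s≤s z≤n))
          (λ e → contradiction e (v≢n+1 t₂)) len
        drop : ∀ {x} → x ∈ names p ++ n ∷ [] → x ∈ n + 2 ∷ n + 1 ∷ n ∷ names q → x ∈ n + 1 ∷ n ∷ names q
        drop x∈ (there y) = y
        drop x∈ (here refl) with ∈-++⁻ (names p) x∈
        ... | inj₂ (here e) = contradiction (sym e) (<⇒≢ (m<m+n n (s≤s z≤n)))
        ... | inj₁ x∈′ with ∈-map⁻ toℕ x∈′
        ... | v , _ , e = contradiction (sym e) (<⇒≢ (<-≤-trans (Fin.toℕ<n v) (m≤m+n n 2)))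

      sound : ∀ {b val f₁ f₂} → Realised b val f₁ f₂ (toℕ s₁) (n + 2) (n + 2) (toℕ t₂) →
        Σ[ P ∈ ShortestPair I ] (1 + common I P ≤ val ×
          (b ≡ 1 → Chain f₁ (map toℕ (vertices₁ I P) ++ n ∷ []) × Chain f₂ (n + 1 ∷ n ∷ map toℕ (vertices₂ I P))))
      sound r with path₁⁻ (Realised.path₁ r) s₁ refl refl | root-path⁻ (Realised.path₂ r) refl refl
      ... | p , τs , xs≡ | q , υs , zs≡ =
        (Π₁.tight⇒shortest p τs , Π₂.tight⇒shortest q υs) ,
        ≤-trans (≤-reflexive (sym (common-count p q (Π₁.tight-unique p τs))))
          (≤-trans (≤-reflexive (cong₂ count (sym xs≡) (sym zs≡)))
            (≤-trans (count-mono (Realised.xs r) (λ _ → ∈-++⁺ʳ (Realised.ws r))) (Realised.counted r))) ,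
        λ b≡1 → let (c₁ , _ , c₂) = Realised.chained r b≡1 in subst (Chain _) xs≡ c₁ , subst (Chain _) zs≡ c₂

-- Output of a path

-- Entries 1, 2 and 3 of array 12 hold the start of the current block of the
-- output, the number of vertices written to it, and the vertex to be written next.
emitStep : ℕ → Cmd
emitStep j =
  cond (arr 12 (lit 3) ≐ var 1) nop
    (out (arr 12 (lit 1) ⊕ lit 1 ⊕ arr 12 (lit 2)) (arr 12 (lit 3)) ⨟
     put 12 (lit 2) (arr 12 (lit 2) ⊕ lit 1) ⨟
     put 12 (lit 3) (arr j (var 7 ⊗ var 10 ⊕ arr 12 (lit 3))))

emit : ℕ → ℕ → Cmd
emit j x =
  put 12 (lit 2) (lit 0) ⨟ put 12 (lit 3) (var x) ⨟ iter (var 7) (emitStep j) ⨟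
  -- The length stands in front of the vertices but is known only now; its cell was left free.
  out (arr 12 (lit 1)) (arr 12 (lit 2)) ⨟
  put 12 (lit 1) (arr 12 (lit 1) ⊕ lit 1 ⊕ arr 12 (lit 2))

at-++ : ∀ xs y ys → at (xs ++ y ∷ ys) (length xs) ≡ y
at-++ []       y ys = refl
at-++ (_ ∷ xs) y ys = at-++ xs y ys

chain-uncons : ∀ {f} x r t → Chain f (x ∷ r ++ t ∷ []) → f x ≡ at (r ++ t ∷ []) 0 × Chain f (r ++ t ∷ [])
chain-uncons x []      t (e ∷ c) = e , c
chain-uncons x (y ∷ r) t (e ∷ c) = e , c

module Emit (𝓛 : Layout)
  (ρ : ℕ → ℕ) (j : ℕ) (okj : T (0 <ᵇ j) × T (j <ᵇ 16)) (j≢12 : j ≢ 12) (x : ℕ) (okx : T (x <ᵇ 11))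
  (1≤N : 1 ≤ ρ 7) (N<B : ρ 7 < Layout.B 𝓛) (l : List ℕ) (p : ℕ) (A : Mem)
  (ordinary : All (_≢ ρ 1) l) (chained : Chain (λ i → A j (ρ 7 * ρ 10 + i)) (l ++ ρ 1 ∷ []))
  (starts : ρ x ≡ at (l ++ ρ 1 ∷ []) 0) (x<B : ρ x < Layout.B 𝓛)
  (pos≡ : A 12 1 ≡ p) (fits : p + 1 + length l ≤ Layout.off 𝓛) (short : length l ≤ ρ 7) where

  open Layout 𝓛

  open Machine 𝓛

  private
    n N s : ℕ
    n = ρ 1
    N = ρ 7
    s = ρ 10
    j≢0 : j ≢ 0
    j≢0 refl = proj₁ okj

  record Emitted (A′ : Mem) : Set where
    field
      same    : ∀ k → k ≢ 0 → k ≢ 12 → A′ k ≡ A k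
      before  : ∀ a → a < p → A′ 0 a ≡ A 0 a
      written : ∀ i → i ≤ length l → A′ 0 (p + i) ≡ at (length l ∷ l) i
      pos     : A′ 12 1 ≡ p + 1 + length l

  record Inv (i : ℕ) (A′ : Mem) : Set where
    field
      {done rest} : List ℕ
      split    : done ++ rest ≡ l
      same     : ∀ k → k ≢ 0 → k ≢ 12 → A′ k ≡ A k
      before   : ∀ a → a < p + 1 → A′ 0 a ≡ A 0 a
      written  : ∀ i → i < length done → A′ 0 (p + 1 + i) ≡ at l i
      pos      : A′ 12 1 ≡ p
      cnt      : A′ 12 2 ≡ length done
      cur      : A′ 12 3 ≡ at (rest ++ n ∷ []) 0
      chain    : Chain (λ i → A j (N * s + i)) (rest ++ n ∷ [])
      special  : All (_≢ n) rest
      -- The loop makes `N` passes whatever the length of the path; those after the end marker are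
      -- idle.
      progress : length done ≡ i ⊎ rest ≡ []

  open Inv

  step : ∀ i → i < N → ∀ A′ → Inv i A′ → wp 13 (ρ [ 11 ↦ i ] [ 12 ↦ N ]) (emitStep j) 1 (Inv (suc i)) A′
  step i i<N A′ v@record { rest = [] ; cur = cur } =
    wp-cond ≤-refl _
      (λ _ → wp-nop ≤-refl record
        { done = done v ; rest = [] ; split = split v ; same = same v ; before = before v ; written = written v
        ; pos = pos v ; cnt = cnt v ; cur = cur ; chain = chain v ; special = [] ; progress = inj₂ refl })
      (λ z → contradiction z (bool-≢0 (≡⇒≡ᵇ (A′ 12 3) n cur)))
  step i i<N A′ v@record { done = done ; rest = y ∷ r ; split = split₀ ; same = same ; before = before ; written = written ; pos = pos ; cnt = cnt ; cur = cur ; chain = chain ; special = y≢ ∷ ys≢ ; progress = progress } =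
    wp-bounded _ λ bd →
    wp-cond ≤-refl _
      (λ e → contradiction (trans (sym cur) (≡ᵇ⇒≡ (A′ 12 3) n (bool-true e))) y≢)
      (λ _ → wp-seq _ _ (wp-out ≤-refl _ _ address<off (bd 12 3)
        (wp-seq _ _ (wp-put ≤-refl _ _ cnt<B
          (wp-bounded _ λ bd′ → wp-put {ok = _} {_ , _ , okj} ≤-refl _ _ (bd′ j (N * s + A′ 12 3)) next)))))
    where
    f = λ i → A j (N * s + i)
    len : suc (length done + length r) ≡ length l
    len = trans (sym (+-suc (length done) (length r))) (trans (sym (length-++ done)) (cong length split₀))
    done<l : length done < length l
    done<l = ≤-trans (s≤s (m≤m+n (length done) (length r))) (≤-reflexive len)
    address≡ : A′ 12 1 + 1 + A′ 12 2 ≡ p + 1 + length done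
    address≡ = cong₂ (λ a b → a + 1 + b) pos cnt
    address<off : A′ 12 1 + 1 + A′ 12 2 < off
    address<off = ≤-trans (s≤s (≤-reflexive address≡)) (≤-trans (+-monoʳ-< (p + 1) done<l) fits)
    cnt<B : A′ 12 2 + 1 < B
    cnt<B = ≤-<-trans (≤-trans (≤-reflexive (trans (cong (_+ 1) cnt) (+-comm _ 1))) (≤-trans done<l short)) N<B
    a : ℕ
    a = A′ 12 1 + 1 + A′ 12 2
    A₁ A₂ A₃ : Mem
    A₁ = upd A′ 0 a (A′ 12 3)
    A₂ = upd A₁ 12 2 (A′ 12 2 + 1)
    A₃ = upd A₂ 12 3 (A₂ j (N * s + A′ 12 3))
    other : ∀ k → k ≢ 0 → k ≢ 12 → A₃ k ≡ A′ k
    other k k≢0 k≢12 = trans (Upd-other-array A₂ {12} {3} _ k≢12)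
      (trans (Upd-other-array A₁ {12} {2} _ k≢12) (Upd-other-array A′ {0} {a} _ k≢0))
    next : Inv (suc i) A₃
    next = record
      { done = done ++ y ∷ [] ; rest = r
      ; split = trans (++-assoc done (y ∷ []) r) split₀
      ; same = λ k k≢0 k≢12 → trans (other k k≢0 k≢12) (same k k≢0 k≢12)
      ; before = λ b b< → trans (upd-below (A′ 0) (A′ 12 3) (<-≤-trans b< (≤-trans (m≤m+n (p + 1) _) (≤-reflexive (sym address≡))))) (before b b<)
      ; written = wr
      ; pos = pos
      ; cnt = trans (cong (_+ 1) cnt) (sym (length-++ done))
      ; cur = trans (cong (λ g → g (N * s + A′ 12 3)) (trans (Upd-other-array A₁ {12} {2} _ j≢12)
                (trans (Upd-other-array A′ {0} {a} _ j≢0) (same j j≢0 j≢12))))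
                (trans (cong f cur) (proj₁ (chain-uncons y r n chain)))
      ; chain = proj₂ (chain-uncons y r n chain)
      ; special = ys≢
      ; progress = prog progress }
      where
      prog : length done ≡ i ⊎ y ∷ r ≡ [] → length (done ++ y ∷ []) ≡ suc i ⊎ r ≡ []
      prog (inj₁ e) = inj₁ (trans (length-++ done) (trans (+-comm _ 1) (cong suc e)))
      wr : ∀ i → i < length (done ++ y ∷ []) → A₃ 0 (p + 1 + i) ≡ at l i
      wr i i< with m≤n⇒m<n∨m≡n (≤-pred (≤-trans i< (≤-reflexive (trans (length-++ done) (+-comm _ 1)))))
      ... | inj₁ i<done = trans (upd-below (A′ 0) (A′ 12 3)
              (<-≤-trans (+-monoʳ-< (p + 1) i<done) (≤-reflexive (sym address≡)))) (written i i<done)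
      ... | inj₂ refl = trans (cong (λ b → (A′ 0 [ a ↦ A′ 12 3 ]) b) (sym address≡))
              (trans (upd-same (A′ 0) a (A′ 12 3)) (trans cur (trans (sym (at-++ done y r)) (cong (λ q → at q (length done)) split₀))))

  emit-correct : wp 11 ρ (emit j x) (N * 1) Emitted A
  emit-correct =
    wp-seq _ _ (wp-put 1≤X _ _ (≤-<-trans z≤n N<B)
      (wp-seq _ _ (wp-put {ok = _} {okx} 1≤X _ _ x<B
        (wp-seq _ _ (wp-iter Inv N N ≤-refl 1≤N ≤-refl _ refl N<B start step finish)))))
    where
    1≤X : 1 ≤ N * 1
    1≤X = *-mono-≤ 1≤N (≤-refl {1})
    A₁ A₂ : Mem
    A₁ = upd A 12 2 0
    A₂ = upd A₁ 12 3 (ρ x)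
    start : Inv 0 A₂
    start = record
      { done = [] ; rest = l ; split = refl
      ; same = λ k _ k≢12 → trans (Upd-other-array A₁ {12} {3} _ k≢12) (Upd-other-array A {12} {2} _ k≢12)
      ; before = λ _ _ → refl ; written = λ _ () ; pos = pos≡ ; cnt = refl ; cur = starts
      ; chain = chained ; special = ordinary ; progress = inj₁ refl }
    finish : ∀ A′ → Inv N A′ →
      wp 11 ρ (out (arr 12 (lit 1)) (arr 12 (lit 2)) ⨟ put 12 (lit 1) (arr 12 (lit 1) ⊕ lit 1 ⊕ arr 12 (lit 2))) (N * 1) Emitted A′
    finish A′ v = wp-bounded _ λ bd →
      wp-seq _ _ (wp-out 1≤X _ _ (≤-<-trans (≤-reflexive (pos v)) p<off) (bd 12 2)
        (wp-put 1≤X _ _ (≤-<-trans (≤-reflexive end≡) (≤-<-trans fits off<B)) emitted))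
      where
      p<off : p < off
      p<off = ≤-trans (≤-trans (≤-reflexive (+-comm 1 p)) (m≤m+n (p + 1) (length l))) fits
      complete : ∀ r → done v ++ r ≡ l → length (done v) ≡ N ⊎ r ≡ [] → r ≡ []
      complete _       _  (inj₂ e) = e
      complete []      _  (inj₁ e) = refl
      complete (y ∷ r) sp (inj₁ e) = contradiction short (<⇒≱ (begin-strict
            N                                 ≡⟨ sym e ⟩
            length (done v)                   <⟨ m<m+n (length (done v)) (s≤s z≤n) ⟩
            length (done v) + suc (length r)  ≡⟨ sym (length-++ (done v)) ⟩
            length (done v ++ y ∷ r)          ≡⟨ cong length sp ⟩
            length l                          ∎))
        where open ≤-Reasoning
      done≡ : done v ≡ l
      done≡ = trans (sym (++-identityʳ (done v))) (trans (cong (done v ++_) (sym (complete (rest v) (split v) (progress v)))) (split v))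
      cnt≡ : A′ 12 2 ≡ length l
      cnt≡ = trans (cnt v) (cong length done≡)
      end≡ : A′ 12 1 + 1 + A′ 12 2 ≡ p + 1 + length l
      end≡ = cong₂ (λ a b → a + 1 + b) (pos v) cnt≡
      A₃ : Mem
      A₃ = upd (upd A′ 0 (A′ 12 1) (A′ 12 2)) 12 1 (A′ 12 1 + 1 + A′ 12 2)
      low : ∀ a → a ≢ p → A₃ 0 a ≡ A′ 0 a
      low a a≢p = upd-other (A′ 0) (A′ 12 2) (λ e → a≢p (trans e (pos v)))
      emitted : Emitted A₃
      emitted = record
        { same = λ k k≢0 k≢12 → trans (Upd-other-array (upd A′ 0 (A′ 12 1) (A′ 12 2)) {12} {1} _ k≢12)
            (trans (Upd-other-array A′ {0} {A′ 12 1} _ k≢0) (same v k k≢0 k≢12))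
        ; before = λ a a<p → trans (low a (<⇒≢ a<p)) (before v a (<-≤-trans a<p (m≤m+n p 1)))
        ; written = wr
        ; pos = end≡ }
        where
        wr : ∀ i → i ≤ length l → A₃ 0 (p + i) ≡ at (length l ∷ l) i
        wr zero    _  = trans (cong (λ a → (A′ 0 [ A′ 12 1 ↦ A′ 12 2 ]) a) (trans (+-identityʳ p) (sym (pos v))))
                          (trans (upd-same (A′ 0) (A′ 12 1) _) cnt≡)
        wr (suc i) i< = trans (low (p + suc i) (λ e → m≢1+m+n p (trans (sym e) (+-suc p i))))
                          (trans (cong (A′ 0) (sym (+-assoc p 1 i))) (written v i (subst (λ q → i < length q) (sym done≡) i<)))

-- The complete program and its correctness

tightE : ℕ → Exp
tightE j = arr j (arr 6 (var 10)) ≐ arr j (arr 5 (var 10)) ⊕ weightE (var 10)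

networkArrays : Cmd
networkArrays =
  fill 3 (var 1) (lit 1 ⊕ arr 1 (var 10) ⊕ (var 9 ⊖ arr 2 (var 10))) (lit 2 ⊗ var 9 ⊕ lit 2) (lit 2 ⊗ var 9 ⊕ lit 3) (lit 0) ⨟
  fill 4 (var 1) (arr 3 (var 10) ⊗ (var 9 ⊕ lit 1) ⊕ arr 1 (var 10))
    (arr 3 (var 1) ⊗ (var 9 ⊕ lit 1)) (arr 3 (var 1 ⊕ lit 1) ⊗ (var 9 ⊕ lit 1)) (lit 0) ⨟
  fill 5 (var 2) (sourceE (var 10)) (var 4) (var 1) (var 1 ⊕ lit 1) ⨟
  fill 6 (var 2) (targetE (var 10)) (var 1) (var 5) (var 1) ⨟
  fill 7 (var 2) (tightE 1) (lit 1) (lit 0) (lit 0) ⨟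
  fill 8 (var 2) (tightE 2) (lit 0) (lit 1) (lit 1)

startE : Exp
startE = indexE (var 3) (var 1 ⊕ lit 2) (var 1 ⊕ lit 2) (var 6)

search : Cmd → Cmd
search finish =
  weightSum ⨟ bind (var 2 ⊗ arr 12 (lit 0) ⊕ lit 1)
    (bellmanFord 1 4 ⨟ bellmanFord 2 6 ⨟ networkArrays ⨟ dp ⨟ finish)

solver : ℕ → Cmd → Cmd → Cmd
solver b finish trivial =
  bind (inp (lit 0)) (bind (inp (lit 1)) (bind (inp (lit 2)) (bind (inp (lit 3)) (bind (inp (lit 4)) (bind (inp (lit 5))
  (bind (var 1 ⊕ lit 3) (bind (lit b)
  -- Without arcs the time bound is a constant, so not even a loop over the vertices is affordable.
  (cond (var 2) (search finish) trivial))))))))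

record Initial {n m} (I : Instance n m) (A : Mem) : Set where
  open Instance I
  open Digraph graph
  field
    in-n  : A 0 0 ≡ n
    in-m  : A 0 1 ≡ m
    in-s₁ : A 0 2 ≡ toℕ s₁
    in-t₁ : A 0 3 ≡ toℕ t₁
    in-s₂ : A 0 4 ≡ toℕ s₂
    in-t₂ : A 0 5 ≡ toℕ t₂
    in-source : ∀ e → A 0 (6 + 3 * toℕ e) ≡ toℕ (src e)
    in-target : ∀ e → A 0 (7 + 3 * toℕ e) ≡ toℕ (tgt e)
    in-weight : ∀ e → A 0 (8 + 3 * toℕ e) ≡ weight e
    zeros : ∀ j i → j ≢ 0 → A j i ≡ 0

env : (off n m s₁ t₁ s₂ t₂ b : ℕ) → ℕ → ℕ
env off n m s₁ t₁ s₂ t₂ b =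
  (λ _ → off) [ 1 ↦ n ] [ 2 ↦ m ] [ 3 ↦ s₁ ] [ 4 ↦ t₁ ] [ 5 ↦ s₂ ] [ 6 ↦ t₂ ] [ 7 ↦ n + 3 ] [ 8 ↦ b ]

record Bounds (𝓛 : Layout) {n m : ℕ} (I : Instance n m) : Set where
  open Layout 𝓛
  field
    W L        : ℕ
    weight≤W   : ∀ e → Digraph.weight (Instance.graph I) e ≤ W
    input<off  : 9 + 3 * m < off
    output≤off : 2 + 2 * n ≤ off
    mmW<L      : m * (m * W) + 1 ≤ L
    -- `L` bounds `big`. The highest level is 2 big + 3, and `K` scales levels by big + 1.
    LL<B       : 1 + (2 * L + 3) * (L + 1) < B
    mW<B       : m * W < B
    N⁴<B       : (n + 3) * ((n + 3) * ((n + 3) * (n + 3))) < B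
    rounds<B   : 2 * m + 4 < B

module Solve (𝓛 : Layout) {n m : ℕ} (I : Instance n m) (bounds : Bounds 𝓛 I) (b : ℕ) (b≤1 : b ≤ 1) where

  open Bounds bounds
  open Layout 𝓛

  open Machine 𝓛
  open Instance I
  open Digraph graph
  open Graph graph
  open Fill 𝓛

  ρ₈ : ℕ → ℕ
  ρ₈ = env off n m (toℕ s₁) (toℕ t₁) (toℕ s₂) (toℕ t₂) b

  start : ℕ
  start = index (n + 3) (toℕ s₁) (n + 2) (n + 2) (toℕ t₂)

  Outcome : Mem → Set
  Outcome A = Σ[ P ∈ ShortestPair I ] (Optimal I P × A 9 start ≡ 1 + common I P ×
    (b ≡ 1 → Chain (λ i → A 10 ((n + 3) * start + i)) (map toℕ (vertices₁ I P) ++ n ∷ []) ×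
             Chain (λ i → A 11 ((n + 3) * start + i)) (n + 1 ∷ n ∷ map toℕ (vertices₂ I P))))

  n≥1 : 1 ≤ n
  n≥1 = ≤-trans (s≤s z≤n) (Fin.toℕ<n s₁)

  N<B : n + 3 < B
  N<B = ≤-<-trans (≤-trans (m≤m*n _ _ ⦃ nz ⦄) (≤-trans (m≤n*m _ (n + 3) ⦃ nz ⦄) (m≤n*m _ (n + 3) ⦃ nz ⦄))) N⁴<B
    where
    nz : NonZero (n + 3)
    nz = >-nonZero (≤-trans (s≤s z≤n) (m≤n+m 3 n))

  m+3<B : m + 3 < B
  m+3<B = ≤-<-trans (+-mono-≤ (m≤n*m m 2) (n≤1+n 3)) rounds<B

  vertex<B : ∀ (v : Fin n) → toℕ v < B
  vertex<B v = <-trans (<-≤-trans (Fin.toℕ<n v) (m≤m+n n 3)) N<B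

  n<B : n < B
  n<B = ≤-<-trans (m≤m+n n 3) N<B

  header<off : ∀ k → k ≤ 9 → k < off
  header<off k k≤9 = ≤-<-trans (≤-trans k≤9 (m≤m+n 9 (3 * m))) input<off

  solver-correct : ∀ {A Q X finish trivial} → Initial I A → 1 ≤ X →
    (1 ≤ m → wp 9 ρ₈ (search finish) X Q A) → (m ≡ 0 → wp 9 ρ₈ trivial X Q A) →
    wp 1 (λ _ → off) (solver b finish trivial) X Q A
  solver-correct init 1≤X h h₀ =
    wp-bind n 1≤X (_ , header<off 0 z≤n) in-n n<B
    (wp-bind m 1≤X (_ , header<off 1 (s≤s z≤n)) in-m (≤-<-trans (m≤m+n m 3) m+3<B)
    (wp-bind (toℕ s₁) 1≤X (_ , header<off 2 (m≤m+n 2 7)) in-s₁ (vertex<B s₁)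
    (wp-bind (toℕ t₁) 1≤X (_ , header<off 3 (m≤m+n 3 6)) in-t₁ (vertex<B t₁)
    (wp-bind (toℕ s₂) 1≤X (_ , header<off 4 (m≤m+n 4 5)) in-s₂ (vertex<B s₂)
    (wp-bind (toℕ t₂) 1≤X (_ , header<off 5 (m≤m+n 5 4)) in-t₂ (vertex<B t₂)
    (wp-bind (n + 3) 1≤X _ refl N<B
    (wp-bind {ok = <⇒<ᵇ (s≤s (≤-trans b≤1 (s≤s z≤n)))} b 1≤X _ refl (≤-<-trans b≤1 (bool<B true))
    (wp-cond 1≤X _ (λ m≢0 → h (n≢0⇒n>0 m≢0)) h₀))))))))
    where open Initial init

  dpTime : ℕ
  dpTime = (2 * m + 4) * ((m + 3) * ((n + 3) * ((n + 3) * ((n + 3) * (suc (b * (n + 3)) * 1)))))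

  N≤dpTime : n + 3 ≤ dpTime
  N≤dpTime = ≤-trans (≤-reflexive (sym (*-identityʳ (n + 3))))
    (≤-trans (*-monoʳ-≤ (n + 3) (*-mono-≤ 1≤N (*-mono-≤ 1≤N (s≤s {0} {b * (n + 3) * 1} z≤n))))
      (≤-trans (m≤n*m _ (m + 3) ⦃ >-nonZero (≤-trans (s≤s z≤n) (m≤n+m 3 m)) ⦄)
        (m≤n*m _ (2 * m + 4) ⦃ >-nonZero (≤-trans (s≤s z≤n) (m≤n+m 4 (2 * m))) ⦄)))
    where
    1≤N : 1 ≤ n + 3
    1≤N = ≤-trans (s≤s z≤n) (m≤n+m 3 n)

  module Nontrivial (1≤m : 1 ≤ m) where

    open Preprocess 𝓛 graph 1≤m input<off W weight≤W mW<B m+3<B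

    module Arrange (big : ℕ) (big≤L : big ≤ L) (A₀ A₃ : Mem) (init : Initial I A₀) (same₀ : A₃ 0 ≡ A₀ 0)
      (zero₉ : ∀ i → A₃ 9 i ≡ 0)
      (π₁ : Potential big t₁ (λ v → A₃ 1 (toℕ v))) (π₂ : Potential big t₂ (λ v → A₃ 2 (toℕ v))) where

      open Initial init
      private
        module π₁ = Potential π₁
        module π₂ = Potential π₂

      ρ : ℕ → ℕ
      ρ = ρ₈ [ 9 ↦ big ]

      g₁≤ : ∀ i → i < n → A₃ 1 i ≤ big
      g₁≤ i i<n = subst (λ k → A₃ 1 k ≤ big) (Fin.toℕ-fromℕ< i<n) (π₁.g≤top (fromℕ< i<n))

      D<B : 1 + (2 * big + 3) * (big + 1) < B
      D<B = ≤-<-trans (s≤s (*-mono-≤ (+-monoˡ-≤ 3 (*-monoʳ-≤ 2 big≤L)) (+-monoˡ-≤ 1 big≤L))) LL<B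

      2big+3<B : 2 * big + 3 < B
      2big+3<B = ≤-<-trans (≤-trans (m≤m*n (2 * big + 3) (big + 1) ⦃ >-nonZero (m≤n+m 1 big) ⦄) (n≤1+n _)) D<B

      φ₃≤ : ∀ i → i < n → 1 + A₃ 1 i + (big ∸ A₃ 2 i) ≤ 2 * big + 1
      φ₃≤ i i<n = ≤-trans (+-mono-≤ (s≤s (g₁≤ i i<n)) (m∸n≤m big (A₃ 2 i)))
        (≤-reflexive (trans (cong (λ k → 1 + (big + k)) (sym (+-identityʳ big))) (+-comm 1 (2 * big))))

      scaled<B : ∀ {k} → k ≤ 2 * big + 3 → k * (big + 1) < B
      scaled<B d = ≤-<-trans (≤-trans (*-monoˡ-≤ (big + 1) d) (n≤1+n _)) D<B

      φ₄<B : ∀ {k g} → k ≤ 2 * big + 1 → g ≤ big → k * (big + 1) + g < B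
      φ₄<B {k} {g} k≤ g≤ = ≤-<-trans (begin
          k * (big + 1) + g                     ≤⟨ +-mono-≤ (*-monoˡ-≤ (big + 1) k≤) (≤-trans g≤ (m≤m+n big 1)) ⟩
          (2 * big + 1) * (big + 1) + (big + 1) ≡⟨ +-comm ((2 * big + 1) * (big + 1)) (big + 1) ⟩
          (1 + (2 * big + 1)) * (big + 1)       ≡⟨ cong (_* (big + 1)) (sym (+-suc (2 * big) 1)) ⟩
          (2 * big + 2) * (big + 1)             ∎)
          (scaled<B (+-monoʳ-≤ (2 * big) (n≤1+n 2)))
        where open ≤-Reasoning

      φ₃ : ℕ → ℕ
      φ₃ i = 1 + A₃ 1 i + (big ∸ A₃ 2 i)

      φ₄ : Mem → ℕ → ℕ
      φ₄ A i = A 3 i * (big + 1) + A₃ 1 i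

      tight : ℕ → Mem → ℕ → ℕ
      tight j A i = bool (A₃ j (A 6 i) ≡ᵇ A₃ j (A 5 i) + A₀ 0 (8 + 3 * i))

      Ready : Mem → Set
      Ready A = Build.Arrays I big (λ v → A₃ 1 (toℕ v)) (λ v → A₃ 2 (toℕ v)) π₁ π₂
                  (A 3) (A 4) (A 5) (A 6) (A 7) (A 8) × (∀ i → A 9 i ≡ 0)

      end<B : ∀ k {end : Fin m → Fin n} → (∀ e → A₀ 0 (k + 3 * toℕ e) ≡ toℕ (end e)) → ∀ i → i < m → A₀ 0 (k + 3 * i) < B
      end<B k {end} entry i i<m = subst (_< B) (trans (sym (entry (fromℕ< i<m)))
        (cong (λ x → A₀ 0 (k + 3 * x)) (Fin.toℕ-fromℕ< i<m))) (vertex<B (end (fromℕ< i<m)))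

      module _ {A₄ A₅ A₆ A₇ A₈ A₉ : Mem}
        (r₃ : Filled 3 n φ₃ (2 * big + 2) (2 * big + 3) 0 A₃ A₄)
        (r₄ : Filled 4 n (φ₄ A₄) (A₄ 3 n * (big + 1)) (A₄ 3 (n + 1) * (big + 1)) 0 A₄ A₅)
        (r₅ : Filled 5 m (λ i → A₀ 0 (6 + 3 * i)) (toℕ t₁) n (n + 1) A₅ A₆)
        (r₆ : Filled 6 m (λ i → A₀ 0 (7 + 3 * i)) n (toℕ s₂) n A₆ A₇)
        (r₇ : Filled 7 m (tight 1 A₇) 1 0 0 A₇ A₈)
        (r₈ : Filled 8 m (tight 2 A₇) 0 1 1 A₈ A₉) where

        open Filled

        same₃ : A₉ 3 ≡ A₄ 3
        same₃ = trans (agree r₈ 3 λ ()) (trans (agree r₇ 3 λ ()) (trans (agree r₆ 3 λ ()) (trans (agree r₅ 3 λ ()) (agree r₄ 3 λ ()))))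
        same₄ : A₉ 4 ≡ A₅ 4
        same₄ = trans (agree r₈ 4 λ ()) (trans (agree r₇ 4 λ ()) (trans (agree r₆ 4 λ ()) (agree r₅ 4 λ ())))
        same₅ : A₉ 5 ≡ A₆ 5
        same₅ = trans (agree r₈ 5 λ ()) (trans (agree r₇ 5 λ ()) (agree r₆ 5 λ ()))
        same₆ : A₉ 6 ≡ A₇ 6
        same₆ = trans (agree r₈ 6 λ ()) (agree r₇ 6 λ ())
        same₇ : A₉ 7 ≡ A₈ 7
        same₇ = agree r₈ 7 λ ()
        same₉ : A₉ 9 ≡ A₃ 9
        same₉ = trans (agree r₈ 9 λ ()) (trans (agree r₇ 9 λ ()) (trans (agree r₆ 9 λ ()) (trans (agree r₅ 9 λ ()) (trans (agree r₄ 9 λ ()) (agree r₃ 9 λ ())))))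

        read : ∀ {f g : ℕ → ℕ} {i v} → f ≡ g → g i ≡ v → f i ≡ v
        read refl e = e

        from-entry : ∀ e → A₆ 5 (toℕ e) ≡ toℕ (src e)
        from-entry e = trans (entries r₅ (toℕ e) (Fin.toℕ<n e)) (in-source e)

        to-entry : ∀ e → A₇ 6 (toℕ e) ≡ toℕ (tgt e)
        to-entry e = trans (entries r₆ (toℕ e) (Fin.toℕ<n e)) (in-target e)

        tight-entry : ∀ j e → tight j A₇ (toℕ e) ≡ bool (A₃ j (toℕ (tgt e)) ≡ᵇ A₃ j (toℕ (src e)) + weight e)
        tight-entry j e = trans
          (cong₂ (λ x y → bool (A₃ j x ≡ᵇ A₃ j y + A₀ 0 (8 + 3 * toℕ e))) (to-entry e) (trans (cong (λ f → f (toℕ e)) (agree r₆ 5 λ ())) (from-entry e)))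
          (cong (λ x → bool (A₃ j (toℕ (tgt e)) ≡ᵇ A₃ j (toℕ (src e)) + x)) (in-weight e))

        ready : Ready A₉
        ready = record
          { F-vertex = λ v → read same₃ (entries r₃ (toℕ v) (Fin.toℕ<n v))
          ; F-top    = read same₃ (entry₀ r₃)
          ; F-root   = read same₃ (entry₁ r₃)
          ; F-bottom = read same₃ (entry₂ r₃)
          ; K-vertex = λ v → read same₄ (trans (entries r₄ (toℕ v) (Fin.toℕ<n v)) (cong (λ x → x * (big + 1) + A₃ 1 (toℕ v)) (cong (λ f → f (toℕ v)) (sym same₃))))
          ; K-top    = read same₄ (trans (entry₀ r₄) (cong (λ f → f n * (big + 1)) (sym same₃)))
          ; K-root   = read same₄ (trans (entry₁ r₄) (cong (λ f → f (n + 1) * (big + 1)) (sym same₃)))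
          ; K-bottom = read same₄ (entry₂ r₄)
          ; from-arc = λ e → read same₅ (from-entry e)
          ; from-0   = read same₅ (entry₀ r₅)
          ; from-1   = read same₅ (entry₁ r₅)
          ; from-2   = read same₅ (entry₂ r₅)
          ; to-arc   = λ e → read same₆ (to-entry e)
          ; to-0     = read same₆ (entry₀ r₆)
          ; to-1     = read same₆ (entry₁ r₆)
          ; to-2     = read same₆ (entry₂ r₆)
          ; o₁-arc   = λ e → read same₇ (trans (entries r₇ (toℕ e) (Fin.toℕ<n e)) (tight-entry 1 e))
          ; o₁-0     = read same₇ (entry₀ r₇)
          ; o₁-1     = read same₇ (entry₁ r₇)
          ; o₁-2     = read same₇ (entry₂ r₇)
          ; o₂-arc   = λ e → trans (entries r₈ (toℕ e) (Fin.toℕ<n e)) (tight-entry 2 e)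
          ; o₂-0     = entry₀ r₈
          ; o₂-1     = entry₁ r₈
          ; o₂-2     = entry₂ r₈ } ,
          λ i → read same₉ (zero₉ i)

      open Filled

      0<B : 0 < B
      0<B = bool<B false
      1<B : 1 < B
      1<B = bool<B true

      arrays-correct : ∀ {X} → n ≤ X → m ≤ X → wp 10 ρ networkArrays X Ready A₃
      arrays-correct {X} n≤X m≤X =
        wp-seq _ _ (wp-mono _ ≤-refl step₃ (fill-correct n φ₃ (2 * big + 2) (2 * big + 3) 0 n<B n≥1 n≤X (λ _ _ → _ , refl)
          (λ A ag i i<n → _ , cong₂ (λ f g → 1 + f i + (big ∸ g i)) (ag 1 λ ()) (ag 2 λ ()) ,
             ≤-<-trans (φ₃≤ i i<n) (≤-<-trans (+-monoʳ-≤ (2 * big) (s≤s z≤n)) 2big+3<B))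
          (λ _ _ → _ , refl , ≤-<-trans (+-monoʳ-≤ (2 * big) (n≤1+n 2)) 2big+3<B)
          (λ _ _ → _ , refl , 2big+3<B)
          (λ _ _ → _ , refl , 0<B)))
        where
        step₃ : ∀ A₄ → Filled 3 n φ₃ (2 * big + 2) (2 * big + 3) 0 A₃ A₄ → wp 10 ρ _ X Ready A₄
        step₃ A₄ r₃ = wp-seq _ _ (wp-mono _ ≤-refl step₄ (fill-correct n (φ₄ A₄) (A₄ 3 n * (big + 1)) (A₄ 3 (n + 1) * (big + 1)) 0
            n<B n≥1 n≤X (λ _ _ → _ , refl)
            (λ A ag i i<n → _ , cong₂ (λ f g → f i * (big + 1) + g i) (ag 3 λ ()) (trans (ag 1 λ ()) (agree r₃ 1 λ ())) ,
               φ₄<B (≤-trans (≤-reflexive (entries r₃ i i<n)) (φ₃≤ i i<n)) (g₁≤ i i<n))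
            (λ A ag → _ , cong (λ f → f n * (big + 1)) (ag 3 λ ()) ,
               scaled<B (≤-trans (≤-reflexive (entry₀ r₃)) (+-monoʳ-≤ (2 * big) (n≤1+n 2))))
            (λ A ag → _ , cong (λ f → f (n + 1) * (big + 1)) (ag 3 λ ()) , scaled<B (≤-reflexive (entry₁ r₃)))
            (λ _ _ → _ , refl , 0<B)))
          where
          step₄ : ∀ A₅ → Filled 4 n (φ₄ A₄) (A₄ 3 n * (big + 1)) (A₄ 3 (n + 1) * (big + 1)) 0 A₄ A₅ → wp 10 ρ _ X Ready A₅
          step₄ A₅ r₄ = wp-seq _ _ (wp-mono _ ≤-refl step₅ (fill-correct m (λ i → A₀ 0 (6 + 3 * i)) (toℕ t₁) n (n + 1)
              (≤-<-trans (m≤m+n m 3) m+3<B) 1≤m m≤X (λ _ _ → _ , refl)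
              (λ A ag i i<m → (_ , in-input {6} (m≤m+n 7 2) i<m) , cong (λ f → f (6 + 3 * i)) (trans (ag 0 λ ()) (trans (agree r₄ 0 λ ()) (trans (agree r₃ 0 λ ()) same₀))) , end<B 6 in-source i i<m)
              (λ _ _ → _ , refl , vertex<B t₁)
              (λ _ _ → _ , refl , n<B)
              (λ _ _ → _ , refl , ≤-<-trans (+-monoʳ-≤ n (s≤s z≤n)) N<B)))
            where
            step₅ : ∀ A₆ → Filled 5 m (λ i → A₀ 0 (6 + 3 * i)) (toℕ t₁) n (n + 1) A₅ A₆ → wp 10 ρ _ X Ready A₆
            step₅ A₆ r₅ = wp-seq _ _ (wp-mono _ ≤-refl step₆ (fill-correct m (λ i → A₀ 0 (7 + 3 * i)) n (toℕ s₂) n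
                (≤-<-trans (m≤m+n m 3) m+3<B) 1≤m m≤X (λ _ _ → _ , refl)
                (λ A ag i i<m → (_ , in-input {7} (m≤m+n 8 1) i<m) , cong (λ f → f (7 + 3 * i)) (trans (ag 0 λ ()) (trans (agree r₅ 0 λ ()) (trans (agree r₄ 0 λ ()) (trans (agree r₃ 0 λ ()) same₀)))) , end<B 7 in-target i i<m)
                (λ _ _ → _ , refl , n<B)
                (λ _ _ → _ , refl , vertex<B s₂)
                (λ _ _ → _ , refl , n<B)))
              where
              step₆ : ∀ A₇ → Filled 6 m (λ i → A₀ 0 (7 + 3 * i)) n (toℕ s₂) n A₆ A₇ → wp 10 ρ _ X Ready A₇
              step₆ A₇ r₆ = wp-seq _ _ (wp-mono _ ≤-refl step₇ (fill-correct m (tight 1 A₇) 1 0 0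
                  (≤-<-trans (m≤m+n m 3) m+3<B) 1≤m m≤X (λ _ _ → _ , refl)
                  (λ A ag i i<m → (_ , _ , _ , in-input {8} ≤-refl i<m) ,
                     cong₄ (λ f g h k → bool (f (g i) ≡ᵇ f (h i) + k (8 + 3 * i)))
                       (trans (ag 1 λ ()) (trans (agree r₆ 1 λ ()) (trans (agree r₅ 1 λ ()) (trans (agree r₄ 1 λ ()) (agree r₃ 1 λ ())))))
                       (ag 6 λ ()) (ag 5 λ ()) (trans (ag 0 λ ()) same₀₇) , bool<B _)
                  (λ _ _ → _ , refl , 1<B)
                  (λ _ _ → _ , refl , 0<B)
                  (λ _ _ → _ , refl , 0<B)))
                where
                cong₄ : ∀ (Φ : (f g h k : ℕ → ℕ) → ℕ) {f f′ g g′ h h′ k k′} → f ≡ f′ → g ≡ g′ → h ≡ h′ → k ≡ k′ → Φ f g h k ≡ Φ f′ g′ h′ k′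
                cong₄ Φ refl refl refl refl = refl
                same₀₇ : A₇ 0 ≡ A₀ 0
                same₀₇ = trans (agree r₆ 0 λ ()) (trans (agree r₅ 0 λ ()) (trans (agree r₄ 0 λ ()) (trans (agree r₃ 0 λ ()) same₀)))
                step₇ : ∀ A₈ → Filled 7 m (tight 1 A₇) 1 0 0 A₇ A₈ → wp 10 ρ (fill 8 (var 2) (tightE 2) (lit 0) (lit 1) (lit 1)) X Ready A₈
                step₇ A₈ r₇ = wp-mono _ ≤-refl (λ A₉ r₈ → ready r₃ r₄ r₅ r₆ r₇ r₈) (fill-correct m (tight 2 A₇) 0 1 1
                    (≤-<-trans (m≤m+n m 3) m+3<B) 1≤m m≤X (λ _ _ → _ , refl)
                    (λ A ag i i<m → (_ , _ , _ , in-input {8} ≤-refl i<m) ,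
                       cong₄ (λ f g h k → bool (f (g i) ≡ᵇ f (h i) + k (8 + 3 * i)))
                         (trans (ag 2 λ ()) (trans (agree r₇ 2 λ ()) (trans (agree r₆ 2 λ ()) (trans (agree r₅ 2 λ ()) (trans (agree r₄ 2 λ ()) (agree r₃ 2 λ ()))))))
                         (trans (ag 6 λ ()) (agree r₇ 6 λ ())) (trans (ag 5 λ ()) (agree r₇ 5 λ ())) (trans (ag 0 λ ()) (trans (agree r₇ 0 λ ()) same₀₇)) , bool<B _)
                    (λ _ _ → _ , refl , 0<B)
                    (λ _ _ → _ , refl , 1<B)
                    (λ _ _ → _ , refl , 1<B))

    search-correct : ∀ {A Q X finish} → Initial I A → dpTime ≤ X →
      (∀ big A′ → Outcome A′ → wp 10 (ρ₈ [ 9 ↦ big ]) finish X Q A′) →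
      wp 9 ρ₈ (search finish) X Q A
    search-correct {A} {Q} {X} {finish} init dp≤X after =
      wp-seq _ _ (wp-mono _ (≤-trans m≤sweep sweep≤X) summed (WeightSum.weightSum-correct ρ₈ refl A input (zeros 12 0 λ ())))
      where
      open Initial init
      1≤inner : 1 ≤ (n + 3) * ((n + 3) * ((n + 3) * (suc (b * (n + 3)) * 1)))
      1≤inner = *-mono-≤ 1≤N (*-mono-≤ 1≤N (*-mono-≤ 1≤N (s≤s z≤n)))
        where 1≤N = ≤-trans (s≤s z≤n) (m≤n+m 3 n)
      sweep≤X : (m + 1) * (m * 1) ≤ X
      -- The m (m + 1) relaxations of Bellman-Ford are covered by the factors 2 m + 4 and m + 3 of
      -- the dynamic program.
      sweep≤X = ≤-trans (*-mono-≤ (≤-trans (+-mono-≤ (m≤n*m m 2) (s≤s z≤n)) (≤-refl {2 * m + 4})) (*-mono-≤ (m≤m+n m 3) 1≤inner)) dp≤X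
      m≤sweep : m * 1 ≤ (m + 1) * (m * 1)
      m≤sweep = m≤n*m (m * 1) (m + 1) ⦃ >-nonZero (m≤n+m 1 m) ⦄
      m≤X : m ≤ X
      m≤X = ≤-trans (≤-reflexive (sym (*-identityʳ m))) (≤-trans m≤sweep sweep≤X)
      1≤X : 1 ≤ X
      1≤X = ≤-trans 1≤m m≤X
      n≤X : n ≤ X
      n≤X = ≤-trans (m≤m+n n 3) (≤-trans N≤dpTime dp≤X)
      input : Input A
      input = record { source = in-source ; target = in-target ; cost = in-weight }

      summed : ∀ A₁ → WeightSum.Sum ρ₈ refl m A A₁ → wp 9 ρ₈ (bind (var 2 ⊗ arr 12 (lit 0) ⊕ lit 1)
        (bellmanFord 1 4 ⨟ bellmanFord 2 6 ⨟ networkArrays ⨟ dp ⨟ finish)) X Q A₁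
      summed A₁ (ag₁ , w≤U , U≤) =
        wp-bind big 1≤X _ refl big<B
          (wp-seq _ _ (wp-mono _ sweep≤X first-done (BF₁.bellmanFord-correct A₁ (input-cong {A} {A₁} (ag₁ 0 λ ()) input) zeros₁)))
        where
        U big : ℕ
        U = A₁ 12 0
        big = m * U + 1
        big≤L : big ≤ L
        big≤L = ≤-trans (+-monoˡ-≤ 1 (*-monoʳ-≤ m U≤)) mmW<L
        big<B : big < B
        big<B = ≤-<-trans (≤-trans big≤L (≤-trans (m≤m+n L 1) (≤-trans (m≤n*m (L + 1) (2 * L + 3) ⦃ >-nonZero (≤-trans (s≤s z≤n) (m≤n+m 3 (2 * L))) ⦄) (n≤1+n _)))) LL<B
        ρ : ℕ → ℕ
        ρ = ρ₈ [ 9 ↦ big ]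
        module BF₁ = BF ρ refl big U refl big<B (λ e → w≤U e (Fin.toℕ<n e)) (m<m+n (m * U) (s≤s z≤n)) 1 _ 4 _ t₁ refl
        module BF₂ = BF ρ refl big U refl big<B (λ e → w≤U e (Fin.toℕ<n e)) (m<m+n (m * U) (s≤s z≤n)) 2 _ 6 _ t₂ refl
        zeros₁ : ∀ i → A₁ 1 i ≡ 0
        zeros₁ i = trans (cong (λ f → f i) (ag₁ 1 λ ())) (zeros 1 i λ ())
        first-done : ∀ A₂ → Agree 1 A₁ A₂ × Potential big t₁ (λ v → A₂ 1 (toℕ v)) × (∀ {s} → Wk s t₁ → 0 < A₂ 1 (toℕ s)) →
          wp 10 ρ (bellmanFord 2 6 ⨟ networkArrays ⨟ dp ⨟ finish) X Q A₂
        first-done A₂ (ag₂ , π₁ , reach₁) =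
          wp-seq _ _ (wp-mono _ sweep≤X second-done (BF₂.bellmanFord-correct A₂
            (input-cong {A} {A₂} (trans (ag₂ 0 λ ()) (ag₁ 0 λ ())) input)
            (λ i → trans (cong (λ f → f i) (trans (ag₂ 2 λ ()) (ag₁ 2 λ ()))) (zeros 2 i λ ()))))
          where
          second-done : ∀ A₃ → Agree 2 A₂ A₃ × Potential big t₂ (λ v → A₃ 2 (toℕ v)) × (∀ {s} → Wk s t₂ → 0 < A₃ 2 (toℕ s)) →
            wp 10 ρ (networkArrays ⨟ dp ⨟ finish) X Q A₃
          second-done A₃ (ag₃ , π₂ , reach₂) =
            wp-seq _ _ (wp-mono _ ≤-refl arranged (Arr.arrays-correct n≤X m≤X))
            where
            π₁′ : Potential big t₁ (λ v → A₃ 1 (toℕ v))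
            π₁′ = subst (λ f → Potential big t₁ (λ v → f (toℕ v))) (sym (ag₃ 1 λ ())) π₁
            module Arr = Arrange big big≤L A A₃ init (trans (ag₃ 0 λ ()) (trans (ag₂ 0 λ ()) (ag₁ 0 λ ())))
              (λ i → trans (cong (λ f → f i) (trans (ag₃ 9 λ ()) (trans (ag₂ 9 λ ()) (ag₁ 9 λ ())))) (zeros 9 i λ ())) π₁′ π₂
            arranged : ∀ A₉ → Arr.Ready A₉ → wp 10 ρ (dp ⨟ finish) X Q A₉
            arranged A₉ (arrays , zero₉) =
              wp-seq _ _ (wp-mono _ dp≤X (λ A′ (good , solved) → after big A′ (outcome A′ good solved))
                (D.dp-correct A₉ (refl , refl , refl , refl , refl , refl) zero₉))
              where
              module Bld = Build I big (λ v → A₃ 1 (toℕ v)) (λ v → A₃ 2 (toℕ v)) π₁′ π₂ (A₉ 3) (A₉ 4) (A₉ 5) (A₉ 6) (A₉ 7) (A₉ 8)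
              module Net = Bld.WithArrays arrays
              module Theory = NetworkTheory Net.network
              module Ans = Net.Answers (subst (λ f → 0 < f (toℕ s₁)) (sym (ag₃ 1 λ ())) (reach₁ reachable₁)) (reach₂ reachable₂)
              K-top<B : 1 + A₉ 4 n < B
              K-top<B = ≤-<-trans (s≤s (≤-trans (≤-reflexive (trans (Bld.Arrays.K-top arrays) (cong (_* (big + 1)) (Bld.Arrays.F-top arrays))))
                (*-monoˡ-≤ (big + 1) (+-monoʳ-≤ (2 * big) (n≤1+n 2))))) Arr.D<B
              module D = DPCorrect 𝓛 Net.network (λ _ → off) m (toℕ s₁) (toℕ t₁) (toℕ s₂) (toℕ t₂) b big b≤1
                refl refl N⁴<B K-top<B rounds<B
              outcome : ∀ A′ → D.Good A′ → Theory.Solved D.rounds (D.V A′) → Outcome A′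
              outcome A′ (_ , snd) solved =
                let (ne , _) = Ans.complete {D.V A′} solved Ans.some-pair
                    (P , le , chains) = Ans.sound (snd (toℕ s₁) (n + 2) (n + 2) (toℕ t₂) (Net.inner<N s₁) Net.n+2<N Net.n+2<N (Net.inner<N t₂) ne)
                in P , (λ R → ≤-pred (≤-trans le (proj₂ (Ans.complete {D.V A′} solved R)))) ,
                   ≤-antisym (proj₂ (Ans.complete {D.V A′} solved P)) le , chains

-- Writing the answer, and instances without arcs

finishValue finishPair trivialValue trivialPair : Cmd
finishValue = out (lit 0) (arr 9 startE ⊖ lit 1)
-- Entering top behind t₂ gives both lists of vertices the same end marker.
finishPair  = bind startE
  (put 12 (lit 1) (lit 0) ⨟ put 11 (var 7 ⊗ var 10 ⊕ var 6) (var 1) ⨟ emit 10 3 ⨟ emit 11 5)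
trivialValue = out (lit 0) (var 3 ≐ var 5)
trivialPair  = out (lit 0) (lit 1) ⨟ out (lit 1) (var 3) ⨟ out (lit 2) (lit 1) ⨟ out (lit 3) (var 5)

at-++ˡ : ∀ xs ys i → i < length xs → at (xs ++ ys) i ≡ at xs i
at-++ˡ (x ∷ xs) ys zero    _        = refl
at-++ˡ (x ∷ xs) ys (suc i) (s≤s i<) = at-++ˡ xs ys i i<

at-++ʳ : ∀ xs ys i → at (xs ++ ys) (length xs + i) ≡ at ys i
at-++ʳ []       ys i = refl
at-++ʳ (_ ∷ xs) ys i = at-++ʳ xs ys i

module Ends {n m : ℕ} (G : Digraph n m) where
  open Graph G

  starts : ∀ {s t} (p : Wk s t) k → at (map toℕ (vs p) ++ k ∷ []) 0 ≡ toℕ s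
  starts ε       k = refl
  starts (_ ◅ p) k = refl

  end∈ : ∀ {s t} (p : Wk s t) → t ∈ vs p
  end∈ ε       = here refl
  end∈ (_ ◅ p) = there (end∈ p)

  -- The last vertex of a path occurs on it only once, so giving it the end marker as successor
  -- leaves the other links intact.
  chain-end : ∀ {s t f k} (p : Wk s t) → Unique (vs p) → Chain f (map toℕ (vs p)) →
              Chain (f [ toℕ t ↦ k ]) (map toℕ (vs p) ++ k ∷ [])
  chain-end {t = t} {f} {k} ε u one = upd-same f (toℕ t) k ∷ one
  chain-end {s} {t} {f} {k} (_ ◅ ε) (s∉ ∷ u) (e ∷ one) =
    trans (upd-other f k (λ i → All.lookup s∉ (here refl) (Fin.toℕ-injective i))) e ∷ upd-same f (toℕ t) k ∷ one
  chain-end {s} {t} {f} {k} (_ ◅ p@(_ ◅ _)) (s∉ ∷ u) (e ∷ c) =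
    trans (upd-other f k (λ i → All.lookup s∉ (end∈ p) (Fin.toℕ-injective i))) e ∷ chain-end p u c

  names-ordinary : ∀ (l : List (Fin n)) → All (_≢ n) (map toℕ l)
  names-ordinary []      = []
  names-ordinary (v ∷ l) = <⇒≢ (Fin.toℕ<n v) ∷ names-ordinary l

  no-arcs : m ≡ 0 → ∀ {s t} (p : Wk s t) → Σ[ e ∈ s ≡ t ] (vs p ≡ s ∷ [])
  no-arcs refl ε = refl , refl
  no-arcs refl ((() , _) ◅ _)

module Finish (𝓛 : Layout) {n m : ℕ} (I : Instance n m) (bounds : Bounds 𝓛 I) (b : ℕ) (b≤1 : b ≤ 1) where

  open Bounds bounds
  open Layout 𝓛

  open Machine 𝓛
  open Instance I
  open Graph graph
  open Ends graph
  open Solve 𝓛 I bounds b b≤1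

  -- The conjunct `a < off` carries the answer over to the machine, whose memory coincides with
  -- array 0 only below `off`.
  Value Pair : Mem → Set
  Value A = ∃[ P ] (Optimal I P × A 0 0 ≡ common I P)
  Pair A = ∃[ P ] (Optimal I P × (∀ a → a < length (pairList I P) → a < off × A 0 a ≡ at (pairList I P) a))

  0<off : 0 < off
  0<off = ≤-trans (s≤s z≤n) input<off

  finishValue-correct : ∀ {big X A} → 1 ≤ X → Outcome A → wp 10 (ρ₈ [ 9 ↦ big ]) finishValue X Value A
  finishValue-correct {A = A} 1≤X (P , opt , V≡ , _) =
    wp-bounded _ λ bd → wp-out 1≤X _ _ 0<off (≤-<-trans (m∸n≤m (A 9 start) 1) (bd 9 start))
      (P , opt , cong (_∸ 1) V≡)

  -- Without arcs all walks are empty, so every path is its source alone and all pairs have the same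
  -- number of common vertices.
  trivial-pair : m ≡ 0 → Σ[ P ∈ ShortestPair I ] (Optimal I P × vertices₁ I P ≡ s₁ ∷ [] × vertices₂ I P ≡ s₂ ∷ [])
  trivial-pair m≡0 = P , (λ Q → ≤-reflexive (trans (same P) (sym (same Q)))) ,
    proj₂ (no-arcs m≡0 reachable₁) , proj₂ (no-arcs m≡0 reachable₂)
    where
    same : ∀ Q → common I Q ≡ ∣ subset (s₁ ∷ []) ∩ subset (s₂ ∷ []) ∣
    same (P , Q) = cong₂ (λ x y → ∣ subset x ∩ subset y ∣) (proj₂ (no-arcs m≡0 (ShortestPath.walk P))) (proj₂ (no-arcs m≡0 (ShortestPath.walk Q)))
    only : ∀ {s t} (p q : Wk s t) → wt p ≤ wt q
    only p q = ≤-trans (wt≤ (λ e → ⊥-edge e) p) (≤-trans (≤-reflexive (*-zeroʳ (size p))) z≤n)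
      where
      ⊥-edge : ∀ e → Digraph.weight graph e ≤ 0
      ⊥-edge e = contradiction (Fin.toℕ<n e) (λ l → m<n⇒n≢0 l m≡0)
    single : ∀ {s t} (p : Wk s t) → Unique (vs p)
    single p = subst Unique (sym (proj₂ (no-arcs m≡0 p))) ([] ∷ [])
    P : ShortestPair I
    P = record { walk = reachable₁ ; isPath = single reachable₁ ; shortest = λ q _ → only reachable₁ q } ,
        record { walk = reachable₂ ; isPath = single reachable₂ ; shortest = λ q _ → only reachable₂ q }

  trivialValue-correct : ∀ {X A} → m ≡ 0 → 1 ≤ X → wp 9 ρ₈ trivialValue X Value A
  trivialValue-correct m≡0 1≤X =
    let (P , opt , e₁ , e₂) = trivial-pair m≡0 in
    wp-out 1≤X _ _ 0<off (bool<B _) (P , opt , (begin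
      bool (toℕ s₁ ≡ᵇ toℕ s₂)                               ≡⟨ sym (+-identityʳ _) ⟩
      bool (toℕ s₁ ≡ᵇ toℕ s₂) + 0                           ≡⟨ cong (λ k → bool k + 0) decide ⟩
      count (toℕ s₁ ∷ []) (toℕ s₂ ∷ [])                     ≡⟨ sym (card-count (s₁ ∷ []) (subset (s₂ ∷ [])) (toℕ s₂ ∷ []) in⁺ in⁻ ([] ∷ [])) ⟩
      ∣ subset (s₁ ∷ []) ∩ subset (s₂ ∷ []) ∣               ≡⟨ cong₂ (λ x y → ∣ subset x ∩ subset y ∣) (sym e₁) (sym e₂) ⟩
      common I P                                            ∎))
    where
    open ≡-Reasoning
    decide : (toℕ s₁ ≡ᵇ toℕ s₂) ≡ does (toℕ s₁ ∈? (toℕ s₂ ∷ []))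
    decide with toℕ s₁ ≡ᵇ toℕ s₂
    ... | true  = refl
    ... | false = refl
    in⁺ : ∀ x → x ∈ₛ subset (s₂ ∷ []) → toℕ x ∈ toℕ s₂ ∷ []
    in⁺ x x∈ with ∈-subset⁻ (s₂ ∷ []) x∈
    ... | here refl = here refl
    in⁻ : ∀ x → toℕ x ∈ toℕ s₂ ∷ [] → x ∈ₛ subset (s₂ ∷ [])
    in⁻ x (here e) with Fin.toℕ-injective {i = x} {s₂} e
    ... | refl = ∈-subset⁺ {vs = s₂ ∷ []} (here refl)

  trivialPair-correct : ∀ {X A} → m ≡ 0 → 1 ≤ X → wp 9 ρ₈ trivialPair X Pair A
  trivialPair-correct {A = A} m≡0 1≤X =
    let (P , opt , e₁ , e₂) = trivial-pair m≡0 in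
    wp-seq _ _ (wp-out 1≤X _ _ 0<off (bool<B true)
    (wp-seq _ _ (wp-out 1≤X _ _ (header<off 1 (m≤m+n 1 8)) (vertex<B s₁)
    (wp-seq _ _ (wp-out 1≤X _ _ (header<off 2 (m≤m+n 2 7)) (bool<B true)
    (wp-out 1≤X _ _ (header<off 3 (m≤m+n 3 6)) (vertex<B s₂)
      (P , opt , subst₂ (λ x y → ∀ a → a < length ((length x ∷ map toℕ x) ++ (length y ∷ map toℕ y)) → a < off × final a ≡ at ((length x ∷ map toℕ x) ++ (length y ∷ map toℕ y)) a)
         (sym e₁) (sym e₂) entries)))))))
    where
    final : ℕ → ℕ
    final = A 0 [ 0 ↦ 1 ] [ 1 ↦ toℕ s₁ ] [ 2 ↦ 1 ] [ 3 ↦ toℕ s₂ ]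
    entries : ∀ a → a < 4 → a < off × final a ≡ at (1 ∷ toℕ s₁ ∷ 1 ∷ toℕ s₂ ∷ []) a
    entries 0 _ = 0<off , refl
    entries 1 _ = header<off 1 (m≤m+n 1 8) , refl
    entries 2 _ = header<off 2 (m≤m+n 2 7) , refl
    entries 3 _ = header<off 3 (m≤m+n 3 6) , refl
    entries (suc (suc (suc (suc a)))) (s≤s (s≤s (s≤s (s≤s ()))))

  finishPair-correct : ∀ {big X A} → b ≡ 1 → n + 3 ≤ X → Outcome A → wp 10 (ρ₈ [ 9 ↦ big ]) finishPair X Pair A
  finishPair-correct {big} {X} {A} b≡1 N≤X ((P₁ , P₂) , opt , V≡ , chains) =
    wp-bind start 1≤X _ refl start<B
      (wp-seq _ _ (wp-put 1≤X _ _ (bool<B false)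
      (wp-seq _ _ (wp-put 1≤X _ _ n<B
      (wp-seq _ _ (wp-mono _ N*1≤X emit₂
        (Emit.emit-correct 𝓛 ρ 10 _ (λ ()) 3 _ 1≤N N<B l₁ 0 A₂ (names-ordinary v₁)
          (proj₁ (chains b≡1)) (sym (starts p₁ n)) (vertex<B s₁) refl fits₁ short₁)))))))
    where
    ρ : ℕ → ℕ
    ρ = ρ₈ [ 9 ↦ big ] [ 10 ↦ start ]
    p₁ = ShortestPath.walk P₁
    p₂ = ShortestPath.walk P₂
    v₁ = vertices graph p₁
    v₂ = vertices graph p₂
    l₁ = map toℕ v₁
    l₂ = map toℕ v₂
    1≤N : 1 ≤ n + 3
    1≤N = ≤-trans (s≤s z≤n) (m≤n+m 3 n)
    1≤X : 1 ≤ X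
    1≤X = ≤-trans 1≤N N≤X
    N*1≤X : (n + 3) * 1 ≤ X
    N*1≤X = ≤-trans (≤-reflexive (*-identityʳ (n + 3))) N≤X
    vertex<N : ∀ (v : Fin n) → toℕ v < n + 3
    vertex<N v = <-≤-trans (Fin.toℕ<n v) (m≤m+n n 3)
    start<B : start < B
    start<B = <-trans (index-bound (vertex<N s₁) (+-monoʳ-< n ≤-refl) (+-monoʳ-< n ≤-refl) (vertex<N t₂)) N⁴<B
    A₁ A₂ : Mem
    A₁ = upd A 12 1 0
    A₂ = upd A₁ 11 ((n + 3) * start + toℕ t₂) n
    len₁ : length l₁ ≤ n
    len₁ = ≤-trans (≤-reflexive (length-map toℕ v₁)) (unique-length (ShortestPath.isPath P₁))
    len₂ : length l₂ ≤ n
    len₂ = ≤-trans (≤-reflexive (length-map toℕ v₂)) (unique-length (ShortestPath.isPath P₂))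
    short₁ : length l₁ ≤ n + 3
    short₁ = ≤-trans len₁ (m≤m+n n 3)
    total : 1 + length l₁ + 1 + length l₂ ≤ off
    total = ≤-trans (+-mono-≤ (+-monoˡ-≤ 1 (s≤s len₁)) len₂)
      (≤-trans (≤-reflexive (trans (cong (_+ n) (+-comm (suc n) 1)) (cong (λ k → 2 + (n + k)) (sym (+-identityʳ n))))) output≤off)
    fits₁ : 0 + 1 + length l₁ ≤ off
    fits₁ = ≤-trans (≤-trans (m≤m+n _ 1) (m≤m+n (1 + length l₁ + 1) (length l₂))) total
    emit₂ : ∀ A₃ → _ → wp 11 ρ (emit 11 5) X Pair A₃
    emit₂ A₃ em₁ = wp-mono _ N*1≤X output
        (Emit.emit-correct 𝓛 ρ 11 _ (λ ()) 5 _ 1≤N N<B l₂ (1 + length l₁) A₃ (names-ordinary v₂)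
          chain₂ (sym (starts p₂ n)) (vertex<B s₂) E₁.pos total (≤-trans len₂ (m≤m+n n 3)))
      where
      module E₁ = Emit.Emitted em₁
      f : ℕ → ℕ
      f i = A 11 ((n + 3) * start + i)
      drop₂ : Chain f (n + 1 ∷ n ∷ l₂) → Chain f l₂
      drop₂ c with p₂ | c
      ... | ε     | _ ∷ _ ∷ c′ = c′
      ... | _ ◅ _ | _ ∷ _ ∷ c′ = c′
      moved : ∀ i → (f [ toℕ t₂ ↦ n ]) i ≡ A₃ 11 ((n + 3) * start + i)
      moved i = sym (trans (cong (λ g → g ((n + 3) * start + i)) (E₁.same 11 (λ ()) λ ())) here′)
        where
        here′ : (A 11 [ (n + 3) * start + toℕ t₂ ↦ n ]) ((n + 3) * start + i) ≡ (f [ toℕ t₂ ↦ n ]) i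
        here′ with i ≟ toℕ t₂
        ... | yes refl = trans (upd-same (A 11) _ n) (sym (upd-same f (toℕ t₂) n))
        ... | no  i≢   = trans (upd-other (A 11) n (λ e → i≢ (+-cancelˡ-≡ ((n + 3) * start) i (toℕ t₂) e))) (sym (upd-other f n i≢))
      chain₂ : Chain (λ i → A₃ 11 ((n + 3) * start + i)) (l₂ ++ n ∷ [])
      chain₂ = chain-cong (All.tabulate (λ {i} _ → moved i))
        (chain-end p₂ (ShortestPath.isPath P₂) (drop₂ (proj₂ (chains b≡1))))
      output : ∀ A₄ → _ → Pair A₄
      output A₄ em₂ = (P₁ , P₂) , opt ,
          subst₂ (λ x y → ∀ a → a < length ((x ∷ l₁) ++ (y ∷ l₂)) → a < off × A₄ 0 a ≡ at ((x ∷ l₁) ++ (y ∷ l₂)) a)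
            (length-map toℕ v₁) (length-map toℕ v₂) entries
        where
        module E₂ = Emit.Emitted em₂
        B₁ B₂ : List ℕ
        B₁ = length l₁ ∷ l₁
        B₂ = length l₂ ∷ l₂
        entries : ∀ a → a < length (B₁ ++ B₂) → a < off × A₄ 0 a ≡ at (B₁ ++ B₂) a
        entries a a< = (<-≤-trans a< (≤-trans (≤-reflexive (trans (length-++ B₁) (sym (+-assoc (1 + length l₁) 1 (length l₂))))) total)) , value
          where
          value : A₄ 0 a ≡ at (B₁ ++ B₂) a
          value with a <? length B₁
          ... | yes a<₁ = trans (E₂.before a a<₁) (trans (E₁.written a (≤-pred a<₁)) (sym (at-++ˡ B₁ B₂ a a<₁)))
          ... | no  a≮ with m≤n⇒∃[o]m+o≡n (≮⇒≥ a≮)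
          ... | i , refl = trans (E₂.written i (≤-pred (+-cancelˡ-< (length B₁) _ _ (≤-trans a< (≤-reflexive (length-++ B₁))))))
                             (sym (at-++ʳ B₁ B₂ i))

-- Word size, input and running time

tapes : ∀ w t → List (Tape w t)
tapes w zero    = [] ∷ []
tapes w (suc t) = cartesianProductWith _∷_ (allFin (2 ^ w)) (tapes w t)

tapes-unique : ∀ w t → Unique (tapes w t)
tapes-unique w zero    = [] ∷ []
tapes-unique w (suc t) = Unique.cartesianProductWith⁺ _∷_ Vec.∷-injective (Unique.allFin⁺ (2 ^ w)) (tapes-unique w t)

length-product : ∀ {A B C : Set} (f : A → B → C) xs ys → length (cartesianProductWith f xs ys) ≡ length xs * length ys
length-product f []       ys = refl
length-product f (x ∷ xs) ys = trans (length-++ (map (f x) ys)) (cong₂ _+_ (length-map (f x) ys) (length-product f xs ys))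

length-tapes : ∀ w t → length (tapes w t) ≡ (2 ^ w) ^ t
length-tapes w zero    = refl
length-tapes w (suc t) = trans (length-product _∷_ (allFin (2 ^ w)) (tapes w t))
  (cong₂ _*_ (length-tabulate {n = 2 ^ w} (λ i → i)) (length-tapes w t))

-- The algorithm is deterministic and right on every tape, so the list of all tapes is the witness.
certain : ∀ {w t} {E : Tape w t → Set} → (∀ ω → E ω) → Likely {w} {t} E
certain {w} {t} e = tapes w t , tapes-unique w t , All.tabulate (λ {ω} _ → e ω) ,
  *-mono-≤ {2} {3} (n≤1+n 2) (≤-reflexive (sym (length-tapes w t)))

n<2^bits : ∀ n → n < 2 ^ (1 + ⌊log₂ n ⌋)
n<2^bits n with n <? 2 ^ (1 + ⌊log₂ n ⌋)
... | yes l = l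
... | no  l = contradiction (⌊log₂⌋-mono-≤ (≮⇒≥ l)) (<⇒≱ (≤-reflexive (sym (⌊log₂[2^n]⌋≡n (1 + ⌊log₂ n ⌋)))))

vertices≥1 : ∀ {n m} → Instance n m → 1 ≤ n
vertices≥1 I = ≤-trans (s≤s z≤n) (Fin.toℕ<n (Instance.s₁ I))

-- Arcs with equal ends coincide. Hence m is polynomial in n, and words of O(log n) bits can address
-- whatever is indexed by arcs.
arcs≤n² : ∀ {n m} (G : Digraph n m) → m ≤ n * n
arcs≤n² G = Fin.injective⇒≤ {f = λ e → combine (src e) (tgt e)} (λ {e} {f} eqn →
    let (s , t) = Fin.combine-injective (src e) (tgt e) (src f) (tgt f) eqn in distinct s t)
  where open Digraph G

module _ {k : ℕ} (f g h : Fin k → ℕ) where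

  triples : ∀ {m} → (Fin m → Fin k) → List ℕ
  triples i = concatMap (λ e → f e ∷ g e ∷ h e ∷ []) (tabulate i)

  at-triples : ∀ {m} (i : Fin m → Fin k) e →
    at (triples i) (3 * toℕ e) ≡ f (i e) × at (triples i) (1 + 3 * toℕ e) ≡ g (i e) × at (triples i) (2 + 3 * toℕ e) ≡ h (i e)
  at-triples i Fin.zero = refl , refl , refl
  at-triples i (Fin.suc e) =
    subst (λ a → at (triples i) a ≡ f (i (Fin.suc e)) × at (triples i) (1 + a) ≡ g (i (Fin.suc e)) × at (triples i) (2 + a) ≡ h (i (Fin.suc e)))
      (sym (*-suc 3 (toℕ e))) (at-triples (λ e → i (Fin.suc e)) e)

  triples-bound : ∀ {m B} (i : Fin m → Fin k) → (∀ e → f e < B × g e < B × h e < B) → All (_< B) (triples i)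
  triples-bound {zero}  i b = []
  triples-bound {suc m} i b = let (x , y , z) = b (i Fin.zero) in x ∷ y ∷ z ∷ triples-bound (λ e → i (Fin.suc e)) b

  length-triples : ∀ {m} (i : Fin m → Fin k) → length (triples i) ≡ 3 * m
  length-triples {zero}  i = refl
  length-triples {suc m} i = trans (cong (3 +_) (length-triples (λ e → i (Fin.suc e)))) (sym (*-suc 3 m))

at-bound : ∀ {B xs} → 0 < B → All (_< B) xs → ∀ i → at xs i < B
at-bound 0<B []       i       = 0<B
at-bound 0<B (x ∷ _)  zero    = x
at-bound 0<B (_ ∷ xs) (suc i) = at-bound 0<B xs i

at-beyond : ∀ xs i → length xs ≤ i → at xs i ≡ 0
at-beyond []       i       _        = refl
at-beyond (x ∷ xs) (suc i) (s≤s le) = at-beyond xs i le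

inputMem : ∀ {n m} → Instance n m → Mem
inputMem I zero    i = at (inputList I) i
inputMem I (suc _) i = 0

initial-input : ∀ {n m} (I : Instance n m) → Initial I (inputMem I)
initial-input {m = m} I = record
  { in-n = refl ; in-m = refl ; in-s₁ = refl ; in-t₁ = refl ; in-s₂ = refl ; in-t₂ = refl
  ; in-source = λ e → proj₁ (entry e)
  ; in-target = λ e → proj₁ (proj₂ (entry e))
  ; in-weight = λ e → proj₂ (proj₂ (entry e))
  ; zeros = λ { zero i j≢0 → contradiction refl j≢0 ; (suc j) i _ → refl } }
  where
  open Digraph (Instance.graph I)
  entry = at-triples (λ e → toℕ (src e)) (λ e → toℕ (tgt e)) weight (λ (e : Fin m) → e)

-- Register 0 becomes 4 * (n + m) + 16, an address beyond input and output.
prologue : Program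
prologue =
  instr (load 1 0) ⨾ instr (const 2 1) ⨾ instr (load 2 2) ⨾ instr (arith add 0 1 2) ⨾
  instr (arith add 0 0 0) ⨾ instr (arith add 0 0 0) ⨾ instr (const 1 16) ⨾ instr (arith add 0 0 1)

program : Cmd → Program
program c = prologue ⨾ comp 1 c

β-power : ∀ ℓ k d → β ((2 ^ ℓ) ^ k) d ≡ 2 ^ (ℓ * (k * 2 ^ d))
β-power ℓ k zero    = trans (β-zero ((2 ^ ℓ) ^ k)) (trans (^-*-assoc 2 ℓ k) (cong (λ x → 2 ^ (ℓ * x)) (sym (*-identityʳ k))))
β-power ℓ k (suc d) = trans (β-suc ((2 ^ ℓ) ^ k) d)
  (trans (cong₂ _*_ (β-power ℓ k d) (β-power ℓ k d)) (trans (sym (^-distribˡ-+-* 2 x x)) (cong (2 ^_) (sym double))))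
  where
  open +-*-Solver
  x = ℓ * (k * 2 ^ d)
  double : ℓ * (k * (2 * 2 ^ d)) ≡ x + x
  double = solve 3 (λ a b c → a :* (b :* (con 2 :* c)) := a :* (b :* c) :+ a :* (b :* c)) refl ℓ k (2 ^ d)

opaque
  -- With R = 2 ^ ℓ above n, cells are below R ^ (20 + 2 c): the 2 c is due to `K`, quadratic in a
  -- multiple of the weights, and 20 leaves room for the powers of n, m and the constants. The
  -- factor 2 ^ d is the growth of `β`; opaque for the same reason.
  scaledSize : ℕ → ℕ → ℕ
  scaledSize c d = (20 + (c + c)) * 2 ^ d

  β-scaledSize : ∀ c d ℓ → β ((2 ^ ℓ) ^ (20 + (c + c))) d ≤ 2 ^ (scaledSize c d * ℓ)
  β-scaledSize c d ℓ = ≤-reflexive (trans (β-power ℓ (20 + (c + c)) d) (cong (2 ^_) (*-comm ℓ ((20 + (c + c)) * 2 ^ d))))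

wordSize : ℕ → ℕ
wordSize c = scaledSize c depthLimit

module Sizes (R c n m : ℕ) (2≤R : 2 ≤ R) (n≤R : n ≤ R) (m≤n² : m ≤ n * n) where

  -- A calculus of degrees in R: a product adds the degrees, and a sum costs one degree because 2 ≤
  -- R. The wrapper keeps e and x visible to unification.
  record Fits (e x : ℕ) : Set where
    constructor fits
    field
      bound : x ≤ R ^ e

  open Fits

  infixl 6 _⊞_
  infixl 7 _⊠_

  R^-mono : ∀ {d e} → d ≤ e → R ^ d ≤ R ^ e
  R^-mono = ^-monoʳ-≤ R ⦃ >-nonZero (≤-trans (s≤s z≤n) 2≤R) ⦄

  _⊞_ : ∀ {e x y} → Fits e x → Fits e y → Fits (1 + e) (x + y)
  _⊞_ {e} (fits p) (fits q) = fits (≤-trans (+-mono-≤ p q)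
    (≤-trans (≤-reflexive (cong (R ^ e +_) (sym (+-identityʳ (R ^ e))))) (*-monoˡ-≤ (R ^ e) 2≤R)))

  _⊠_ : ∀ {d e x y} → Fits d x → Fits e y → Fits (d + e) (x * y)
  _⊠_ {d} {e} (fits p) (fits q) = fits (≤-trans (*-mono-≤ p q) (≤-reflexive (sym (^-distribˡ-+-* R d e))))

  up : ∀ {d e x} → d ≤ e → Fits d x → Fits e x
  up d≤e (fits p) = fits (≤-trans p (R^-mono d≤e))

  lit≤ : ∀ e {k} → k ≤ 2 ^ e → Fits e k
  lit≤ e k≤ = fits (≤-trans k≤ (^-monoˡ-≤ e 2≤R))

  power : ∀ e → Fits e (R ^ e)
  power e = fits ≤-refl

  fits-n : Fits 1 n
  fits-n = fits (≤-trans n≤R (≤-reflexive (sym (*-identityʳ R))))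

  fits-m : Fits 2 m
  fits-m = fits (≤-trans m≤n² (bound (fits-n ⊠ fits-n)))

  k₀ B off W L : ℕ
  k₀ = 20 + (c + c)
  B = R ^ k₀
  off = 4 * (n + m) + 16
  W = R ^ c
  L = R ^ (5 + c)

  strict : ∀ {e x} → e < k₀ → Fits e x → x < B
  strict e<k₀ (fits p) = ≤-<-trans p (^-monoʳ-< R 2≤R e<k₀)

  small : ∀ {e x} → e < 20 → Fits e x → x < B
  small e<20 = strict (<-≤-trans e<20 (m≤m+n 20 (c + c)))

  16≤B : 16 ≤ B
  16≤B = bound (up {4} {k₀} (m≤m+n 4 (16 + (c + c))) (lit≤ 4 ≤-refl))

  off<B : off < B
  off<B = small (m≤m+n 7 13) (lit≤ 2 ≤-refl ⊠ (up (s≤s z≤n) fits-n ⊞ fits-m) ⊞ lit≤ 5 (m≤m+n 16 16))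

  mW : Fits (2 + c) (m * W)
  mW = fits-m ⊠ power c

  mW<B : m * W < B
  mW<B = strict (+-mono-<-≤ (m≤m+n 3 17) (m≤m+n c c)) mW

  mmW<L : m * (m * W) + 1 ≤ L
  mmW<L = bound (fits-m ⊠ mW ⊞ up z≤n (lit≤ 0 ≤-refl))

  LL<B : 1 + (2 * L + 3) * (L + 1) < B
  LL<B = strict e< (up z≤n (lit≤ 0 ≤-refl) ⊞
      (lit≤ 1 ≤-refl ⊠ power (5 + c) ⊞ up (s≤s (s≤s z≤n)) (lit≤ 2 (n≤1+n 3))) ⊠
      (power (5 + c) ⊞ up z≤n (lit≤ 0 ≤-refl)))
    where
    open +-*-Solver
    e< : suc ((7 + c) + (6 + c)) < k₀
    e< = ≤-trans (m≤m+n _ 5) (≤-reflexive (solve 1 (λ c →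
      con 2 :+ ((con 7 :+ c) :+ (con 6 :+ c)) :+ con 5 := con 20 :+ (c :+ c)) refl c))

  fits-N : Fits 3 (n + 3)
  fits-N = up (s≤s z≤n) fits-n ⊞ lit≤ 2 (n≤1+n 3)

  N⁴<B : (n + 3) * ((n + 3) * ((n + 3) * (n + 3))) < B
  N⁴<B = small (m≤m+n 13 7) (fits-N ⊠ (fits-N ⊠ (fits-N ⊠ fits-N)))

  rounds<B : 2 * m + 4 < B
  rounds<B = small (m≤m+n 5 15) (lit≤ 1 ≤-refl ⊠ fits-m ⊞ lit≤ 3 (m≤m+n 4 4))

  input<off : 9 + 3 * m < off
  input<off = ≤-trans (+-mono-≤ (m≤m+n 10 6) (≤-trans (*-monoˡ-≤ m (n≤1+n 3)) (*-monoʳ-≤ 4 (m≤n+m m n)))) (≤-reflexive (+-comm 16 _))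

  output≤off : 2 + 2 * n ≤ off
  output≤off = ≤-trans (+-mono-≤ (m≤m+n 2 14) (≤-trans (*-monoˡ-≤ n (m≤m+n 2 2)) (*-monoʳ-≤ 4 (m≤m+n n m)))) (≤-reflexive (+-comm 16 _))

module Assemble (c ℓ′ : ℕ) {n m : ℕ} (I : Instance n m) (n<2^ℓ : n < 2 ^ suc ℓ′)
  (light : ∀ e → Digraph.weight (Instance.graph I) e < 2 ^ (c * suc ℓ′)) (b : ℕ) (b≤1 : b ≤ 1) where

  open Instance I
  open Digraph graph

  ℓ R : ℕ
  ℓ = suc ℓ′
  R = 2 ^ ℓ

  2≤R : 2 ≤ R
  2≤R = m≤m*n 2 (2 ^ ℓ′) ⦃ m^n≢0 2 ℓ′ ⦄

  open Sizes R c n m 2≤R (<⇒≤ n<2^ℓ) (arcs≤n² graph)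

  layout : Layout
  layout = record { w = wordSize c * ℓ ; B = B ; off = off ; 16≤B = 16≤B ; off<B = off<B ; β≤2^w = β-scaledSize c depthLimit ℓ }

  open Layout layout using (w)

  weight<W : ∀ e → weight e < W
  weight<W e = <-≤-trans (light e) (≤-reflexive (trans (cong (2 ^_) (*-comm c ℓ)) (sym (^-*-assoc 2 ℓ c))))

  bounds : Bounds layout I
  bounds = record
    { W = W ; L = L ; weight≤W = λ e → <⇒≤ (weight<W e) ; input<off = input<off ; output≤off = output≤off
    ; mmW<L = mmW<L ; LL<B = LL<B ; mW<B = mW<B ; N⁴<B = N⁴<B ; rounds<B = rounds<B }

  open Machine layout
  open Solve layout I bounds b b≤1
  open Finish layout I bounds b b≤1

  open Semantics w

  M₀ : ℕ → ℕ
  M₀ a = trunc w (at (inputList I) a)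

  entries<B : All (_< B) (inputList I)
  entries<B = n<B ∷ ≤-<-trans (m≤m+n m 3) m+3<B ∷ vertex<B s₁ ∷ vertex<B t₁ ∷ vertex<B s₂ ∷ vertex<B t₂ ∷
    triples-bound (λ e → toℕ (src e)) (λ e → toℕ (tgt e)) weight (λ e → e)
      (λ e → vertex<B (src e) , vertex<B (tgt e) , <-≤-trans (weight<W e) (R^-mono (≤-trans (m≤m+n c c) (m≤n+m (c + c) 20))))

  M₀≡ : ∀ a → M₀ a ≡ at (inputList I) a
  M₀≡ a = trunc-id (<-≤-trans (at-bound (≤-trans (s≤s z≤n) 16≤B) entries<B a) B≤2^w)

  memRel : MemRel M₀ (inputMem I)
  memRel = record
    { low = λ a _ → M₀≡ a
    ; high = λ { (suc j) i _ _ → trans (M₀≡ (off + (16 * i + suc j))) (at-beyond (inputList I) (off + (16 * i + suc j)) (≤-trans short (m≤m+n off _))) }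
    ; bounded = λ { zero i → at-bound (≤-trans (s≤s z≤n) 16≤B) entries<B i ; (suc j) i → ≤-trans (s≤s z≤n) 16≤B } }
    where
    short : length (inputList I) ≤ off
    short = ≤-trans (≤-reflexive (cong (6 +_) (length-triples (λ e → toℕ (src e)) (λ e → toℕ (tgt e)) weight {m} (λ e → e))))
      (≤-trans (+-monoˡ-≤ (3 * m) (m≤m+n 6 4)) input<off)

  prologue-run : ∀ ω → ∃[ f ] (Run prologue ⟨ (λ _ → 0) , M₀ , ω ⟩ 8 ⟨ f , M₀ , ω ⟩ × f 0 ≡ off)
  prologue-run ω = f₈ ,
      seq (instr load) (seq (instr const) (seq (instr load) (seq (instr arith) (seq (instr arith) (seq (instr arith)
        (seq (instr const) (instr arith))))))) , e₈
    where
    f₁ f₂ f₃ f₄ f₅ f₆ f₇ f₈ : ℕ → ℕ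
    f₁ = (λ _ → 0) [ 1 ↦ M₀ 0 ]
    f₂ = f₁ [ 2 ↦ trunc w 1 ]
    f₃ = f₂ [ 2 ↦ M₀ (f₂ 2) ]
    f₄ = f₃ [ 0 ↦ evalOp w add (f₃ 1) (f₃ 2) ]
    f₅ = f₄ [ 0 ↦ evalOp w add (f₄ 0) (f₄ 0) ]
    f₆ = f₅ [ 0 ↦ evalOp w add (f₅ 0) (f₅ 0) ]
    f₇ = f₆ [ 1 ↦ trunc w 16 ]
    f₈ = f₇ [ 0 ↦ evalOp w add (f₇ 0) (f₇ 1) ]
    fit : ∀ {x} → x ≤ off → trunc w x ≡ x
    fit x≤ = trunc-id (<-≤-trans (≤-<-trans x≤ off<B) B≤2^w)
    n+m≤ : ∀ k → k ≤ 4 → k * (n + m) ≤ off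
    n+m≤ k k≤4 = ≤-trans (*-monoˡ-≤ (n + m) k≤4) (m≤m+n _ 16)
    e₄ : f₄ 0 ≡ n + m
    e₄ = trans (cong₂ (λ x y → trunc w (x + y)) (M₀≡ 0) (trans (cong M₀ (trunc-id (<-≤-trans (bool<B true) B≤2^w))) (M₀≡ 1)))
           (fit (≤-trans (≤-reflexive (sym (*-identityˡ (n + m)))) (n+m≤ 1 (s≤s z≤n))))
    e₅ : f₅ 0 ≡ 2 * (n + m)
    e₅ = trans (cong₂ (λ x y → trunc w (x + y)) e₄ e₄) (trans (cong (λ x → trunc w ((n + m) + x)) (sym (+-identityʳ (n + m)))) (fit (n+m≤ 2 (m≤m+n 2 2))))
    e₆ : f₆ 0 ≡ 4 * (n + m)
    e₆ = trans (cong₂ (λ x y → trunc w (x + y)) e₅ e₅)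
           (trans (cong (trunc w) (sym (*-distribʳ-+ (n + m) 2 2))) (fit (n+m≤ 4 ≤-refl)))
    e₈ : f₈ 0 ≡ off
    e₈ = trans (cong₂ (λ x y → trunc w (x + y)) e₆ (trunc-id 16<2^w)) (fit ≤-refl)

  Halts : Cmd → ℕ → ((ℕ → ℕ) → Set) → List ℕ → Set
  Halts c X Post ω = ∃[ t ] ∃[ τ ] (Run (program c) ⟨ (λ _ → 0) , M₀ , ω ⟩ t τ × t ≤ 8 + κ c * X × Post (mem τ))

  halts : ∀ {c X} {Q : Mem → Set} {Post : (ℕ → ℕ) → Set} → wp 1 (λ _ → off) c X Q (inputMem I) →
    (∀ {M A} → MemRel M A → Q A → Post M) → ∀ ω → Halts c X Post ω
  halts h post ω =
    let (f , r , f0) = prologue-run ω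
        E = record { positive = s≤s z≤n ; offset = refl
                   ; agree = λ { zero _ → f0 ; (suc r) (s≤s ()) } ; small = λ { zero _ → off<B ; (suc r) (s≤s ()) } }
        (d , f′ , M′ , A′ , r′ , d≤ , _ , R′ , q) = wp.run h f M₀ ω E memRel
    in 8 + d , ⟨ f′ , M′ , ω ⟩ , seq r r′ , +-monoʳ-≤ 8 d≤ , post R′ q

  solve : ∀ {finish trivial X Q} → 1 ≤ X → (1 ≤ m → dpTime ≤ X) →
    (m ≡ 0 → wp 9 ρ₈ trivial X Q (inputMem I)) →
    (1 ≤ m → ∀ big A → Outcome A → wp 10 (ρ₈ [ 9 ↦ big ]) finish X Q A) →
    wp 1 (λ _ → off) (solver b finish trivial) X Q (inputMem I)
  solve 1≤X dp≤X h₀ h = solver-correct (initial-input I) 1≤X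
    (λ 1≤m → Nontrivial.search-correct 1≤m (initial-input I) (dp≤X 1≤m) (h 1≤m)) h₀

  value-halts : ∀ {X} → 1 ≤ X → (1 ≤ m → dpTime ≤ X) → ∀ ω →
    Halts (solver b finishValue trivialValue) X (MinValue I) ω
  value-halts 1≤X dp≤X = halts (solve 1≤X dp≤X (λ m≡0 → trivialValue-correct m≡0 1≤X) (λ _ big A o → finishValue-correct 1≤X o))
    (λ { R (P , opt , e) → P , opt , trans (MemRel.low R 0 0<off) e })

  pair-halts : ∀ {X} → b ≡ 1 → 1 ≤ X → (1 ≤ m → dpTime ≤ X) → ∀ ω →
    Halts (solver b finishPair trivialPair) X (MinPair I) ω
  pair-halts {X} b≡1 1≤X dp≤X = halts (solve 1≤X dp≤X (λ m≡0 → trivialPair-correct m≡0 1≤X)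
      (λ 1≤m big A o → finishPair-correct b≡1 (≤-trans N≤dpTime (dp≤X 1≤m)) o))
    (λ { R (P , opt , e) → P , opt , λ a a< → trans (MemRel.low R a (proj₁ (e a a<))) (proj₂ (e a a<)) })

linear : ∀ {x} a d → 1 ≤ x → a * x + d ≤ (a + d) * x
linear {x} a d 1≤x = ≤-trans (+-monoʳ-≤ (a * x) (m≤m*n d x ⦃ >-nonZero 1≤x ⦄)) (≤-reflexive (sym (*-distribʳ-+ x a d)))

shifted : ∀ {x} d → 1 ≤ x → x + d ≤ (1 + d) * x
shifted {x} d 1≤x = ≤-trans (≤-reflexive (cong (_+ d) (sym (*-identityˡ x)))) (linear 1 d 1≤x)

-- For n, m ≥ 1 additive constants are absorbed: 2 m + 4 ≤ 6 m, m + 3 ≤ 4 m and n + 3 ≤ 4 n, whence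
-- 1536 = 6 · 4 · 4³. Copying a block costs another factor 5 n, which leads to 7680 for pairs.
value-time : ∀ n m → 1 ≤ n → 1 ≤ m →
  (2 * m + 4) * ((m + 3) * ((n + 3) * ((n + 3) * ((n + 3) * (suc (0 * (n + 3)) * 1))))) ≤ 1536 * (m ^ 2 * n ^ 3)
value-time n m 1≤n 1≤m = ≤-trans (*-mono-≤ (linear 2 4 1≤m) (*-mono-≤ (shifted 3 1≤m)
    (*-mono-≤ (shifted 3 1≤n) (*-mono-≤ (shifted 3 1≤n) (*-mono-≤ (shifted 3 1≤n) (≤-refl {1}))))))
  (≤-reflexive (solve 2 (λ n m → (con 6 :* m) :* ((con 4 :* m) :* ((con 4 :* n) :* ((con 4 :* n) :* ((con 4 :* n) :* con 1)))) :=
    con 1536 :* (m :^ 2 :* n :^ 3)) refl n m))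
  where open +-*-Solver

pair-time : ∀ n m → 1 ≤ n → 1 ≤ m →
  (2 * m + 4) * ((m + 3) * ((n + 3) * ((n + 3) * ((n + 3) * (suc (1 * (n + 3)) * 1))))) ≤ 7680 * (m ^ 2 * n ^ 4)
pair-time n m 1≤n 1≤m = ≤-trans (*-mono-≤ (linear 2 4 1≤m) (*-mono-≤ (shifted 3 1≤m)
    (*-mono-≤ (shifted 3 1≤n) (*-mono-≤ (shifted 3 1≤n) (*-mono-≤ (shifted 3 1≤n) payload)))))
  (≤-reflexive (solve 2 (λ n m → (con 6 :* m) :* ((con 4 :* m) :* ((con 4 :* n) :* ((con 4 :* n) :* ((con 4 :* n) :* (con 5 :* n))))) :=
    con 7680 :* (m :^ 2 :* n :^ 4)) refl n m))
  where
  open +-*-Solver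
  payload : suc (1 * (n + 3)) * 1 ≤ 5 * n
  payload = ≤-trans (≤-reflexive (trans (*-identityʳ _) (trans (cong suc (*-identityˡ (n + 3))) (sym (+-suc n 3))))) (shifted 4 1≤n)

-- The 8 steps of the prologue are absorbed by the factor 1 + x, which never vanishes.
budget : ∀ {t} K C₀ x → t ≤ 8 + K * (C₀ * (1 + x)) → t ≤ (8 + K * C₀) * (1 + x)
budget {t} K C₀ x t≤ = ≤-trans t≤ (≤-trans
  (+-mono-≤ (m≤m*n 8 (1 + x)) (≤-reflexive (sym (*-assoc K C₀ (1 + x)))))
  (≤-reflexive (sym (*-distribʳ-+ (1 + x) 8 (K * C₀)))))

within-time : ∀ {Correct : Answer} {f} (C₀ : ℕ) (p : Cmd) →
  (∀ c {n m} (I : Instance n m) (light : ∀ e → Digraph.weight (Instance.graph I) e < 2 ^ bits c n) → ∀ ω →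
    ∃[ t ] ∃[ τ ] (Semantics.Run (bits (wordSize c) n) (program p) (initial (bits (wordSize c) n) I ω) t τ ×
      t ≤ 8 + κ p * (C₀ * (1 + f n m)) × Correct I (mem τ))) →
  SolvableInTime Correct f
within-time {f = f} C₀ p h c =
  wordSize c , program p , 8 + κ p * C₀ ,
  λ {n} {m} I light →
    let run = λ ω → let (t , τ , r , t≤ , post) = h c I light (map toℕ (toList ω)) in
                    t , τ , r , budget (κ p) C₀ (f n m) t≤ , post
    in (λ ω → let (t , τ , r , t≤ , _) = run ω in t , τ , r , t≤ , _) , certain {bits (wordSize c) n} run

theorem2 : SolvableInTime MinValue (λ n m → m ^ 2 * n ^ 3)
    × SolvableInTime MinPair (λ n m → m ^ 2 * n ^ 4)
theorem2 =
  within-time 1536 (solver 0 finishValue trivialValue) (λ c {n} {m} I light →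
    Assemble.value-halts c ⌊log₂ n ⌋ I (n<2^bits n) light 0 z≤n (s≤s z≤n)
      (λ 1≤m → ≤-trans (value-time n m (vertices≥1 I) 1≤m) (*-monoʳ-≤ 1536 (n≤1+n _)))) ,
  within-time 7680 (solver 1 finishPair trivialPair) (λ c {n} {m} I light →
    Assemble.pair-halts c ⌊log₂ n ⌋ I (n<2^bits n) light 1 ≤-refl refl (s≤s z≤n)
      (λ 1≤m → ≤-trans (pair-time n m (vertices≥1 I) 1≤m) (*-monoʳ-≤ 7680 (n≤1+n _))))
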